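{- For any $p=p(n)\in[0,1]$, with probability tending to $1$ as $n\to\infty$, the random graph $G=G_{n,p}$ satisfies $\tau(G)\le 2\nu(G)$.
   Context: $G_{n,p}$ is the binomial random graph on vertex set $[n]$ in which each of the $\binom n2$ possible edges is present independently with probability $p$. For a finite graph $H$, $\nu(H)$ is the maximum number of pairwise edge-disjoint triangles in $H$, and $\tau(H)$ is the minimum size of a set $F$ of edges of $H$ such that every triangle of $H$ contains an edge of $F$.
   Formalization: The edge probabilities p(n) are taken to be rational numbers in [0,1] instead of arbitrary real numbers in [0,1]. -}

module Defs where

open import Data.Bool using (Bool; true; false; if_then_else_)
open import Data.Nat as ℕ using (ℕ; zero; suc; _⊔_; _⊓_; _∸_)
open import Data.Fin as Fin using (Fin)
open import Data.Product using (_×_; _,_; proj₁; proj₂)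
open import Data.Product.Properties using (≡-dec)
open import Data.List using (List; []; _∷_; [_]; _++_; map; filter; length; foldr; allFin; cartesianProduct)
open import Data.List.Relation.Unary.All as All using (All)
open import Data.List.Relation.Unary.Any as Any using (Any)
open import Data.List.Relation.Unary.AllPairs using (AllPairs; allPairs?)
open import Relation.Nullary using (Dec; yes; no; ¬_; does)

open import Relation.Nullary.Decidable using (_×-dec_; ¬?)
open import Relation.Binary.PropositionalEquality using (_≡_)
open import Data.Rational as ℚ using (ℚ; 0ℚ; 1ℚ; _*_; _+_; _-_)

-- Graphs on the vertex set Fin n (standing in for [n]).
-- An (unordered) edge {i,j} is represented canonically as the pair (i , j)
-- with i < j.  A graph is its list of edges (a sublist of `pairs n`).

Edge : ℕ → Set
Edge n = Fin n × Fin n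

_≟ₑ_ : ∀ {n} (e f : Edge n) → Dec (e ≡ f)
_≟ₑ_ = ≡-dec Fin._≟_ Fin._≟_

_∈ₑ?_ : ∀ {n} (e : Edge n) (G : List (Edge n)) → Dec (Any (e ≡_) G)
e ∈ₑ? G = Any.any? (e ≟ₑ_) G

pairs : (n : ℕ) → List (Edge n)
pairs n = filter (λ e → proj₁ e Fin.<? proj₂ e) (cartesianProduct (allFin n) (allFin n))

-- all sublists (each subset of a duplicate-free list exactly once)
sublists : ∀ {a} {A : Set a} → List A → List (List A)
sublists []       = [ [] ]
sublists (x ∷ xs) = map (x ∷_) (sublists xs) ++ sublists xs

graphs : (n : ℕ) → List (List (Edge n))
graphs n = sublists (pairs n)

Triple : ℕ → Set
Triple n = Fin n × Fin n × Fin n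

tedges : ∀ {n} → Triple n → List (Edge n)
tedges (i , j , k) = (i , j) ∷ (i , k) ∷ (j , k) ∷ []

triples : (n : ℕ) → List (Triple n)
triples n = filter (λ t → (proj₁ t Fin.<? proj₁ (proj₂ t)) ×-dec (proj₁ (proj₂ t) Fin.<? proj₂ (proj₂ t)))
                   (cartesianProduct (allFin n) (cartesianProduct (allFin n) (allFin n)))

triangles : ∀ {n} → List (Edge n) → List (Triple n)
triangles {n} G = filter (λ t → All.all? (_∈ₑ? G) (tedges t)) (triples n)

EdgeDisjoint : ∀ {n} → Triple n → Triple n → Set
EdgeDisjoint t u = All (λ e → ¬ Any (e ≡_) (tedges u)) (tedges t)

edgeDisjoint? : ∀ {n} (t u : Triple n) → Dec (EdgeDisjoint t u)
edgeDisjoint? t u = All.all? (λ e → ¬? (e ∈ₑ? tedges u)) (tedges t)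

maxℕ : List ℕ → ℕ
maxℕ = foldr _⊔_ 0

ν : ∀ {n} → List (Edge n) → ℕ
ν G = maxℕ (map (λ T → if does (allPairs? edgeDisjoint? T) then length T else 0)
                (sublists (triangles G)))

Covers : ∀ {n} → List (Edge n) → List (Edge n) → Set
Covers G F = All (λ t → Any (λ e → Any (e ≡_) F) (tedges t)) (triangles G)

covers? : ∀ {n} (G F : List (Edge n)) → Dec (Covers G F)
covers? G F = All.all? (λ t → Any.any? (_∈ₑ? F) (tedges t)) (triangles G)

-- τ(G): minimum size of a set F ⊆ E(G) meeting every triangle of G
-- (E(G) itself always qualifies, so length G is a valid default)
τ : ∀ {n} → List (Edge n) → ℕ
τ G = foldr _⊓_ (length G)
        (map (λ F → if does (covers? G F) then length F else length G) (sublists G))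

_^ℚ_ : ℚ → ℕ → ℚ
x ^ℚ zero  = 1ℚ
x ^ℚ suc k = x * (x ^ℚ k)

weight : (n : ℕ) → ℚ → List (Edge n) → ℚ
weight n p G = (p ^ℚ length G) * ((1ℚ - p) ^ℚ (length (pairs n) ∸ length G))

badProb : (n : ℕ) → ℚ → ℚ
badProb n p = foldr _+_ 0ℚ
  (map (λ G → if does (τ G ℕ.≤? 2 ℕ.* ν G) then 0ℚ else weight n p G) (graphs n))

{-# OPTIONS --safe #-}
-- Write d for n p², the order of the expected codegree of a pair of vertices. Changing one edge changes τ and ν by at
-- most one, so by Efron–Stein and Chebyshev it is enough that the mean of X = 2ν - τ is of larger order than the
-- square root of n² p.
--
-- For small d, deleting intersecting triangles gives X ≥ T - P, with T the number of triangles and P that of ordered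
-- pairs of triangles sharing an edge. This suffices if n⁴ p⁵ is large; if n⁴ p⁵ is bounded, then with high probability
-- no triangle shares edges with two others, and again X ≥ 0.
--
-- Otherwise, fix a balanced cut. The uncut edges having a common neighbour across the cut, together with an edge of each
-- uncut triangle none of whose edges is of this kind, form a cover, so that asymptotically
--   E τ ≤ ((1 - e^(-d/2)) / 2 + d e^(-3d/2) / 12) n² p / 2.
-- In the random greedy packing a random triangle is removed, if present, at every step. The probability that a set of m
-- edges survives obeys an exact linear hierarchy in which m is coupled to m + 2, whose bounded solutions are
-- asymptotically x^m, up to a factor for the triangles inside the set, where x' = - d x³. Hence
--   E ν ≥ (1 - (1 + 2 d)^(-1/2)) n² p / 6
-- asymptotically, and the inequality between the two bounds is checked on a grid of values of d. When d is large,
-- τ is at most half the number of edges, and the edges are split at random into classes with d between 9 and 36.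
module Submission where

-- The hierarchy for the greedy packing is not closed: an error bound δ λ^m for sets of m edges
-- feeds on the bound for m + 2, so that λ' = Δ λ³, where Δ bounds d, and λ blows up in finite time.
-- The process is therefore run in short blocks, after each of which the trivial bound 1 on the
-- error turns η² 256^m back into η 16^m. The number of blocks depends on Δ alone and the error fed
-- in is proportional to p. Hence d has to be bounded for the threshold on n to be uniform in p,
-- which is why large d goes through a splitting of the edges.
--
-- Triangles are drawn with replacement, so a triangle inside a surviving set must never have been
-- drawn. This has probability y = (1 - ε)^r after r steps, where ε is the inverse of the number of
-- triangles, and the limit equation is x' = - d y x³ in the time r ε. With 1 - y as the new time,
-- which stays below 1, it loses the factor y; hence the limit (1 + 2 d)^(-1/2).
--
-- All numbers are rational: exponentials are replaced by powers, controlled by Bernoulli's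
-- inequality, and square roots by comparisons of squares.

open import Defs
open import Data.Bool using (Bool; true; false; if_then_else_)
open import Data.Bool.Properties using () renaming (_≟_ to _≟ᵇ_)
open import Data.Empty using (⊥; ⊥-elim)
open import Data.Fin as Fin using (Fin; toℕ)
import Data.Fin.Properties as Finₚ
open import Data.Integer as ℤ using (ℤ)
import Data.Integer.Properties as ℤₚ
open import Data.List using (List; []; _∷_; [_]; _++_; map; filter; length; foldr; allFin; cartesianProduct; tabulate; drop)
import Data.List.Properties as Listₚ
open import Data.List.Membership.Propositional using (_∈_; _∉_; find; lose)
open import Data.List.Membership.Propositional.Properties using (∈-filter⁺; ∈-filter⁻; ∈-++⁺ˡ; ∈-++⁺ʳ; ∈-++⁻; ∈-map⁺; ∈-map⁻; ∈-allFin; ∈-cartesianProduct⁺)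
open import Data.List.Relation.Binary.Sublist.Propositional as Sub using ([]; _∷_; _∷ʳ_) renaming (_⊆_ to _⊑_)
import Data.List.Relation.Binary.Sublist.Propositional.Properties as Subₚ
open import Data.List.Relation.Unary.All as All using (All; []; _∷_)
import Data.List.Relation.Unary.All.Properties as Allₚ
open import Data.List.Relation.Unary.AllPairs as AllPairs using (AllPairs; []; _∷_; allPairs?)
import Data.List.Relation.Unary.AllPairs.Properties as AllPairsₚ
open import Data.List.Relation.Unary.Any as Any using (Any; here; there)
open import Data.List.Relation.Unary.Unique.Propositional using (Unique)
import Data.List.Relation.Unary.Unique.Propositional.Properties as Uniqueₚ
open import Data.Nat as ℕ using (ℕ; zero; suc; _≤_; z≤n; s≤s; _∸_; _⊔_; _⊓_)
import Data.Nat.Properties as ℕₚ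
open import Data.Product using (_×_; _,_; proj₁; proj₂; ∃-syntax)
open import Data.Product.Properties using (≡-dec)
open import Data.Rational as ℚ using (ℚ; 0ℚ; 1ℚ; _+_; _*_; _-_; -_) renaming (_≤_ to _≤ℚ_; _<_ to _<ℚ_)
import Data.Rational.Properties as ℚₚ
open ℚₚ using (≤-trans; ≤-refl; ≤-reflexive; ≤-total; ≤-antisym; nonNegative⁻¹; positive⁻¹; *-identityˡ; *-identityʳ; *-zeroˡ; *-zeroʳ; *-comm; *-assoc; *-distribˡ-+; <⇒≤; <-≤-trans; ≤-<-trans; <-irrefl; <-cmp; +-mono-≤; +-monoˡ-≤; +-monoʳ-≤; +-identityˡ; +-identityʳ; +-comm; +-assoc)
import Data.Rational.Unnormalised as ℚᵘ
import Data.Rational.Unnormalised.Properties as ℚᵘₚ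
open import Data.Rational.Solver using (module +-*-Solver)
open import Data.Sum using (_⊎_; inj₁; inj₂; [_,_]′)
open import Data.Unit using (⊤; tt)
open import Function using (_∘_; id; case_of_)
open import Relation.Nullary using (Dec; yes; no; ¬_; does; contradiction)
open import Relation.Nullary.Decidable using (¬?; _×-dec_; map′; dec-true; dec-false; decidable-stable; toWitness)
open import Relation.Binary.Definitions using (DecidableEquality; tri<; tri≈; tri>)
open import Relation.Binary.PropositionalEquality using (_≡_; _≢_; refl; sym; trans; cong; cong₂; subst; subst₂)
open +-*-Solver using (solve; _:=_; _:+_; _:*_; _:-_; :-_; con; _:^_)

-- Rational arithmetic, finite sums and indicators

infix 4 _≥0
_≥0 : ℚ → Set
q ≥0 = 0ℚ ≤ℚ q

2ℚ 3ℚ 4ℚ : ℚ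
2ℚ = 1ℚ + 1ℚ
3ℚ = 1ℚ + 2ℚ
4ℚ = 1ℚ + 3ℚ

≤-by : ∀ {x y s} → s ≥0 → y ≡ x + s → x ≤ℚ y
≤-by {x} {y} {s} p refl = subst (_≤ℚ x + s) (+-identityʳ x) (+-monoʳ-≤ x p)

diff≥0 : ∀ {x y} → x ≤ℚ y → y - x ≥0
diff≥0 {x} {y} p = subst (_≤ℚ y - x) (ℚₚ.+-inverseʳ x) (+-monoˡ-≤ (- x) p)

diff≥0⁻ : ∀ {x y} → y - x ≥0 → x ≤ℚ y
diff≥0⁻ {x} {y} p = ≤-by p (solve 2 (λ x y → y := x :+ (y :- x)) refl x y)

+≥0 : ∀ {x y} → x ≥0 → y ≥0 → x + y ≥0
+≥0 p q = +-mono-≤ p q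

*≥0 : ∀ {x y} → x ≥0 → y ≥0 → x * y ≥0
*≥0 {x} {y} p q = nonNegative⁻¹ (x * y) ⦃ ℚₚ.nonNeg*nonNeg⇒nonNeg x ⦃ ℚ.nonNegative p ⦄ y ⦃ ℚ.nonNegative q ⦄ ⦄

*-monoˡ : ∀ {c x y} → c ≥0 → x ≤ℚ y → c * x ≤ℚ c * y
*-monoˡ {c} p = ℚₚ.*-monoˡ-≤-nonNeg c ⦃ ℚ.nonNegative p ⦄

*-monoʳ : ∀ {c x y} → c ≥0 → x ≤ℚ y → x * c ≤ℚ y * c
*-monoʳ {c} p = ℚₚ.*-monoʳ-≤-nonNeg c ⦃ ℚ.nonNegative p ⦄

*-mono : ∀ {a b c d} → a ≥0 → c ≥0 → a ≤ℚ b → c ≤ℚ d → a * c ≤ℚ b * d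
*-mono a0 c0 ab cd = ≤-trans (*-monoʳ c0 ab) (*-monoˡ (≤-trans a0 ab) cd)

sq≥0 : ∀ x → x * x ≥0
sq≥0 x with ≤-total 0ℚ x
... | inj₁ p = *≥0 p p
... | inj₂ p = subst _≥0 (solve 1 (λ x → :- x :* :- x := x :* x) refl x) (*≥0 q q)
  where q : - x ≥0
        q = subst (_≤ℚ - x) refl (ℚₚ.neg-antimono-≤ p)

*-cancelˡ : ∀ {c x y} → 0ℚ <ℚ c → c * x ≤ℚ c * y → x ≤ℚ y
*-cancelˡ {c} p = ℚₚ.*-cancelˡ-≤-pos c ⦃ ℚ.positive p ⦄

*>0 : ∀ {x y} → 0ℚ <ℚ x → 0ℚ <ℚ y → 0ℚ <ℚ x * y
*>0 {x} {y} p q = positive⁻¹ (x * y) ⦃ ℚₚ.pos*pos⇒pos x ⦃ ℚ.positive p ⦄ y ⦃ ℚ.positive q ⦄ ⦄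

0≤1 : 1ℚ ≥0
0≤1 = nonNegative⁻¹ 1ℚ

0<1 : 0ℚ <ℚ 1ℚ
0<1 = positive⁻¹ 1ℚ

inverse : ∀ {q} → 0ℚ <ℚ q → ∃[ r ] (0ℚ <ℚ r × r * q ≡ 1ℚ)
inverse {q} p = r , positive⁻¹ r ⦃ ℚₚ.1/pos⇒pos q ⦄ , ℚₚ.*-inverseˡ q
  where instance _ = ℚ.positive p
                 _ = ℚₚ.pos⇒nonZero q
        r = ℚ.1/ q

infix 9 ⟨_⟩
-- Unary recursion makes `⟨ suc n ⟩` equal to `1ℚ + ⟨ n ⟩` by definition, the form in which the ring
-- solver meets it. The price is that large numerals must go through `lit`.
⟨_⟩ : ℕ → ℚ
⟨ zero ⟩  = 0ℚ
⟨ suc n ⟩ = 1ℚ + ⟨ n ⟩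

⟨⟩≥0 : ∀ n → ⟨ n ⟩ ≥0
⟨⟩≥0 zero    = ≤-refl
⟨⟩≥0 (suc n) = +≥0 0≤1 (⟨⟩≥0 n)

⟨⟩-+ : ∀ m n → ⟨ m ℕ.+ n ⟩ ≡ ⟨ m ⟩ + ⟨ n ⟩
⟨⟩-+ zero    n = sym (+-identityˡ ⟨ n ⟩)
⟨⟩-+ (suc m) n = trans (cong (1ℚ +_) (⟨⟩-+ m n)) (sym (+-assoc 1ℚ ⟨ m ⟩ ⟨ n ⟩))

⟨⟩-* : ∀ m n → ⟨ m ℕ.* n ⟩ ≡ ⟨ m ⟩ * ⟨ n ⟩
⟨⟩-* zero    n = sym (*-zeroˡ ⟨ n ⟩)
⟨⟩-* (suc m) n = trans (⟨⟩-+ n (m ℕ.* n)) (trans (cong (⟨ n ⟩ +_) (⟨⟩-* m n))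
  (solve 2 (λ m n → n :+ m :* n := (con 1ℚ :+ m) :* n) refl ⟨ m ⟩ ⟨ n ⟩))

⟨⟩-mono : ∀ {m n} → m ≤ n → ⟨ m ⟩ ≤ℚ ⟨ n ⟩
⟨⟩-mono {n = n} z≤n = ⟨⟩≥0 n
⟨⟩-mono (s≤s p) = +-monoʳ-≤ 1ℚ (⟨⟩-mono p)

1≤⟨suc⟩ : ∀ n → 1ℚ ≤ℚ ⟨ suc n ⟩
1≤⟨suc⟩ n = ≤-by (⟨⟩≥0 n) refl

⟨suc⟩>0 : ∀ n → 0ℚ <ℚ ⟨ suc n ⟩
⟨suc⟩>0 n = <-≤-trans 0<1 (1≤⟨suc⟩ n)

⟨⟩-pred : ∀ m n → ⟨ m ⟩ ≤ℚ ⟨ n ⟩ → m ≤ n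
⟨⟩-pred m n p with m ℕ.≤? n
... | yes q = q
... | no  q = contradiction (≤-trans (⟨⟩-mono (ℕₚ.≰⇒> q)) p) λ r →
  <-irrefl refl (<-≤-trans 0<1 (subst₂ _≤ℚ_
    (solve 1 (λ x → con 1ℚ :+ x :- x := con 1ℚ) refl ⟨ n ⟩) (ℚₚ.+-inverseʳ ⟨ n ⟩) (+-monoˡ-≤ (- ⟨ n ⟩) r)))

toℚᵘ-⟨⟩ : ∀ n → ℚ.toℚᵘ ⟨ n ⟩ ℚᵘ.≃ ℚᵘ.mkℚᵘ (ℤ.+ n) 0
toℚᵘ-⟨⟩ zero    = ℚᵘ.*≡* refl
toℚᵘ-⟨⟩ (suc n) = ℚᵘₚ.≃-trans (ℚₚ.toℚᵘ-homo-+ 1ℚ ⟨ n ⟩) (ℚᵘₚ.≃-trans (ℚᵘₚ.+-congʳ (ℚ.toℚᵘ 1ℚ) (toℚᵘ-⟨⟩ n))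
  (ℚᵘ.*≡* (cong (ℤ._* (ℤ.+ 1)) (cong (λ z → ℤ._+_ (ℤ.+ 1) z) (ℤₚ.*-identityʳ (ℤ.+ n))))))

archimedean : ∀ q → ∃[ n ] q ≤ℚ ⟨ n ⟩
archimedean (ℚ.mkℚ i d _) = ℤ.∣ i ∣ , ℚₚ.toℚᵘ-cancel-≤ (ℚᵘₚ.≤-respʳ-≃ (ℚᵘₚ.≃-sym (toℚᵘ-⟨⟩ ℤ.∣ i ∣)) (ℚᵘ.*≤* (bound i (suc d) (s≤s z≤n))))
  where bound : ∀ i d → 1 ℕ.≤ d → i ℤ.* (ℤ.+ 1) ℤ.≤ (ℤ.+ ℤ.∣ i ∣) ℤ.* (ℤ.+ d)
        bound i@(ℤ.+ m) d p = subst₂ ℤ._≤_ (sym (ℤₚ.*-identityʳ (ℤ.+ m))) (ℤₚ.pos-* m d)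
          (ℤ.+≤+ (subst (_≤ m ℕ.* d) (ℕₚ.*-identityʳ m) (ℕₚ.*-monoʳ-≤ m p)))
        bound ℤ.-[1+ m ] (suc d) p = ℤ.-≤+

^≥0 : ∀ {x} → x ≥0 → ∀ k → x ^ℚ k ≥0
^≥0 p zero    = 0≤1
^≥0 p (suc k) = *≥0 p (^≥0 p k)

^>0 : ∀ {x} → 0ℚ <ℚ x → ∀ k → 0ℚ <ℚ x ^ℚ k
^>0 p zero    = 0<1
^>0 p (suc k) = *>0 p (^>0 p k)

^≤1 : ∀ {x} → x ≥0 → x ≤ℚ 1ℚ → ∀ k → x ^ℚ k ≤ℚ 1ℚ
^≤1 p q zero    = ≤-refl
^≤1 {x} p q (suc k) = subst (λ y → x * (x ^ℚ k) ≤ℚ y) (*-identityˡ 1ℚ) (*-mono p (^≥0 p k) q (^≤1 p q k))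

^-mono : ∀ {x y} → x ≥0 → x ≤ℚ y → ∀ k → x ^ℚ k ≤ℚ y ^ℚ k
^-mono p q zero    = ≤-refl
^-mono p q (suc k) = *-mono p (^≥0 p k) q (^-mono p q k)

^-+ : ∀ x j k → x ^ℚ (j ℕ.+ k) ≡ x ^ℚ j * x ^ℚ k
^-+ x zero    k = sym (*-identityˡ _)
^-+ x (suc j) k = trans (cong (x *_) (^-+ x j k)) (sym (*-assoc x _ _))

^-* : ∀ x j k → x ^ℚ (j ℕ.* k) ≡ (x ^ℚ k) ^ℚ j
^-* x zero    k = refl
^-* x (suc j) k = trans (^-+ x k (j ℕ.* k)) (cong (x ^ℚ k *_) (^-* x j k))

*-^ : ∀ x y k → (x * y) ^ℚ k ≡ x ^ℚ k * y ^ℚ k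
*-^ x y zero    = refl
*-^ x y (suc k) = trans (cong (x * y *_) (*-^ x y k))
  (solve 4 (λ x y a b → x :* y :* (a :* b) := x :* a :* (y :* b)) refl x y (x ^ℚ k) (y ^ℚ k))

1^ : ∀ k → 1ℚ ^ℚ k ≡ 1ℚ
1^ zero    = refl
1^ (suc k) = trans (*-identityˡ _) (1^ k)

bernoulli : ∀ {z} → z ≤ℚ 1ℚ → ∀ k → 1ℚ - ⟨ k ⟩ * z ≤ℚ (1ℚ - z) ^ℚ k
bernoulli {z} p zero    = ≤-reflexive (solve 1 (λ z → con 1ℚ :- con 0ℚ :* z := con 1ℚ) refl z)
bernoulli {z} p (suc k) = ≤-trans
  (≤-by (*≥0 (⟨⟩≥0 k) (sq≥0 z)) (solve 2 (λ z k → (con 1ℚ :- z) :* (con 1ℚ :- k :* z) :=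
    con 1ℚ :- (con 1ℚ :+ k) :* z :+ k :* (z :* z)) refl z ⟨ k ⟩))
  (*-monoˡ (diff≥0 p) (bernoulli p k))

bernoulli⁺ : ∀ {z} → z ≥0 → ∀ k → 1ℚ + ⟨ k ⟩ * z ≤ℚ (1ℚ + z) ^ℚ k
bernoulli⁺ {z} p zero    = ≤-reflexive (solve 1 (λ z → con 1ℚ :+ con 0ℚ :* z := con 1ℚ) refl z)
bernoulli⁺ {z} p (suc k) = ≤-trans
  (≤-by (*≥0 (⟨⟩≥0 k) (sq≥0 z)) (solve 2 (λ z k → (con 1ℚ :+ z) :* (con 1ℚ :+ k :* z) :=
    con 1ℚ :+ (con 1ℚ :+ k) :* z :+ k :* (z :* z)) refl z ⟨ k ⟩))
  (*-monoˡ (+≥0 0≤1 p) (bernoulli⁺ p k))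

-- Both (1 - z)^k (1 + k z) ≤ 1 and (1 + z)^k (1 - k z) ≤ 1 stand in for exponential bounds.
pow-decay : ∀ {z} → z ≥0 → z ≤ℚ 1ℚ → ∀ k → (1ℚ - z) ^ℚ k * (1ℚ + ⟨ k ⟩ * z) ≤ℚ 1ℚ
pow-decay {z} p q k = ≤-trans (*-monoˡ (^≥0 (diff≥0 q) k) (bernoulli⁺ p k))
  (subst (_≤ℚ 1ℚ) (*-^ (1ℚ - z) (1ℚ + z) k)
    (^≤1 (*≥0 (diff≥0 q) (+≥0 0≤1 p)) (≤-by (sq≥0 z) (solve 1 (λ z → con 1ℚ := (con 1ℚ :- z) :* (con 1ℚ :+ z) :+ z :* z) refl z)) k))

pow-growth : ∀ {z} → z ≥0 → z ≤ℚ 1ℚ → ∀ k → (1ℚ + z) ^ℚ k * (1ℚ - ⟨ k ⟩ * z) ≤ℚ 1ℚ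
pow-growth {z} p q k = ≤-trans (*-monoˡ (^≥0 (+≥0 0≤1 p) k) (bernoulli q k))
  (subst (_≤ℚ 1ℚ) (*-^ (1ℚ + z) (1ℚ - z) k)
    (^≤1 (*≥0 (+≥0 0≤1 p) (diff≥0 q)) (≤-by (sq≥0 z) (solve 1 (λ z → con 1ℚ := (con 1ℚ :+ z) :* (con 1ℚ :- z) :+ z :* z) refl z)) k))

∑ : ∀ {A : Set} → List A → (A → ℚ) → ℚ
∑ []       f = 0ℚ
∑ (x ∷ xs) f = f x + ∑ xs f

infixr 6.5 ∑
syntax ∑ xs (λ x → e) = ∑[ x ∈ xs ] e

module _ {A : Set} where

  ∑-cong : ∀ xs {f g : A → ℚ} → (∀ {x} → x ∈ xs → f x ≡ g x) → ∑ xs f ≡ ∑ xs g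
  ∑-cong []       h = refl
  ∑-cong (x ∷ xs) h = cong₂ _+_ (h (here refl)) (∑-cong xs (h ∘ there))

  ∑-mono : ∀ xs {f g : A → ℚ} → (∀ {x} → x ∈ xs → f x ≤ℚ g x) → ∑ xs f ≤ℚ ∑ xs g
  ∑-mono []       h = ≤-refl
  ∑-mono (x ∷ xs) h = +-mono-≤ (h (here refl)) (∑-mono xs (h ∘ there))

  ∑-0 : ∀ (xs : List A) → ∑ xs (λ _ → 0ℚ) ≡ 0ℚ
  ∑-0 []       = refl
  ∑-0 (x ∷ xs) = trans (+-identityˡ _) (∑-0 xs)

  ∑≥0 : ∀ xs {f : A → ℚ} → (∀ {x} → x ∈ xs → f x ≥0) → ∑ xs f ≥0
  ∑≥0 xs {f} h = subst (_≤ℚ ∑ xs f) (∑-0 xs) (∑-mono xs h)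

  ∑-+ : ∀ xs (f g : A → ℚ) → ∑ xs (λ x → f x + g x) ≡ ∑ xs f + ∑ xs g
  ∑-+ []       f g = refl
  ∑-+ (x ∷ xs) f g = trans (cong (f x + g x +_) (∑-+ xs f g))
    (solve 4 (λ a b c d → a :+ b :+ (c :+ d) := a :+ c :+ (b :+ d)) refl (f x) (g x) (∑ xs f) (∑ xs g))

  ∑-*ˡ : ∀ xs c (f : A → ℚ) → ∑ xs (λ x → c * f x) ≡ c * ∑ xs f
  ∑-*ˡ []       c f = sym (*-zeroʳ c)
  ∑-*ˡ (x ∷ xs) c f = trans (cong (c * f x +_) (∑-*ˡ xs c f)) (sym (*-distribˡ-+ c (f x) (∑ xs f)))

  ∑-*ʳ : ∀ xs c (f : A → ℚ) → ∑ xs (λ x → f x * c) ≡ ∑ xs f * c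
  ∑-*ʳ xs c f = trans (∑-cong xs λ {x} _ → *-comm (f x) c) (trans (∑-*ˡ xs c f) (*-comm c _))

  ∑-const : ∀ (xs : List A) c → ∑ xs (λ _ → c) ≡ ⟨ length xs ⟩ * c
  ∑-const []       c = sym (*-zeroˡ c)
  ∑-const (x ∷ xs) c = trans (cong (c +_) (∑-const xs c))
    (solve 2 (λ c n → c :+ n :* c := (con 1ℚ :+ n) :* c) refl c ⟨ length xs ⟩)

  ∑-++ : ∀ xs ys (f : A → ℚ) → ∑ (xs ++ ys) f ≡ ∑ xs f + ∑ ys f
  ∑-++ []       ys f = sym (+-identityˡ _)
  ∑-++ (x ∷ xs) ys f = trans (cong (f x +_) (∑-++ xs ys f)) (sym (+-assoc (f x) _ _))

  ∑-map : ∀ {B : Set} (g : B → A) xs (f : A → ℚ) → ∑ (map g xs) f ≡ ∑ xs (f ∘ g)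
  ∑-map g []       f = refl
  ∑-map g (x ∷ xs) f = cong (f (g x) +_) (∑-map g xs f)

  ∑-∈ : ∀ xs {f : A → ℚ} → (∀ {x} → x ∈ xs → f x ≥0) → ∀ {x} → x ∈ xs → f x ≤ℚ ∑ xs f
  ∑-∈ (y ∷ xs) {f} h {x} (here refl) = ≤-by (∑≥0 xs (h ∘ there)) refl
  ∑-∈ (y ∷ xs) {f} h {x} (there i) = ≤-trans (∑-∈ xs (h ∘ there) i)
    (≤-by (h (here refl)) (+-comm (f y) (∑ xs f)))

∑-swap : ∀ {A B : Set} xs ys (f : A → B → ℚ) → ∑[ x ∈ xs ] ∑[ y ∈ ys ] f x y ≡ ∑[ y ∈ ys ] ∑[ x ∈ xs ] f x y
∑-swap []       ys f = sym (∑-0 ys)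
∑-swap (x ∷ xs) ys f = trans (cong (∑ ys (f x) +_) (∑-swap xs ys f)) (sym (∑-+ ys (f x) _))

𝟙 : ∀ {P : Set} → Dec P → ℚ
𝟙 d = if does d then 1ℚ else 0ℚ

module _ {P : Set} where

  𝟙-yes : (d : Dec P) → P → 𝟙 d ≡ 1ℚ
  𝟙-yes (yes _) p = refl
  𝟙-yes (no ¬p) p = contradiction p ¬p

  𝟙-no : (d : Dec P) → ¬ P → 𝟙 d ≡ 0ℚ
  𝟙-no (yes p) ¬p = contradiction p ¬p
  𝟙-no (no _)  _  = refl

  𝟙≥0 : (d : Dec P) → 𝟙 d ≥0
  𝟙≥0 (yes _) = 0≤1
  𝟙≥0 (no _)  = ≤-refl

  𝟙-cong : ∀ {Q : Set} (d : Dec P) (e : Dec Q) → (P → Q) → (Q → P) → 𝟙 d ≡ 𝟙 e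
  𝟙-cong (yes p) (yes q) f g = refl
  𝟙-cong (yes p) (no ¬q) f g = contradiction (f p) ¬q
  𝟙-cong (no ¬p) (yes q) f g = contradiction (g q) ¬p
  𝟙-cong (no ¬p) (no ¬q) f g = refl

  𝟙-× : ∀ {Q : Set} (d : Dec P) (e : Dec Q) → 𝟙 (d ×-dec e) ≡ 𝟙 d * 𝟙 e
  𝟙-× (yes p) (yes q) = refl
  𝟙-× (yes p) (no q)  = refl
  𝟙-× (no p)  (yes q) = refl
  𝟙-× (no p)  (no q)  = refl

  𝟙-elim : (C : ℚ → Set) (d : Dec P) → (P → C 1ℚ) → (¬ P → C 0ℚ) → C (𝟙 d)
  𝟙-elim C (yes p) f g = f p
  𝟙-elim C (no ¬p) f g = g ¬p

  𝟙-¬ : (d : Dec P) → 𝟙 (¬? d) ≡ 1ℚ - 𝟙 d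
  𝟙-¬ (yes p) = refl
  𝟙-¬ (no p)  = refl

∑-filter : ∀ {A : Set} {P : A → Set} (P? : ∀ x → Dec (P x)) xs (f : A → ℚ) →
           ∑ (filter P? xs) f ≡ ∑[ x ∈ xs ] 𝟙 (P? x) * f x
∑-filter P? []       f = refl
∑-filter P? (x ∷ xs) f with P? x
... | yes _ = cong₂ _+_ (sym (*-identityˡ (f x))) (∑-filter P? xs f)
... | no  _ = trans (∑-filter P? xs f) (trans (sym (+-identityˡ _)) (cong (_+ _) (sym (*-zeroˡ (f x)))))

length-filter : ∀ {A : Set} {P : A → Set} (P? : ∀ x → Dec (P x)) xs → ⟨ length (filter P? xs) ⟩ ≡ ∑[ x ∈ xs ] 𝟙 (P? x)
length-filter P? []       = refl
length-filter P? (x ∷ xs) with P? x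
... | yes _ = cong (1ℚ +_) (length-filter P? xs)
... | no  _ = trans (length-filter P? xs) (sym (+-identityˡ _))

-- Binomial random subsets

module _ {A : Set} where

  -- Defined by conditioning on the first element, so that linearity, monotonicity and the variance
  -- bound are structural inductions. `𝔼-sublists` identifies it with the weighted sum over subsets.
  𝔼 : ℚ → List A → (List A → ℚ) → ℚ
  𝔼 p []       F = F []
  𝔼 p (x ∷ xs) F = p * 𝔼 p xs (λ G → F (x ∷ G)) + (1ℚ - p) * 𝔼 p xs F

  𝔼-cong : ∀ p xs {F F′ : List A → ℚ} → (∀ {G} → G ⊑ xs → F G ≡ F′ G) → 𝔼 p xs F ≡ 𝔼 p xs F′
  𝔼-cong p []       h = h []
  𝔼-cong p (x ∷ xs) h = cong₂ (λ a b → p * a + (1ℚ - p) * b)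
    (𝔼-cong p xs λ s → h (refl ∷ s)) (𝔼-cong p xs λ s → h (x ∷ʳ s))

  𝔼-+ : ∀ p xs (F F′ : List A → ℚ) → 𝔼 p xs (λ G → F G + F′ G) ≡ 𝔼 p xs F + 𝔼 p xs F′
  𝔼-+ p []       F F′ = refl
  𝔼-+ p (x ∷ xs) F F′ = trans (cong₂ (λ a b → p * a + (1ℚ - p) * b) (𝔼-+ p xs _ _) (𝔼-+ p xs F F′))
    (solve 5 (λ p a b c d → p :* (a :+ b) :+ (con 1ℚ :- p) :* (c :+ d) :=
      p :* a :+ (con 1ℚ :- p) :* c :+ (p :* b :+ (con 1ℚ :- p) :* d)) refl p
      (𝔼 p xs (λ G → F (x ∷ G))) (𝔼 p xs (λ G → F′ (x ∷ G))) (𝔼 p xs F) (𝔼 p xs F′))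

  𝔼-* : ∀ p xs c (F : List A → ℚ) → 𝔼 p xs (λ G → c * F G) ≡ c * 𝔼 p xs F
  𝔼-* p []       c F = refl
  𝔼-* p (x ∷ xs) c F = trans (cong₂ (λ a b → p * a + (1ℚ - p) * b) (𝔼-* p xs c _) (𝔼-* p xs c F))
    (solve 4 (λ p c a b → p :* (c :* a) :+ (con 1ℚ :- p) :* (c :* b) := c :* (p :* a :+ (con 1ℚ :- p) :* b)) refl
      p c (𝔼 p xs (λ G → F (x ∷ G))) (𝔼 p xs F))

  𝔼-const : ∀ p xs c → 𝔼 p xs (λ _ → c) ≡ c
  𝔼-const p []       c = refl
  𝔼-const p (x ∷ xs) c = trans (cong₂ (λ a b → p * a + (1ℚ - p) * b) (𝔼-const p xs c) (𝔼-const p xs c))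
    (solve 2 (λ p c → p :* c :+ (con 1ℚ :- p) :* c := c) refl p c)

  𝔼-- : ∀ p xs (F F′ : List A → ℚ) → 𝔼 p xs (λ G → F G - F′ G) ≡ 𝔼 p xs F - 𝔼 p xs F′
  𝔼-- p xs F F′ = trans (𝔼-cong p xs λ {G} _ → solve 2 (λ a b → a :- b := a :+ con (- 1ℚ) :* b) refl (F G) (F′ G))
    (trans (𝔼-+ p xs F _) (trans (cong (𝔼 p xs F +_) (𝔼-* p xs (- 1ℚ) F′))
    (solve 2 (λ a b → a :+ con (- 1ℚ) :* b := a :- b) refl (𝔼 p xs F) (𝔼 p xs F′))))

  𝔼-∑ : ∀ {B : Set} p xs ys (F : B → List A → ℚ) → 𝔼 p xs (λ G → ∑[ y ∈ ys ] F y G) ≡ ∑[ y ∈ ys ] 𝔼 p xs (F y)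
  𝔼-∑ p xs []       F = 𝔼-const p xs 0ℚ
  𝔼-∑ p xs (y ∷ ys) F = trans (𝔼-+ p xs (F y) _) (cong (𝔼 p xs (F y) +_) (𝔼-∑ p xs ys F))

  module _ {p} (p≥0 : p ≥0) (p≤1 : p ≤ℚ 1ℚ) where

    𝔼-mono : ∀ xs {F F′ : List A → ℚ} → (∀ {G} → G ⊑ xs → F G ≤ℚ F′ G) → 𝔼 p xs F ≤ℚ 𝔼 p xs F′
    𝔼-mono []       h = h []
    𝔼-mono (x ∷ xs) h = +-mono-≤ (*-monoˡ p≥0 (𝔼-mono xs λ s → h (refl ∷ s)))
                                    (*-monoˡ (diff≥0 p≤1) (𝔼-mono xs λ s → h (x ∷ʳ s)))

    𝔼≥0 : ∀ xs {F : List A → ℚ} → (∀ {G} → G ⊑ xs → F G ≥0) → 𝔼 p xs F ≥0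
    𝔼≥0 xs {F} h = subst (_≤ℚ 𝔼 p xs F) (𝔼-const p xs 0ℚ) (𝔼-mono xs h)

    𝔼-deviation : ∀ xs m (F : List A → ℚ) →
                  𝔼 p xs (λ G → (F G - m) * (F G - m)) ≡ 𝔼 p xs (λ G → F G * F G) - 2ℚ * m * 𝔼 p xs F + m * m
    𝔼-deviation xs m F = trans (𝔼-cong p xs λ {G} _ → solve 2 (λ m f → (f :- m) :* (f :- m) :=
        f :* f :+ (con (- 2ℚ) :* m :* f :+ m :* m)) refl m (F G))
      (trans (𝔼-+ p xs (λ G → F G * F G) _) (trans (cong (𝔼 p xs (λ G → F G * F G) +_)
        (trans (𝔼-+ p xs (λ G → - 2ℚ * m * F G) _) (cong₂ _+_ (𝔼-* p xs (- 2ℚ * m) F) (𝔼-const p xs (m * m)))))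
        (solve 3 (λ m e f → f :+ (con (- 2ℚ) :* m :* e :+ m :* m) := f :- con 2ℚ :* m :* e :+ m :* m) refl
          m (𝔼 p xs F) (𝔼 p xs (λ G → F G * F G)))))

    -- The difference of the two sides is the mean square deviation from `m`.
    jensen : ∀ xs (F : List A → ℚ) → 𝔼 p xs F * 𝔼 p xs F ≤ℚ 𝔼 p xs (λ G → F G * F G)
    jensen xs F = ≤-by (𝔼≥0 xs {λ G → (F G - m) * (F G - m)} λ {G} _ → sq≥0 (F G - m))
      (trans (solve 2 (λ m f → f := m :* m :+ (f :- con 2ℚ :* m :* m :+ m :* m)) refl m (𝔼 p xs (λ G → F G * F G)))
        (cong (m * m +_) (sym (𝔼-deviation xs m F))))
      where m = 𝔼 p xs F

  data Insert (x : A) : List A → List A → Set where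
    here  : ∀ {G} → Insert x G (x ∷ G)
    there : ∀ {y G G′} → Insert x G G′ → Insert x (y ∷ G) (y ∷ G′)

  -- Efron–Stein inequality
  variance : ∀ {p} → p ≥0 → p ≤ℚ 1ℚ → ∀ {c} → c ≥0 → ∀ xs (F : List A → ℚ) →
             (∀ {x G G′} → Insert x G G′ → G′ ⊑ xs → (F G′ - F G) * (F G′ - F G) ≤ℚ c) →
             𝔼 p xs (λ G → F G * F G) ≤ℚ 𝔼 p xs F * 𝔼 p xs F + ⟨ length xs ⟩ * (p * c)
  variance {p} p≥0 p≤1 {c} c≥0 []       F h = ≤-by ≤-refl (solve 2 (λ a b → a :+ con 0ℚ :* b := a :+ con 0ℚ) refl (F [] * F []) (p * c))
  variance {p} p≥0 p≤1 {c} c≥0 (x ∷ xs) F h = ≤-trans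
    (+-mono-≤ (*-monoˡ p≥0 (variance p≥0 p≤1 c≥0 xs F₁ λ i s → h (there i) (refl ∷ s)))
                 (*-monoˡ (diff≥0 p≤1) (variance p≥0 p≤1 c≥0 xs F λ i s → h i (x ∷ʳ s))))
    -- Law of total variance: conditioning on `x` adds p (1 - p) (a - b)², which is at most p c.
    (≤-by (+≥0 (*≥0 p≥0 (diff≥0 ab≤c)) (*≥0 (*≥0 p≥0 p≥0) (sq≥0 (a - b))))
      (solve 5 (λ p c a b n → (p :* a :+ (con 1ℚ :- p) :* b) :* (p :* a :+ (con 1ℚ :- p) :* b) :+ (con 1ℚ :+ n) :* (p :* c) :=
         p :* (a :* a :+ n :* (p :* c)) :+ (con 1ℚ :- p) :* (b :* b :+ n :* (p :* c)) :+
         (p :* (c :- (a :- b) :* (a :- b)) :+ p :* p :* ((a :- b) :* (a :- b)))) refl p c a b ⟨ length xs ⟩))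
    where
    F₁ = λ G → F (x ∷ G)
    a = 𝔼 p xs F₁
    b = 𝔼 p xs F
    ab≤c : (a - b) * (a - b) ≤ℚ c
    ab≤c = ≤-trans (subst (λ m → m * m ≤ℚ 𝔼 p xs (λ G → (F₁ G - F G) * (F₁ G - F G))) (𝔼-- p xs F₁ F)
        (jensen p≥0 p≤1 xs (λ G → F₁ G - F G)))
      (subst (𝔼 p xs (λ G → (F₁ G - F G) * (F₁ G - F G)) ≤ℚ_) (𝔼-const p xs c)
        (𝔼-mono p≥0 p≤1 xs λ s → h here (refl ∷ s)))

  -- On the bad event `X` is at least μ ≥ m below its mean, so `bad` times m² is at most the squared
  -- deviation. The product form avoids dividing by m².
  chebyshev : ∀ {p} → p ≥0 → p ≤ℚ 1ℚ → ∀ {c} → c ≥0 → ∀ xs (X bad : List A → ℚ) →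
              (∀ {x G G′} → Insert x G G′ → G′ ⊑ xs → (X G′ - X G) * (X G′ - X G) ≤ℚ c) →
              (∀ {G} → G ⊑ xs → (bad G ≡ 0ℚ) ⊎ ((bad G ≡ 1ℚ) × X G ≤ℚ 0ℚ)) →
              ∀ {m} → m ≥0 → m ≤ℚ 𝔼 p xs X →
              𝔼 p xs bad * (m * m) ≤ℚ ⟨ length xs ⟩ * (p * c)
  chebyshev {p} p≥0 p≤1 {c} c≥0 xs X bad lip neg {m} m≥0 m≤μ = ≤-trans
    (subst (_≤ℚ 𝔼 p xs (λ G → (X G - μ) * (X G - μ))) (trans (𝔼-* p xs (m * m) bad) (*-comm (m * m) _)) (𝔼-mono p≥0 p≤1 xs pt))
    (subst (_≤ℚ ⟨ length xs ⟩ * (p * c)) (sym (𝔼-deviation p≥0 p≤1 xs μ X))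
      (diff≥0⁻ (subst _≥0 (solve 3 (λ m f v → m :* m :+ v :- f := v :- (f :- con 2ℚ :* m :* m :+ m :* m)) refl μ _ _)
        (diff≥0 (variance p≥0 p≤1 c≥0 xs X lip)))))
    where
    μ = 𝔼 p xs X
    pt : ∀ {G} → G ⊑ xs → m * m * bad G ≤ℚ (X G - μ) * (X G - μ)
    pt {G} s with neg s
    ... | inj₁ e = subst (_≤ℚ (X G - μ) * (X G - μ)) (sym (trans (cong (m * m *_) e) (*-zeroʳ (m * m)))) (sq≥0 (X G - μ))
    ... | inj₂ (e , X≤0) = subst₂ _≤ℚ_ (sym (trans (cong (m * m *_) e) (*-identityʳ (m * m))))
      (solve 2 (λ x m → (m :- x) :* (m :- x) := (x :- m) :* (x :- m)) refl (X G) μ) (*-mono m≥0 m≥0 le le)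
      where le : m ≤ℚ μ - X G
            le = ≤-by (+≥0 (diff≥0 m≤μ) (diff≥0 X≤0)) (solve 3 (λ m u x → u :- x := m :+ (u :- m :+ (con 0ℚ :- x))) refl m μ (X G))

  data Split : List A → List A → List A → Set where
    []  : Split [] [] []
    _◂_ : ∀ x {G₁ G₂ G} → Split G₁ G₂ G → Split (x ∷ G₁) G₂ (x ∷ G)
    _▸_ : ∀ x {G₁ G₂ G} → Split G₁ G₂ G → Split G₁ (x ∷ G₂) (x ∷ G)

  -- Two disjoint classes of a random colouring, with marginal densities p₁ and p₂, have union of density p₁ + p₂.
  𝔼-superadditive : ∀ {p₁ p₂} → p₁ ≥0 → p₂ ≥0 → p₁ + p₂ ≤ℚ 1ℚ → ∀ xs (F₁ F₂ F : List A → ℚ) →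
    (∀ {G₁ G₂ G} → Split G₁ G₂ G → G ⊑ xs → F₁ G₁ + F₂ G₂ ≤ℚ F G) →
    𝔼 p₁ xs F₁ + 𝔼 p₂ xs F₂ ≤ℚ 𝔼 (p₁ + p₂) xs F
  𝔼-superadditive p₁≥0 p₂≥0 le []       F₁ F₂ F h = h [] []
  𝔼-superadditive {p₁} {p₂} p₁≥0 p₂≥0 le (x ∷ xs) F₁ F₂ F h = ≤-by
    (+≥0 (+≥0 (*≥0 p₁≥0 (diff≥0 (ih (λ G → F₁ (x ∷ G)) F₂ (λ G → F (x ∷ G)) λ i s → h (x ◂ i) (refl ∷ s))))
              (*≥0 p₂≥0 (diff≥0 (ih F₁ (λ G → F₂ (x ∷ G)) (λ G → F (x ∷ G)) λ i s → h (x ▸ i) (refl ∷ s)))))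
         (*≥0 (diff≥0 le) (diff≥0 (ih F₁ F₂ F λ i s → h i (x ∷ʳ s)))))
    (solve 8 (λ p q a₁ a₀ b₁ b₀ f₁ f₀ →
       (p :+ q) :* f₁ :+ (con 1ℚ :- (p :+ q)) :* f₀ :=
       p :* a₁ :+ (con 1ℚ :- p) :* a₀ :+ (q :* b₁ :+ (con 1ℚ :- q) :* b₀) :+
       (p :* (f₁ :- (a₁ :+ b₀)) :+ q :* (f₁ :- (a₀ :+ b₁)) :+ (con 1ℚ :- (p :+ q)) :* (f₀ :- (a₀ :+ b₀))))
      refl p₁ p₂ (𝔼 p₁ xs (λ G → F₁ (x ∷ G))) (𝔼 p₁ xs F₁) (𝔼 p₂ xs (λ G → F₂ (x ∷ G))) (𝔼 p₂ xs F₂)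
      (𝔼 (p₁ + p₂) xs (λ G → F (x ∷ G))) (𝔼 (p₁ + p₂) xs F))
    where ih = 𝔼-superadditive p₁≥0 p₂≥0 le xs

  sublists-⊑ : ∀ xs {G : List A} → G ∈ sublists xs → G ⊑ xs
  sublists-⊑ [] (here refl) = []
  sublists-⊑ (x ∷ xs) i with ∈-++⁻ (map (x ∷_) (sublists xs)) i
  ... | inj₂ j = x ∷ʳ sublists-⊑ xs j
  ... | inj₁ j with ∈-map⁻ (x ∷_) j
  ...   | _ , k , refl = refl ∷ sublists-⊑ xs k

  ⊑-sublists : ∀ {xs G : List A} → G ⊑ xs → G ∈ sublists xs
  ⊑-sublists [] = here refl
  ⊑-sublists (x ∷ʳ s) = ∈-++⁺ʳ _ (⊑-sublists s)
  ⊑-sublists (refl ∷ s) = ∈-++⁺ˡ (∈-map⁺ _ (⊑-sublists s))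

  𝔼-sublists : ∀ p xs (F : List A → ℚ) →
    ∑[ G ∈ sublists xs ] (p ^ℚ length G * (1ℚ - p) ^ℚ (length xs ∸ length G)) * F G ≡ 𝔼 p xs F
  𝔼-sublists p []       F = solve 1 (λ f → con 1ℚ :* con 1ℚ :* f :+ con 0ℚ := f) refl (F [])
  𝔼-sublists p (x ∷ xs) F = trans (∑-++ (map (x ∷_) (sublists xs)) (sublists xs) _) (cong₂ _+_
    (trans (∑-map (x ∷_) (sublists xs) _) (trans (∑-cong (sublists xs) λ {G} _ →
        solve 4 (λ p a b f → p :* a :* b :* f := p :* (a :* b :* f)) refl p (p ^ℚ length G) ((1ℚ - p) ^ℚ (length xs ∸ length G)) (F (x ∷ G)))
      (trans (∑-*ˡ (sublists xs) p _) (cong (p *_) (𝔼-sublists p xs (λ G → F (x ∷ G)))))))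
    (trans (∑-cong (sublists xs) λ {G} i →
        trans (cong (λ k → p ^ℚ length G * (1ℚ - p) ^ℚ k * F G) (ℕₚ.+-∸-assoc 1 (Subₚ.length-mono-≤ (sublists-⊑ xs i))))
        (solve 4 (λ q a b f → a :* (q :* b) :* f := q :* (a :* b :* f)) refl (1ℚ - p) (p ^ℚ length G) ((1ℚ - p) ^ℚ (length xs ∸ length G)) (F G)))
      (trans (∑-*ˡ (sublists xs) (1ℚ - p) _) (cong ((1ℚ - p) *_) (𝔼-sublists p xs F)))))

  ⊑-Unique : ∀ {xs ys : List A} → xs ⊑ ys → Unique ys → Unique xs
  ⊑-Unique [] u = []
  ⊑-Unique (y ∷ʳ s) (_ ∷ u) = ⊑-Unique s u
  ⊑-Unique (refl ∷ s) (n ∷ u) = All.tabulate (λ i → All.lookup n (Sub.lookup s i)) ∷ ⊑-Unique s u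

-- Indicators of containment and their expectations

module Containment {A : Set} (_≟_ : DecidableEquality A) where

  infix 4 _∈?_ _⊆_ _⊆?_

  _∈?_ : (x : A) (G : List A) → Dec (x ∈ G)
  x ∈? G = Any.any? (x ≟_) G

  _⊆_ : List A → List A → Set
  S ⊆ G = All (_∈ G) S

  _⊆?_ : (S G : List A) → Dec (S ⊆ G)
  S ⊆? G = All.all? (_∈? G) S

  _∖_ : List A → List A → List A
  S ∖ T = filter (λ x → ¬? (x ∈? T)) S

  χ : List A → List A → ℚ
  χ S G = 𝟙 (S ⊆? G)

  ∈-∖⁺ : ∀ {x S T} → x ∈ S → x ∉ T → x ∈ S ∖ T
  ∈-∖⁺ = ∈-filter⁺ (λ x → ¬? (x ∈? _))

  ∈-∖⁻ : ∀ {x S T} → x ∈ S ∖ T → x ∈ S × x ∉ T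
  ∈-∖⁻ = ∈-filter⁻ (λ x → ¬? (x ∈? _))

  ∖-Unique : ∀ {S T} → Unique S → Unique (S ∖ T)
  ∖-Unique = Uniqueₚ.filter⁺ (λ x → ¬? (x ∈? _))

  ∑-≟ : ∀ {x xs} → Unique xs → x ∈ xs → (f : A → ℚ) → ∑[ y ∈ xs ] 𝟙 (x ≟ y) * f y ≡ f x
  ∑-≟ {x} {_ ∷ xs} (n ∷ u) (here refl) f = trans (cong₂ _+_ (cong (_* f x) (𝟙-yes (x ≟ x) refl))
      (trans (∑-cong xs λ {y} i → trans (cong (_* f y) (𝟙-no (x ≟ y) (All.lookup n i))) (*-zeroˡ (f y))) (∑-0 xs)))
    (solve 1 (λ f → con 1ℚ :* f :+ con 0ℚ := f) refl (f x))
  ∑-≟ {x} {y ∷ xs} (n ∷ u) (there i) f = trans (cong₂ _+_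
      (trans (cong (_* f y) (𝟙-no (x ≟ y) λ { refl → All.lookup n i refl })) (*-zeroˡ (f y))) (∑-≟ u i f)) (+-identityˡ _)

  ∑-≟-∉ : ∀ {x} xs → x ∉ xs → (f : A → ℚ) → ∑[ y ∈ xs ] 𝟙 (x ≟ y) * f y ≡ 0ℚ
  ∑-≟-∉ {x} xs x∉ f = trans (∑-cong xs λ {y} i → trans (cong (_* f y) (𝟙-no (x ≟ y) λ { refl → x∉ i })) (*-zeroˡ (f y))) (∑-0 xs)

  -- Membership becomes a sum of equalities, so that double counting is an exchange of sums.
  𝟙-∈ : ∀ {x S} → Unique S → 𝟙 (x ∈? S) ≡ ∑[ y ∈ S ] 𝟙 (x ≟ y)
  𝟙-∈ {x} {S} u = trans (case x ∈? S of λ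
      { (yes i) → trans (𝟙-yes (x ∈? S) i) (sym (∑-≟ u i (λ _ → 1ℚ)))
      ; (no i) → trans (𝟙-no (x ∈? S) i) (sym (∑-≟-∉ S i (λ _ → 1ℚ))) })
    (∑-cong S λ {y} _ → *-identityʳ (𝟙 (x ≟ y)))

  ∑-∈-comm : ∀ {S T} → Unique S → Unique T → ∑[ x ∈ S ] 𝟙 (x ∈? T) ≡ ∑[ x ∈ T ] 𝟙 (x ∈? S)
  ∑-∈-comm {S} {T} uS uT = trans (∑-cong S λ _ → 𝟙-∈ uT) (trans (∑-swap S T _) (∑-cong T λ {y} _ →
    trans (∑-cong S λ {x} _ → 𝟙-cong (x ≟ y) (y ≟ x) sym sym) (sym (𝟙-∈ uS))))

  length-∖ : ∀ S T → ⟨ length (S ∖ T) ⟩ + (∑[ x ∈ S ] 𝟙 (x ∈? T)) ≡ ⟨ length S ⟩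
  length-∖ []      T = refl
  length-∖ (x ∷ S) T with x ∈? T
  ... | yes _ = trans (solve 2 (λ a b → a :+ (con 1ℚ :+ b) := con 1ℚ :+ (a :+ b)) refl ⟨ length (S ∖ T) ⟩ _) (cong (1ℚ +_) (length-∖ S T))
  ... | no  _ = trans (solve 2 (λ a b → con 1ℚ :+ a :+ (con 0ℚ :+ b) := con 1ℚ :+ (a :+ b)) refl ⟨ length (S ∖ T) ⟩ _) (cong (1ℚ +_) (length-∖ S T))

  length-∖-[] : ∀ {x S} → Unique S → x ∈ S → length S ≡ suc (length (S ∖ [ x ]))
  length-∖-[] {x} {y ∷ S} (n ∷ u) (here refl) = cong suc (sym (cong length (trans
    (Listₚ.filter-reject (λ z → ¬? (z ∈? [ x ])) (λ h → h (here refl)))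
    (Listₚ.filter-all (λ z → ¬? (z ∈? [ x ])) (All.map (λ ne → λ { (here e) → ne (sym e) }) n)))))
  length-∖-[] {x} {y ∷ S} (n ∷ u) (there i) = trans (cong suc (length-∖-[] u i)) (cong suc (sym (cong length
    (Listₚ.filter-accept (λ z → ¬? (z ∈? [ x ])) λ { (here refl) → All.lookup n i refl }))))

  -- An element of the ground list contributes a factor p exactly when it lies in S. All later uses
  -- of independence reduce to this formula.
  𝔼-χ : ∀ p {xs} → Unique xs → ∀ {S} → Unique S → S ⊆ xs → 𝔼 p xs (χ S) ≡ p ^ℚ length S
  𝔼-χ p {[]} ux {[]} uS s = refl
  𝔼-χ p {[]} ux {y ∷ S} uS (() ∷ _)
  𝔼-χ p {x ∷ xs} (x∉ ∷ ux) {S} uS s with x ∈? S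
  ... | yes i = trans (cong₂ (λ a b → p * a + (1ℚ - p) * b)
          (trans (𝔼-cong p xs {λ G → χ S (x ∷ G)} {χ S′} λ {G} sub → 𝟙-cong (S ⊆? (x ∷ G)) (S′ ⊆? G) (to sub) (from sub)) (𝔼-χ p ux (∖-Unique uS) S′⊆))
          (trans (𝔼-cong p xs {χ S} {λ _ → 0ℚ} λ {G} sub → 𝟙-no (S ⊆? G) λ h → All.lookup x∉ (Sub.lookup sub (All.lookup h i)) refl) (𝔼-const p xs 0ℚ)))
        (trans (solve 2 (λ p a → p :* a :+ (con 1ℚ :- p) :* con 0ℚ := p :* a) refl p (p ^ℚ length S′)) (cong (p ^ℚ_) (sym (length-∖-[] uS i))))
    where
    S′ = S ∖ [ x ]
    S′⊆ : S′ ⊆ xs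
    S′⊆ = All.tabulate λ j → case All.lookup s (proj₁ (∈-∖⁻ {S = S} {[ x ]} j)) of λ
      { (here refl) → contradiction (here refl) (proj₂ (∈-∖⁻ {S = S} {[ x ]} j)) ; (there k) → k }
    to : ∀ {G} → G ⊑ xs → S ⊆ (x ∷ G) → S′ ⊆ G
    to sub h = All.tabulate λ j → case All.lookup h (proj₁ (∈-∖⁻ {S = S} {[ x ]} j)) of λ
      { (here refl) → contradiction (here refl) (proj₂ (∈-∖⁻ {S = S} {[ x ]} j)) ; (there k) → k }
    from : ∀ {G} → G ⊑ xs → S′ ⊆ G → S ⊆ (x ∷ G)
    from sub h = All.tabulate λ {y} j → case y ≟ x of λ
      { (yes refl) → here refl ; (no ne) → there (All.lookup h (∈-∖⁺ {S = S} {[ x ]} j λ { (here e) → ne e })) }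
  ... | no x∉S = trans (cong₂ (λ a b → p * a + (1ℚ - p) * b)
          (trans (𝔼-cong p xs {λ G → χ S (x ∷ G)} {χ S} λ {G} _ → 𝟙-cong (S ⊆? (x ∷ G)) (S ⊆? G) to (All.map there)) ih) ih)
        (solve 2 (λ p a → p :* a :+ (con 1ℚ :- p) :* a := a) refl p (p ^ℚ length S))
    where
    to : ∀ {G} → S ⊆ (x ∷ G) → S ⊆ G
    to h = All.tabulate λ j → case All.lookup h j of λ { (here refl) → contradiction j x∉S ; (there k) → k }
    ih = 𝔼-χ p ux uS (All.tabulate λ j → case All.lookup s j of λ { (here refl) → contradiction j x∉S ; (there k) → k })

-- Absolute values and estimates for the error of the greedy process

∣∣≤ : ∀ {u b} → u ≤ℚ b → - u ≤ℚ b → ℚ.∣ u ∣ ≤ℚ b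
∣∣≤ {u} {b} p q = [ (λ e → subst (_≤ℚ b) (sym e) p) , (λ e → subst (_≤ℚ b) (sym e) q) ]′ (ℚₚ.∣p∣≡p∨∣p∣≡-p u)

∣∣-unit : ∀ {u v c} → u ≥0 → u ≤ℚ c → v ≥0 → v ≤ℚ c → ℚ.∣ u - v ∣ ≤ℚ c
∣∣-unit {u} {v} {c} u0 uc v0 vc = ∣∣≤
  (≤-by (+≥0 (diff≥0 uc) v0) (solve 3 (λ u v c → c := u :- v :+ (c :- u :+ v)) refl u v c))
  (≤-by (+≥0 (diff≥0 vc) u0) (solve 3 (λ u v c → c := :- (u :- v) :+ (c :- v :+ u)) refl u v c))

∣∣-scale : ∀ {c u b} → c ≥0 → ℚ.∣ u ∣ ≤ℚ b → ℚ.∣ c * u ∣ ≤ℚ c * b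
∣∣-scale {c} {u} {b} p q = subst (_≤ℚ c * b) (sym (trans (ℚₚ.∣p*q∣≡∣p∣*∣q∣ c u) (cong (_* ℚ.∣ u ∣) (ℚₚ.0≤p⇒∣p∣≡p p)))) (*-monoˡ p q)

∣∣-∑ : ∀ {A : Set} xs {f g : A → ℚ} → (∀ {x} → x ∈ xs → ℚ.∣ f x ∣ ≤ℚ g x) → ℚ.∣ ∑ xs f ∣ ≤ℚ ∑ xs g
∣∣-∑ []       h = ≤-refl
∣∣-∑ (x ∷ xs) {f} h = ≤-trans (ℚₚ.∣p+q∣≤∣p∣+∣q∣ (f x) (∑ xs f)) (+-mono-≤ (h (here refl)) (∣∣-∑ xs (h ∘ there)))

-- Bernoulli bounds the product below by 1 - s, and `pow-decay` bounds it above by 1 / (1 + s) ≤ 1 -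
-- s + s².
product-expansion : ∀ {z e} → z ≥0 → z ≤ℚ 1ℚ → e ≥0 → e ≤ℚ 1ℚ → ∀ m k → let s = ⟨ m ⟩ * z + ⟨ k ⟩ * e in
  ℚ.∣ (1ℚ - s) - (1ℚ - z) ^ℚ m * (1ℚ - e) ^ℚ k ∣ ≤ℚ s * s
product-expansion {z} {e} z0 z1 e0 e1 m k = ∣∣≤
  (≤-by (+≥0 (+≥0 (diff≥0 lower) (sq≥0 s)) ≤-refl) (solve 2 (λ s ab → s :* s := con 1ℚ :- s :- ab :+ (ab :- (con 1ℚ :- s) :+ s :* s :+ con 0ℚ)) refl s (A * B)))
  (≤-by (diff≥0 upper) (solve 2 (λ s ab → s :* s := :- (con 1ℚ :- s :- ab) :+ (con 1ℚ :- s :+ s :* s :- ab)) refl s (A * B)))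
  where
  A = (1ℚ - z) ^ℚ m
  B = (1ℚ - e) ^ℚ k
  α = ⟨ m ⟩ * z
  β = ⟨ k ⟩ * e
  s = α + β
  α0 = *≥0 (⟨⟩≥0 m) z0
  β0 = *≥0 (⟨⟩≥0 k) e0
  s0 = +≥0 α0 β0
  A0 = ^≥0 (diff≥0 z1) m
  B0 = ^≥0 (diff≥0 e1) k
  A1 = ^≤1 (diff≥0 z1) (≤-by z0 (solve 1 (λ z → con 1ℚ := con 1ℚ :- z :+ z) refl z)) m
  B1 = ^≤1 (diff≥0 e1) (≤-by e0 (solve 1 (λ z → con 1ℚ := con 1ℚ :- z :+ z) refl e)) k
  lower : 1ℚ - s ≤ℚ A * B
  lower = ≤-by (+≥0 (+≥0 (*≥0 (diff≥0 A1) (diff≥0 B1)) (diff≥0 (bernoulli z1 m))) (diff≥0 (bernoulli e1 k)))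
    (solve 4 (λ a b x y → a :* b := con 1ℚ :- (x :+ y) :+ ((con 1ℚ :- a) :* (con 1ℚ :- b) :+ (a :- (con 1ℚ :- x)) :+ (b :- (con 1ℚ :- y)))) refl A B α β)
  prod : A * B * (1ℚ + s) ≤ℚ 1ℚ
  prod = ≤-trans (≤-by (*≥0 (*≥0 A0 B0) (*≥0 α0 β0))
      (solve 4 (λ a b x y → a :* (con 1ℚ :+ x) :* (b :* (con 1ℚ :+ y)) := a :* b :* (con 1ℚ :+ (x :+ y)) :+ a :* b :* (x :* y)) refl A B α β))
    (*-mono {d = 1ℚ} (*≥0 A0 (+≥0 0≤1 α0)) (*≥0 B0 (+≥0 0≤1 β0)) (pow-decay z0 z1 m) (pow-decay e0 e1 k))
  upper : A * B ≤ℚ 1ℚ - s + s * s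
  upper = *-cancelˡ (<-≤-trans 0<1 (≤-by s0 refl)) (≤-by (+≥0 (*≥0 (sq≥0 s) s0) (diff≥0 prod))
    (solve 2 (λ s ab → (con 1ℚ :+ s) :* (con 1ℚ :- s :+ s :* s) := (con 1ℚ :+ s) :* ab :+ (s :* s :* s :+ (con 1ℚ :- ab :* (con 1ℚ :+ s)))) refl s (A * B)))

n≤2^n : ∀ n → ⟨ n ⟩ ≤ℚ 2ℚ ^ℚ n
n≤2^n zero    = 0≤1
n≤2^n (suc n) = ≤-by (+≥0 (diff≥0 (n≤2^n n)) (diff≥0 (1≤2^ n))) (solve 2 (λ n x → con 2ℚ :* x := con 1ℚ :+ n :+ (x :- n :+ (x :- con 1ℚ))) refl ⟨ n ⟩ (2ℚ ^ℚ n))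
  where 1≤2^ : ∀ n → 1ℚ ≤ℚ 2ℚ ^ℚ n
        1≤2^ zero = ≤-refl
        1≤2^ (suc n) = ≤-trans (1≤2^ n) (≤-by (^≥0 (+≥0 0≤1 0≤1) n) (solve 1 (λ x → con 2ℚ :* x := x :+ x) refl (2ℚ ^ℚ n)))

16ℚ 256ℚ ½ : ℚ
16ℚ = 4ℚ * 4ℚ
256ℚ = 16ℚ * 16ℚ
½ = ℚ.½

-- From n ≤ 2^n. This is the origin of the base 16: each step of the process produces errors of
-- order |S|⁴, and 16^|S| absorbs them.
n⁴≤16^n : ∀ n → ⟨ n ⟩ ^ℚ 4 ≤ℚ 16ℚ ^ℚ n
n⁴≤16^n n = subst (⟨ n ⟩ ^ℚ 4 ≤ℚ_) (trans (solve 1 (λ x → x :* (x :* (x :* (x :* con 1ℚ))) := x :* x :* (x :* x)) refl (2ℚ ^ℚ n))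
    (trans (cong (λ k → k * k) (sym (*-^ 2ℚ 2ℚ n))) (sym (*-^ (2ℚ * 2ℚ) (2ℚ * 2ℚ) n))))
  (^-mono (⟨⟩≥0 n) (n≤2^n n) 4)

n≤n² : ∀ n → ⟨ n ⟩ ≤ℚ ⟨ n ⟩ * ⟨ n ⟩
n≤n² zero    = ≤-refl
n≤n² (suc n) = ≤-by (*≥0 (⟨⟩≥0 n) (⟨⟩≥0 (suc n))) (solve 1 (λ n → (con 1ℚ :+ n) :* (con 1ℚ :+ n) := con 1ℚ :+ n :+ n :* (con 1ℚ :+ n)) refl ⟨ n ⟩)

-- Either s ≥ 1, and w ≤ 1 suffices, or s² ≤ s. It takes the square root of an error bound once the
-- error is known to be at most 1.
≤-sq⇒≤ : ∀ {w s} → s ≥0 → w ≤ℚ 1ℚ → w ≤ℚ s * s → w ≤ℚ s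
≤-sq⇒≤ {w} {s} s0 w1 ws with ≤-total 1ℚ s
... | inj₁ p = ≤-trans w1 p
... | inj₂ p = ≤-trans ws (subst (s * s ≤ℚ_) (*-identityʳ s) (*-monoˡ s0 p))

-- Smallness of p needed to run i blocks of the process with final error η.
Small : ℚ → ℕ → ℚ → ℚ → Set
Small C zero    η p = ⊤
Small C (suc i) η p = Small C i (½ * (η * η)) p × p * C ≤ℚ ½ * (η * η)

small : ∀ {C} → 0ℚ <ℚ C → ∀ i {η} → 0ℚ <ℚ η → ∃[ ρ ] (0ℚ <ℚ ρ × (∀ {p} → p ≤ℚ ρ → Small C i η p))
small C>0 zero    η>0 = 1ℚ , 0<1 , λ _ → tt
small {C} C>0 (suc i) {η} η>0 with small C>0 i {½ * (η * η)} (*>0 (positive⁻¹ ½) (*>0 η>0 η>0)) | inverse C>0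
... | ρ , ρ>0 , h | c , c>0 , e = ρ ℚ.⊓ ρ′ , min>0 , λ {p} q → h (≤-trans q (ℚₚ.p⊓q≤p ρ ρ′)) ,
    subst (p * C ≤ℚ_) (trans (solve 3 (λ h c C → h :* c :* C := h :* (c :* C)) refl (½ * (η * η)) c C) (trans (cong (½ * (η * η) *_) e) (*-identityʳ _)))
      (*-monoʳ (<⇒≤ C>0) (≤-trans q (ℚₚ.p⊓q≤q ρ ρ′)))
  where
  ρ′ = ½ * (η * η) * c
  ρ′>0 = *>0 (*>0 (positive⁻¹ ½) (*>0 η>0 η>0)) c>0
  min>0 : 0ℚ <ℚ ρ ℚ.⊓ ρ′
  min>0 with ℚₚ.⊓-sel ρ ρ′
  ... | inj₁ e = subst (0ℚ <ℚ_) (sym e) ρ>0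
  ... | inj₂ e = subst (0ℚ <ℚ_) (sym e) ρ′>0

-- Random greedy packing in linear 3-uniform hypergraphs

module _ {A : Set} where

  ∑-atMost1 : ∀ {P : A → Set} (P? : ∀ x → Dec (P x)) {xs} → Unique xs →
              (∀ {x y} → x ∈ xs → y ∈ xs → P x → P y → x ≡ y) → ∑[ x ∈ xs ] 𝟙 (P? x) ≤ℚ 1ℚ
  ∑-atMost1 P? {[]}     u h = 0≤1
  ∑-atMost1 P? {x ∷ xs} (n ∷ u) h with P? x
  ... | yes p = ≤-reflexive (trans (cong (1ℚ +_) (trans (∑-cong xs λ {y} i →
                  𝟙-no (P? y) λ q → All.lookup n i (h (here refl) (there i) p q)) (∑-0 xs))) (+-identityʳ 1ℚ))
  ... | no  _ = subst (_≤ℚ 1ℚ) (sym (+-identityˡ _)) (∑-atMost1 P? u λ i j → h (there i) (there j))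

  ∑-*-∑ : ∀ {B : Set} xs ys (f : A → ℚ) (g : B → ℚ) → ∑ xs f * ∑ ys g ≡ ∑[ x ∈ xs ] ∑[ y ∈ ys ] f x * g y
  ∑-*-∑ xs ys f g = trans (sym (∑-*ʳ xs (∑ ys g) f)) (∑-cong xs λ {x} _ → sym (∑-*ˡ ys (f x) g))

  -- The predicates differ only at `t`, which occurs exactly once in the list.
  filter-suc : ∀ {P Q : A → Set} (P? : ∀ x → Dec (P x)) (Q? : ∀ x → Dec (Q x)) {xs t} → Unique xs → t ∈ xs →
               (∀ {x} → x ∈ xs → P x → Q x ⊎ x ≡ t) → (∀ {x} → Q x → P x) → P t → ¬ Q t →
               length (filter P? xs) ≡ suc (length (filter Q? xs))
  filter-suc P? Q? {x ∷ xs} (n ∷ u) (here refl) P⇒ Q⇒ Pt ¬Qt = trans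
    (cong length (Listₚ.filter-accept P? Pt))
    (cong suc (trans (rest n P⇒) (cong length (sym (Listₚ.filter-reject Q? ¬Qt)))))
    where
    rest : ∀ {zs} → All (x ≢_) zs → (∀ {y} → y ∈ x ∷ zs → _ → _) → length (filter P? zs) ≡ length (filter Q? zs)
    rest [] _ = refl
    rest {z ∷ zs} (ne ∷ nes) h with P? z | Q? z
    ... | yes p | yes q = cong suc (rest nes λ { (here e) → h (here e) ; (there i) → h (there (there i)) })
    ... | no  p | no  q = rest nes λ { (here e) → h (here e) ; (there i) → h (there (there i)) }
    ... | no ¬p | yes q = contradiction (Q⇒ q) ¬p
    ... | yes p | no ¬q with h (there (here refl)) p
    ...   | inj₁ q = contradiction q ¬q
    ...   | inj₂ e = contradiction (sym e) ne
  filter-suc P? Q? {x ∷ xs} (n ∷ u) (there i) P⇒ Q⇒ Pt ¬Qt with P? x | Q? x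
  ... | yes p | yes q = cong suc (filter-suc P? Q? u i (P⇒ ∘ there) Q⇒ Pt ¬Qt)
  ... | no  p | no  q = filter-suc P? Q? u i (P⇒ ∘ there) Q⇒ Pt ¬Qt
  ... | no ¬p | yes q = contradiction (Q⇒ q) ¬p
  ... | yes p | no ¬q with P⇒ (here refl) p
  ...   | inj₁ q = contradiction q ¬q
  ...   | inj₂ refl = contradiction refl (All.lookup n i)

-- Applied to the hypergraph whose vertices are the edges of the complete graph and whose hyperedges are its triangles.
module Hypergraph {V T : Set} (_≟ᵥ_ : DecidableEquality V) (es : List V) (ts : List T) (inc : T → List V)
  (es-unique : Unique es) (ts-unique : Unique ts)
  (inc-⊆ : ∀ {t} → t ∈ ts → All (_∈ es) (inc t)) (inc-unique : ∀ {t} → t ∈ ts → Unique (inc t))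
  (inc-length : ∀ t → length (inc t) ≡ 3)
  (linear : ∀ {t t′ f f′} → t ∈ ts → t′ ∈ ts → f ≢ f′ → f ∈ inc t → f′ ∈ inc t → f ∈ inc t′ → f′ ∈ inc t′ → t ≡ t′)
  (D : ℚ) (D≥0 : D ≥0) (degree : ∀ {f} → f ∈ es → ∑[ t ∈ ts ] 𝟙 (Any.any? (f ≟ᵥ_) (inc t)) ≡ D)
  where

  open Containment _≟ᵥ_

  Valid : List V → Set
  Valid S = Unique S × S ⊆ es

  fresh : List V → T → List V
  fresh S t = inc t ∖ S

  meet : List V → T → ℚ
  meet S t = ∑[ f ∈ S ] 𝟙 (f ∈? inc t)

  θ : List V → ℕ
  θ S = length (filter (λ t → inc t ⊆? S) ts)

  meet-fresh : ∀ {S} → Unique S → ∀ {t} → t ∈ ts → meet S t ≡ 3ℚ - ⟨ length (fresh S t) ⟩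
  meet-fresh {S} u {t} i = trans (∑-∈-comm u (inc-unique i)) (trans
    (solve 2 (λ a b → b := a :+ b :- a) refl ⟨ length (fresh S t) ⟩ (∑[ f ∈ inc t ] 𝟙 (f ∈? S)))
    (cong (_- ⟨ length (fresh S t) ⟩) (trans (length-∖ (inc t) S) (trans (cong ⟨_⟩ (inc-length t)) refl))))

  meet≥0 : ∀ S t → meet S t ≥0
  meet≥0 S t = ∑≥0 S λ {f} _ → 𝟙≥0 (f ∈? inc t)

  fresh≤3 : ∀ S t → length (fresh S t) ≤ 3
  fresh≤3 S t = subst (length (fresh S t) ≤_) (inc-length t) (Listₚ.length-filter (λ x → ¬? (x ∈? S)) (inc t))

  -- With k = 3 - n the size of a meet, this is k (k - 1) ≥ 0 for k = 0, 1, 2, 3.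
  pairs≥0 : ∀ n → n ≤ 3 → (3ℚ - ⟨ n ⟩) * (3ℚ - ⟨ n ⟩) - (3ℚ - ⟨ n ⟩) ≥0
  pairs≥0 0 _ = toWitness {a? = 0ℚ ℚₚ.≤? (3ℚ - ⟨ 0 ⟩) * (3ℚ - ⟨ 0 ⟩) - (3ℚ - ⟨ 0 ⟩)} _
  pairs≥0 1 _ = toWitness {a? = 0ℚ ℚₚ.≤? (3ℚ - ⟨ 1 ⟩) * (3ℚ - ⟨ 1 ⟩) - (3ℚ - ⟨ 1 ⟩)} _
  pairs≥0 2 _ = toWitness {a? = 0ℚ ℚₚ.≤? (3ℚ - ⟨ 2 ⟩) * (3ℚ - ⟨ 2 ⟩) - (3ℚ - ⟨ 2 ⟩)} _
  pairs≥0 3 _ = toWitness {a? = 0ℚ ℚₚ.≤? (3ℚ - ⟨ 3 ⟩) * (3ℚ - ⟨ 3 ⟩) - (3ℚ - ⟨ 3 ⟩)} _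
  pairs≥0 (suc (suc (suc (suc _)))) (s≤s (s≤s (s≤s ())))

  pairs-meet≥0 : ∀ {S} → Unique S → ∀ {t} → t ∈ ts → meet S t * meet S t - meet S t ≥0
  pairs-meet≥0 {S} u {t} i = subst (λ k → k * k - k ≥0) (sym (meet-fresh u i)) (pairs≥0 (length (fresh S t)) (fresh≤3 S t))

  codegree≤1 : ∀ {f f′} → f ≢ f′ → ∑[ t ∈ ts ] 𝟙 (f ∈? inc t) * 𝟙 (f′ ∈? inc t) ≤ℚ 1ℚ
  codegree≤1 {f} {f′} ne = subst (_≤ℚ 1ℚ) (∑-cong ts λ {t} _ → 𝟙-× (f ∈? inc t) (f′ ∈? inc t))
    (∑-atMost1 (λ t → (f ∈? inc t) ×-dec (f′ ∈? inc t)) ts-unique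
      λ i j (a , b) (c , d) → linear i j ne a b c d)

  ∑-meet : ∀ {S} → S ⊆ es → ∑[ t ∈ ts ] meet S t ≡ ⟨ length S ⟩ * D
  ∑-meet {S} s = trans (∑-swap ts S _) (trans (∑-cong S λ i → degree (All.lookup s i)) (∑-const S D))

  -- A meet of size k contains k (k - 1) ordered pairs of distinct vertices of S, and by linearity
  -- each such pair lies in at most one hyperedge.
  ∑-pairs-meet : ∀ {S} → Valid S → ∑[ t ∈ ts ] (meet S t * meet S t - meet S t) ≤ℚ ⟨ length S ⟩ * ⟨ length S ⟩
  ∑-pairs-meet {S} (u , s) = subst (_≤ℚ m * m) (sym split)
    (≤-by (diff≥0 le) (solve 3 (λ m d x → m :* m := x :- m :* d :+ (m :* m :+ m :* d :- x)) refl m D (∑[ t ∈ ts ] meet S t * meet S t)))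
    where
    m = ⟨ length S ⟩
    split : ∑[ t ∈ ts ] (meet S t * meet S t - meet S t) ≡ ∑[ t ∈ ts ] meet S t * meet S t - m * D
    split = trans (∑-cong ts λ {t} _ → solve 1 (λ k → k :* k :- k := k :* k :+ con (- 1ℚ) :* k) refl (meet S t))
      (trans (∑-+ ts (λ t → meet S t * meet S t) _) (trans (cong ((∑[ t ∈ ts ] meet S t * meet S t) +_)
        (trans (∑-*ˡ ts (- 1ℚ) (meet S)) (cong (- 1ℚ *_) (∑-meet s))))
        (solve 2 (λ a b → a :+ con (- 1ℚ) :* b := a :- b) refl (∑[ t ∈ ts ] meet S t * meet S t) (m * D))))
    le : ∑[ t ∈ ts ] meet S t * meet S t ≤ℚ m * m + m * D
    le = subst₂ _≤ℚ_
      (sym (trans (∑-cong ts λ {t} _ → ∑-*-∑ S S _ _) (trans (∑-swap ts S _) (∑-cong S λ _ → ∑-swap ts S _))))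
      (trans (∑-cong S λ {f} i → trans (∑-+ S (λ _ → 1ℚ) _) (cong₂ _+_ (∑-const S 1ℚ) (∑-≟ u i (λ _ → D))))
        (trans (∑-const S (m * 1ℚ + D)) (solve 2 (λ m d → m :* (m :* con 1ℚ :+ d) := m :* m :+ m :* d) refl m D)))
      (∑-mono S λ {f} i → ∑-mono S λ {f′} j → pair f f′ i)
      where
      pair : ∀ f f′ → f ∈ S → ∑[ t ∈ ts ] 𝟙 (f ∈? inc t) * 𝟙 (f′ ∈? inc t) ≤ℚ 1ℚ + 𝟙 (f ≟ᵥ f′) * D
      pair f f′ i with f ≟ᵥ f′
      ... | no ne = subst (∑[ t ∈ ts ] 𝟙 (f ∈? inc t) * 𝟙 (f′ ∈? inc t) ≤ℚ_) (solve 1 (λ d → con 1ℚ := con 1ℚ :+ con 0ℚ :* d) refl D) (codegree≤1 ne)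
      ... | yes refl = ≤-by 0≤1 (trans (solve 1 (λ d → con 1ℚ :+ con 1ℚ :* d := d :+ con 1ℚ) refl D)
        (cong (_+ 1ℚ) (sym (trans (∑-cong ts λ {t} _ → idem (f ∈? inc t)) (degree (All.lookup s i))))))
        where idem : ∀ {P : Set} (d : Dec P) → 𝟙 d * 𝟙 d ≡ 𝟙 d
              idem (yes _) = refl
              idem (no _)  = refl

  -- Adding the hyperedge t to S completes the hyperedge t′ as well.
  Clash : List V → T → T → Set
  Clash S t t′ = length (fresh S t′) ≡ 1 × Any (_∈ inc t) (fresh S t′)

  clash? : ∀ S t t′ → Dec (Clash S t t′)
  clash? S t t′ = (length (fresh S t′) ℕ.≟ 1) ×-dec Any.any? (_∈? inc t) (fresh S t′)

  -- Counts the triples (f, t′, g) where f lies in S and in t, and g is both in t and the only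
  -- vertex of t′ outside S. The factor `meet S t` is harmless in the intended case of meet 1, and
  -- it makes the sum over t small: f and g determine t.
  clashes : List V → T → ℚ
  clashes S t = meet S t * (∑[ t′ ∈ ts ] 𝟙 (length (fresh S t′) ℕ.≟ 1) * (∑[ g ∈ fresh S t′ ] 𝟙 (g ∈? inc t)))

  clashes≥0 : ∀ S t → clashes S t ≥0
  clashes≥0 S t = *≥0 (meet≥0 S t) (∑≥0 ts λ {t′} _ → *≥0 (𝟙≥0 (length (fresh S t′) ℕ.≟ 1)) (∑≥0 (fresh S t′) λ {g} _ → 𝟙≥0 (g ∈? inc t)))

  clashes≥1 : ∀ {S t} → meet S t ≡ 1ℚ → Any (Clash S t) ts → 1ℚ ≤ℚ clashes S t
  clashes≥1 {S} {t} e c = subst (1ℚ ≤ℚ_) (sym (trans (cong (_* X) e) (*-identityˡ X))) (outer c)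
    where
    term : T → ℚ
    term t′ = 𝟙 (length (fresh S t′) ℕ.≟ 1) * (∑[ g ∈ fresh S t′ ] 𝟙 (g ∈? inc t))
    X = ∑ ts term
    inner : ∀ gs → Any (_∈ inc t) gs → 1ℚ ≤ℚ ∑[ g ∈ gs ] 𝟙 (g ∈? inc t)
    inner gs a = let g , g∈ , h = find a in
      subst (_≤ℚ ∑[ g ∈ gs ] 𝟙 (g ∈? inc t)) (𝟙-yes (g ∈? inc t) h) (∑-∈ gs (λ {g} _ → 𝟙≥0 (g ∈? inc t)) g∈)
    outer : Any (Clash S t) ts → 1ℚ ≤ℚ X
    outer a = let t′ , t′∈ , (l , h) = find a in ≤-trans
      (subst (1ℚ ≤ℚ_) (sym (trans (cong (_* (∑[ g ∈ fresh S t′ ] 𝟙 (g ∈? inc t))) (𝟙-yes (length (fresh S t′) ℕ.≟ 1) l)) (*-identityˡ _))) (inner (fresh S t′) h))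
      (∑-∈ ts (λ {t′} _ → *≥0 (𝟙≥0 (length (fresh S t′) ℕ.≟ 1)) (∑≥0 (fresh S t′) λ {g} _ → 𝟙≥0 (g ∈? inc t))) t′∈)

  -- Since g is outside S, it differs from f, and linearity leaves at most one t for given f and g.
  -- So each t′ with a single fresh vertex contributes at most m. Such t′ have meet 2 and are
  -- counted by `∑-pairs-meet`.
  ∑-clashes : ∀ {S} → Valid S → ∑[ t ∈ ts ] clashes S t ≤ℚ ⟨ length S ⟩ * (⟨ length S ⟩ * ⟨ length S ⟩)
  ∑-clashes {S} (u , s) = ≤-trans (subst₂ _≤ℚ_ (sym reorganise) (∑-*ˡ ts m _) (∑-mono ts bound)) (*-monoˡ (⟨⟩≥0 (length S)) (∑-pairs-meet (u , s)))
    where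
    m = ⟨ length S ⟩
    one : T → ℚ
    one t′ = 𝟙 (length (fresh S t′) ℕ.≟ 1)
    reorganise : ∑[ t ∈ ts ] clashes S t ≡
      ∑[ t′ ∈ ts ] one t′ * (∑[ g ∈ fresh S t′ ] ∑[ f ∈ S ] ∑[ t ∈ ts ] 𝟙 (f ∈? inc t) * 𝟙 (g ∈? inc t))
    reorganise = trans (∑-cong ts λ {t} _ → trans (sym (∑-*ˡ ts (meet S t) _)) (∑-cong ts λ {t′} _ →
        trans (solve 3 (λ a b c → a :* (b :* c) := b :* (c :* a)) refl (meet S t) (one t′) (∑[ g ∈ fresh S t′ ] 𝟙 (g ∈? inc t)))
          (cong (one t′ *_) (trans (∑-*-∑ (fresh S t′) S _ _) (∑-cong (fresh S t′) λ {g} _ → ∑-cong S λ {f} _ → *-comm (𝟙 (g ∈? inc t)) (𝟙 (f ∈? inc t)))))))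
      (trans (∑-swap ts ts _) (∑-cong ts λ {t′} _ → trans (∑-*ˡ ts (one t′) _) (cong (one t′ *_)
        (trans (∑-swap ts (fresh S t′) _) (∑-cong (fresh S t′) λ _ → ∑-swap ts S _)))))
    bound : ∀ {t′} → t′ ∈ ts → one t′ * (∑[ g ∈ fresh S t′ ] ∑[ f ∈ S ] ∑[ t ∈ ts ] 𝟙 (f ∈? inc t) * 𝟙 (g ∈? inc t))
                      ≤ℚ m * (meet S t′ * meet S t′ - meet S t′)
    bound {t′} i = 𝟙-elim (λ k → k * X ≤ℚ m * (meet S t′ * meet S t′ - meet S t′)) (length (fresh S t′) ℕ.≟ 1)
      (λ e → ≤-trans
        (*-monoˡ 0≤1 (∑-mono (fresh S t′) λ {g} g∈ → ∑-mono S λ {f} f∈ →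
          codegree≤1 {f} {g} λ { refl → proj₂ (∈-∖⁻ {S = inc t′} {S} g∈) f∈ }))
        (subst₂ _≤ℚ_ (sym (trans (*-identityˡ _) (trans (∑-const (fresh S t′) _) (trans (cong₂ (λ a b → a * b) (cong ⟨_⟩ e) (∑-const S 1ℚ))
             (solve 1 (λ m → (con 1ℚ :+ con 0ℚ) :* (m :* con 1ℚ) := m) refl m)))))
           (cong (λ k → m * (k * k - k)) (sym (trans (meet-fresh u i) (cong (λ k → 3ℚ - ⟨ k ⟩) e))))
           (≤-by (⟨⟩≥0 (length S)) (solve 1 (λ m → m :* con (2ℚ * 2ℚ - 2ℚ) := m :+ m) refl m))))
      (λ _ → subst (_≤ℚ m * (meet S t′ * meet S t′ - meet S t′)) (sym (*-zeroˡ X))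
        (*≥0 (⟨⟩≥0 (length S)) (pairs-meet≥0 u i)))
      where X = ∑[ g ∈ fresh S t′ ] ∑[ f ∈ S ] ∑[ t ∈ ts ] 𝟙 (f ∈? inc t) * 𝟙 (g ∈? inc t)

  θ≤ : ∀ {S} → Valid S → ⟨ θ S ⟩ ≤ℚ ⟨ length S ⟩ * ⟨ length S ⟩
  θ≤ {S} (u , s) = ≤-trans (subst (_≤ℚ ∑[ t ∈ ts ] (meet S t * meet S t - meet S t)) (sym (length-filter (λ t → inc t ⊆? S) ts))
      (∑-mono ts bound)) (∑-pairs-meet (u , s))
    where
    bound : ∀ {t} → t ∈ ts → 𝟙 (inc t ⊆? S) ≤ℚ meet S t * meet S t - meet S t
    bound {t} i = 𝟙-elim (_≤ℚ meet S t * meet S t - meet S t) (inc t ⊆? S)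
      (λ h → subst (λ k → 1ℚ ≤ℚ k * k - k) (sym (trans (meet-fresh u i) (cong (λ k → 3ℚ - ⟨ length k ⟩)
        (Listₚ.filter-none (λ x → ¬? (x ∈? S)) (All.map (λ j k → k j) h)))))
        (toWitness {a? = 1ℚ ℚₚ.≤? (3ℚ - ⟨ 0 ⟩) * (3ℚ - ⟨ 0 ⟩) - (3ℚ - ⟨ 0 ⟩)} _))
      (λ _ → pairs-meet≥0 u i)

  θ≤ts : ∀ S → θ S ≤ length ts
  θ≤ts S = Listₚ.length-filter (λ t → inc t ⊆? S) ts

  fresh-Valid : ∀ {S} → Valid S → ∀ {t} → t ∈ ts → Valid (fresh S t ++ S)
  fresh-Valid {S} (u , s) {t} i = Uniqueₚ.++⁺ (∖-Unique (inc-unique i)) u (λ (a , b) → proj₂ (∈-∖⁻ {S = inc t} {S} a) b) ,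
    Allₚ.++⁺ (All.tabulate λ j → All.lookup (inc-⊆ i) (proj₁ (∈-∖⁻ {S = inc t} {S} j))) s

  inc-⊆-fresh : ∀ S t → inc t ⊆ (fresh S t ++ S)
  inc-⊆-fresh S t = All.tabulate λ {f} i → case f ∈? S of λ
    { (yes j) → ∈-++⁺ʳ (fresh S t) j ; (no j) → ∈-++⁺ˡ (∈-∖⁺ {S = inc t} {S} i j) }

  -- A hyperedge t′ that is inside only after the enlargement has all its fresh vertices in t. If
  -- there is just one, t′ clashes with t; if there are two, linearity forces t′ = t.
  θ-fresh : ∀ {S} → Valid S → ∀ {t} → t ∈ ts → length (fresh S t) ≡ 2 → ¬ Any (Clash S t) ts →
            θ (fresh S t ++ S) ≡ suc (θ S)
  θ-fresh {S} (u , s) {t} i e ¬c = filter-suc (λ t′ → inc t′ ⊆? (fresh S t ++ S)) (λ t′ → inc t′ ⊆? S) ts-unique i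
      new (All.map (∈-++⁺ʳ (fresh S t))) (inc-⊆-fresh S t)
      λ h → contradiction (trans (sym e) (cong length (Listₚ.filter-none (λ x → ¬? (x ∈? S)) (All.map (λ j k → k j) h)))) λ ()
    where
    in-t : ∀ {t′ g} → inc t′ ⊆ (fresh S t ++ S) → g ∈ fresh S t′ → g ∈ inc t × g ∈ inc t′
    in-t {t′} h j with ∈-∖⁻ {S = inc t′} {S} j
    ... | g∈ , g∉ with ∈-++⁻ (fresh S t) (All.lookup h g∈)
    ...   | inj₁ k = proj₁ (∈-∖⁻ {S = inc t} {S} k) , g∈
    ...   | inj₂ k = contradiction k g∉
    new : ∀ {t′} → t′ ∈ ts → inc t′ ⊆ (fresh S t ++ S) → inc t′ ⊆ S ⊎ t′ ≡ t
    new {t′} j h with fresh S t′ in eq | ∖-Unique {inc t′} {S} (inc-unique j)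
    ... | [] | _ = inj₁ (All.tabulate λ {f} k → case f ∈? S of λ
      { (yes z) → z ; (no z) → case subst (f ∈_) eq (∈-∖⁺ {S = inc t′} {S} k z) of λ () })
    ... | g ∷ [] | _ = contradiction (Any.map (λ { refl → cong length eq , subst (Any (_∈ inc t)) (sym eq) (here (proj₁ (in-t h (subst (g ∈_) (sym eq) (here refl))))) }) j) ¬c
    ... | g ∷ g′ ∷ _ | un = inj₂ (linear j i (All.lookup (AllPairs.head (subst Unique eq (∖-Unique {inc t′} {S} (inc-unique j)))) (here refl))
        (proj₂ (in-t h g∈)) (proj₂ (in-t h g′∈)) (proj₁ (in-t h g∈)) (proj₁ (in-t h g′∈)))
      where g∈ = subst (g ∈_) (sym eq) (here refl)
            g′∈ = subst (g′ ∈_) (sym eq) (there (here refl))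

  -- One step of the random greedy packing picks t uniformly and removes its vertices if they are all still available.
  module Process {ε : ℚ} (ε≥0 : ε ≥0) (ε-total : ⟨ length ts ⟩ * ε ≡ 1ℚ) where

    pick : T → List V → List V
    pick t U = if does (inc t ⊆? U) then U ∖ inc t else U

    L : (List V → ℚ) → List V → ℚ
    L F U = ε * (∑[ t ∈ ts ] F (pick t U))

    -- Conditional expectation after r steps, given the present set. The recursion peels off the
    -- last step, so that `L-χ` can be applied inside `K r`.
    K : ℕ → (List V → ℚ) → List V → ℚ
    K zero    F = F
    K (suc r) F = K r (L F)

    pick-cases : ∀ t U (C : List V → Set) → (inc t ⊆ U → C (U ∖ inc t)) → (¬ inc t ⊆ U → C U) → C (pick t U)
    pick-cases t U C f g = go (inc t ⊆? U) f g
      where go : (d : Dec (inc t ⊆ U)) → (inc t ⊆ U → C (U ∖ inc t)) → (¬ inc t ⊆ U → C U) → C (if does d then U ∖ inc t else U)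
            go (yes h) f g = f h
            go (no h)  f g = g h

    ∖-Valid : ∀ {U} S → Valid U → Valid (U ∖ S)
    ∖-Valid {U} S (u , s) = ∖-Unique u , All.tabulate λ i → All.lookup s (proj₁ (∈-∖⁻ {S = U} {S} i))

    pick-Valid : ∀ t {U} → Valid U → Valid (pick t U)
    pick-Valid t {U} v = pick-cases t U Valid (λ _ → ∖-Valid (inc t) v) (λ _ → v)

    K-mono : ∀ r {F F′} → (∀ {U} → Valid U → F U ≤ℚ F′ U) → ∀ {U} → Valid U → K r F U ≤ℚ K r F′ U
    K-mono zero    h = h
    K-mono (suc r) h = K-mono r λ v → *-monoˡ ε≥0 (∑-mono ts λ {t} _ → h (pick-Valid t v))

    K-cong : ∀ r {F F′} → (∀ {U} → Valid U → F U ≡ F′ U) → ∀ {U} → Valid U → K r F U ≡ K r F′ U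
    K-cong r h v = ≤-antisym (K-mono r (≤-reflexive ∘ h) v) (K-mono r (≤-reflexive ∘ sym ∘ h) v)

    K-+ : ∀ r F F′ {U} → Valid U → K r (λ W → F W + F′ W) U ≡ K r F U + K r F′ U
    K-+ zero    F F′ v = refl
    K-+ (suc r) F F′ v = trans (K-cong r (λ {U} _ → trans (cong (ε *_) (∑-+ ts _ _)) (*-distribˡ-+ ε _ _)) v) (K-+ r (L F) (L F′) v)

    K-∑ : ∀ {B : Set} r ys (c : B → ℚ) (F : B → List V → ℚ) {U} → Valid U →
          K r (λ W → ∑[ y ∈ ys ] c y * F y W) U ≡ ∑[ y ∈ ys ] c y * K r (F y) U
    K-∑ zero    ys c F v = refl
    K-∑ (suc r) ys c F v = trans (K-cong r (λ {U} _ →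
      trans (cong (ε *_) (∑-swap ts ys _)) (trans (sym (∑-*ˡ ys ε _)) (∑-cong ys λ {y} _ →
        trans (cong (ε *_) (∑-*ˡ ts (c y) _)) (solve 3 (λ a b c → a :* (b :* c) := b :* (a :* c)) refl ε (c y) (∑[ t ∈ ts ] F y (pick t U)))))) v)
      (K-∑ r ys c (L ∘ F) v)

    touch? : ∀ S t → Dec (Any (_∈ S) (inc t))
    touch? S t = Any.any? (_∈? S) (inc t)

    -- S is destroyed by t exactly when t meets S and is removed, which requires S and all of t,
    -- that is `fresh S t ++ S`, to be present.
    χ-pick : ∀ S U t → χ S (pick t U) ≡ χ S U + (- 1ℚ) * (𝟙 (touch? S t) * χ (fresh S t ++ S) U)
    χ-pick S U t = pick-cases t U (λ W → χ S W ≡ χ S U + (- 1ℚ) * (𝟙 (touch? S t) * χ (fresh S t ++ S) U)) in-U out-U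
      where
      out-U : ¬ inc t ⊆ U → χ S U ≡ χ S U + (- 1ℚ) * (𝟙 (touch? S t) * χ (fresh S t ++ S) U)
      out-U h = trans (solve 2 (λ a b → a := a :+ con (- 1ℚ) :* (b :* con 0ℚ)) refl (χ S U) (𝟙 (touch? S t)))
        (cong (λ k → χ S U + (- 1ℚ) * (𝟙 (touch? S t) * k)) (sym (𝟙-no ((fresh S t ++ S) ⊆? U) λ k → h (All.map (All.lookup k) (inc-⊆-fresh S t)))))
      in-U : inc t ⊆ U → χ S (U ∖ inc t) ≡ χ S U + (- 1ℚ) * (𝟙 (touch? S t) * χ (fresh S t ++ S) U)
      in-U h = 𝟙-elim (λ k → χ S (U ∖ inc t) ≡ χ S U + (- 1ℚ) * (k * χ (fresh S t ++ S) U)) (touch? S t)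
        (λ a → trans (𝟙-no (S ⊆? (U ∖ inc t)) λ k → touched k a) (trans (solve 1 (λ a → con 0ℚ := a :+ con (- 1ℚ) :* (con 1ℚ :* a)) refl (χ S U))
          (cong (λ k → χ S U + (- 1ℚ) * (1ℚ * k)) (𝟙-cong (S ⊆? U) ((fresh S t ++ S) ⊆? U)
            (λ k → Allₚ.++⁺ (All.tabulate λ j → All.lookup h (proj₁ (∈-∖⁻ {S = inc t} {S} j))) k) (Allₚ.++⁻ʳ (fresh S t))))))
        (λ ¬a → trans (𝟙-cong (S ⊆? (U ∖ inc t)) (S ⊆? U) (All.map λ j → proj₁ (∈-∖⁻ {S = U} {inc t} j))
            λ k → All.tabulate λ {f} j → ∈-∖⁺ {S = U} {inc t} (All.lookup k j) λ i → ¬a (Any.map (λ { refl → j }) i))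
          (solve 2 (λ a b → a := a :+ con (- 1ℚ) :* (con 0ℚ :* b)) refl (χ S U) (χ (fresh S t ++ S) U)))
        where touched : S ⊆ (U ∖ inc t) → ¬ Any (_∈ S) (inc t)
              touched k a = let f , f∈t , f∈S = find a in proj₂ (∈-∖⁻ {S = U} {inc t} (All.lookup k f∈S)) f∈t

    loss : List V → T → ℚ
    loss S t = - ε * 𝟙 (touch? S t)

    L-χ : ∀ S U → L (χ S) U ≡ χ S U + (∑[ t ∈ ts ] loss S t * χ (fresh S t ++ S) U)
    L-χ S U = trans (cong (ε *_) (trans (∑-cong ts λ {t} _ → χ-pick S U t) (∑-+ ts (λ _ → χ S U) _)))
      (trans (*-distribˡ-+ ε (∑[ t ∈ ts ] χ S U) (∑[ t ∈ ts ] (- 1ℚ) * (𝟙 (touch? S t) * χ (fresh S t ++ S) U))) (cong₂ _+_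
        (trans (cong (ε *_) (∑-const ts (χ S U))) (trans (solve 3 (λ e n x → e :* (n :* x) := n :* e :* x) refl ε ⟨ length ts ⟩ (χ S U))
          (trans (cong (_* χ S U) ε-total) (*-identityˡ (χ S U)))))
        (trans (sym (∑-*ˡ ts ε _)) (∑-cong ts λ {t} _ →
          solve 3 (λ e a b → e :* (con (- 1ℚ) :* (a :* b)) := (:- e) :* a :* b) refl ε (𝟙 (touch? S t)) (χ (fresh S t ++ S) U)))))

    module _ {p : ℚ} (p>0 : 0ℚ <ℚ p) (p≤1 : p ≤ℚ 1ℚ) where

      p≥0 : p ≥0
      p≥0 = <⇒≤ p>0

      survive : ℕ → List V → ℚ
      survive r S = 𝔼 p es (K r (χ S))

      sub-Valid : ∀ {G} → G ⊑ es → Valid G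
      sub-Valid s = ⊑-Unique s es-unique , All.tabulate (Sub.lookup s)

      survive-suc : ∀ r S → survive (suc r) S ≡ survive r S + (∑[ t ∈ ts ] loss S t * survive r (fresh S t ++ S))
      survive-suc r S = trans (𝔼-cong p es λ {G} s → trans (K-cong r (λ {U} _ → L-χ S U) (sub-Valid s))
          (trans (K-+ r (χ S) _ (sub-Valid s)) (cong (K r (χ S) G +_) (K-∑ r ts (loss S) _ (sub-Valid s)))))
        (trans (𝔼-+ p es (K r (χ S)) _) (cong (survive r S +_) (trans (𝔼-∑ p es ts _) (∑-cong ts λ {t} _ → 𝔼-* p es (loss S t) _))))

      -- a r S is the probability that S survives r steps, conditioned on S being present initially.
      a : ℕ → List V → ℚ
      a zero    S = 1ℚ
      a (suc r) S = a r S + (∑[ t ∈ ts ] loss S t * (p ^ℚ length (fresh S t) * a r (fresh S t ++ S)))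

      -- Every set in the hierarchy is S enlarged by fresh vertices, so p^|S| factors out and each
      -- term keeps p to the number of fresh vertices.
      survive-a : ∀ r {S} → Valid S → survive r S ≡ p ^ℚ length S * a r S
      survive-a zero    {S} (u , s) = trans (𝔼-χ p es-unique u s) (sym (*-identityʳ _))
      survive-a (suc r) {S} v = trans (survive-suc r S) (trans (cong₂ _+_ (survive-a r v)
          (trans (∑-cong ts λ {t} i → trans (cong (loss S t *_) (trans (survive-a r (fresh-Valid v i))
              (cong (_* a r (fresh S t ++ S)) (trans (cong (p ^ℚ_) (Listₚ.length-++ (fresh S t))) (^-+ p (length (fresh S t)) (length S))))))
              (solve 4 (λ l f m x → l :* (f :* m :* x) := m :* (l :* (f :* x))) refl (loss S t) (p ^ℚ length (fresh S t)) (p ^ℚ length S) (a r (fresh S t ++ S))))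
            (∑-*ˡ ts (p ^ℚ length S) _)))
        (sym (*-distribˡ-+ (p ^ℚ length S) (a r S) _)))

      survive≥0 : ∀ r S → survive r S ≥0
      survive≥0 r S = 𝔼≥0 p≥0 p≤1 es λ {G} s → subst (_≤ℚ K r (χ S) G) (trans (K-cong r (λ _ → refl) (sub-Valid s)) (K-0 r (sub-Valid s)))
          (K-mono r (λ {U} _ → 𝟙≥0 (S ⊆? U)) (sub-Valid s))
        where K-0 : ∀ r {U} → Valid U → K r (λ _ → 0ℚ) U ≡ 0ℚ
              K-0 r v = K-∑ {⊥} r [] (λ ()) (λ ()) v

      a≥0 : ∀ r {S} → Valid S → a r S ≥0
      a≥0 r {S} v = *-cancelˡ (^>0 p>0 (length S)) (subst₂ _≤ℚ_ (sym (*-zeroʳ (p ^ℚ length S))) (survive-a r v) (survive≥0 r S))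

      -- All terms of the recursion are subtracted, so `a` does not increase with r.
      a≤1 : ∀ r {S} → Valid S → a r S ≤ℚ 1ℚ
      a≤1 zero    v = ≤-refl
      a≤1 (suc r) {S} v = ≤-trans (≤-by (∑≥0 ts λ {t} i → *≥0 (*≥0 ε≥0 (𝟙≥0 (touch? S t))) (*≥0 (^≥0 p≥0 (length (fresh S t))) (a≥0 r (fresh-Valid v i))))
          (trans (solve 2 (λ x y → x := x :+ y :+ con (- 1ℚ) :* y) refl (a r S) (∑ ts (λ t → loss S t * (p ^ℚ length (fresh S t) * a r (fresh S t ++ S)))))
            (cong (a (suc r) S +_) (trans (sym (∑-*ˡ ts (- 1ℚ) _)) (∑-cong ts λ {t} _ →
              solve 3 (λ e b x → con (- 1ℚ) :* ((:- e) :* b :* x) := e :* b :* x) refl ε (𝟙 (touch? S t)) (p ^ℚ length (fresh S t) * a r (fresh S t ++ S)))))))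
        (a≤1 r v)

      -- The mean of φ cannot increase along the process, and at the end it is at least minus the
      -- mean number of survivors. Using a potential avoids recording which hyperedges have been
      -- removed.
      greedy : ∀ r (φ : List V → ℚ) → (∀ {U} → Valid U → - ⟨ length U ⟩ ≤ℚ φ U) →
               (∀ {U t} → Valid U → t ∈ ts → inc t ⊆ U → φ (U ∖ inc t) ≤ℚ φ U) →
               - (∑[ e ∈ es ] p * a r [ e ]) ≤ℚ 𝔼 p es φ
      greedy r φ low dec = subst (_≤ℚ 𝔼 p es φ)
          (trans (𝔼-∑ p es es _) (trans (∑-cong es λ {e} i → trans (𝔼-* p es (- 1ℚ) _) (cong (- 1ℚ *_)
              (trans (survive-a r (([] ∷ []) , (i ∷ []))) (cong (_* a r [ e ]) (*-identityʳ p)))))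
            (trans (∑-*ˡ es (- 1ℚ) _) (solve 1 (λ x → con (- 1ℚ) :* x := :- x) refl (∑[ e ∈ es ] p * a r [ e ])))))
          (𝔼-mono p≥0 p≤1 es λ {G} s → ≤-trans (subst (_≤ℚ K r φ G) (K-∑ r es (λ _ → - 1ℚ) (λ e → χ [ e ]) (sub-Valid s))
              (K-mono r (λ {U} v → subst (_≤ℚ φ U) (len v) (low v)) (sub-Valid s)))
            (down r (sub-Valid s)))
        where
        len : ∀ {U} → Valid U → - ⟨ length U ⟩ ≡ ∑[ e ∈ es ] (- 1ℚ) * χ [ e ] U
        len {U} (u , s) = trans (cong -_ (trans (sym (trans (∑-const U 1ℚ) (*-identityʳ _)))
            (trans (∑-cong U λ {e} i → sym (𝟙-yes (e ∈? es) (All.lookup s i))) (trans (∑-∈-comm u es-unique)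
              (∑-cong es λ {e} _ → 𝟙-cong (e ∈? U) ([ e ] ⊆? U) (λ i → i ∷ []) All.head)))))
          (trans (solve 1 (λ x → :- x := con (- 1ℚ) :* x) refl (∑[ e ∈ es ] χ [ e ] U)) (sym (∑-*ˡ es (- 1ℚ) _)))
        Lφ≤φ : ∀ {U} → Valid U → L φ U ≤ℚ φ U
        Lφ≤φ {U} v = subst (L φ U ≤ℚ_) (trans (cong (ε *_) (∑-const ts (φ U))) (trans (solve 3 (λ e n x → e :* (n :* x) := n :* e :* x) refl ε ⟨ length ts ⟩ (φ U))
            (trans (cong (_* φ U) ε-total) (*-identityˡ _))))
          (*-monoˡ ε≥0 (∑-mono ts λ {t} i → pick-cases t U (λ W → φ W ≤ℚ φ U) (dec v i) (λ _ → ≤-refl)))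
        down : ∀ r {U} → Valid U → K r φ U ≤ℚ φ U
        down zero    v = ≤-refl
        down (suc r) v = ≤-trans (K-mono r Lφ≤φ v) (down r v)

      -- Approximation of the survival probabilities by the trajectory

      module Trajectory (ε≤1 : ε ≤ℚ 1ℚ) (ε≤p : ε ≤ℚ p) {Δ : ℚ} (d≤Δ : D * (p * p) ≤ℚ Δ) (εΔ≤1 : ε * Δ ≤ℚ 1ℚ) where

        d = D * (p * p)

        d≥0 : d ≥0
        d≥0 = *≥0 D≥0 (*≥0 p≥0 p≥0)

        Δ≥0 : Δ ≥0
        Δ≥0 = ≤-trans d≥0 d≤Δ

        -- Heuristically a r S ≈ x r ^ |S| · y r ^ θ S.
        x y z : ℕ → ℚ
        y zero    = 1ℚ
        y (suc r) = y r * (1ℚ - ε)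
        x zero    = 1ℚ
        x (suc r) = x r * (1ℚ - z r)
        z r = ε * (d * (y r * (x r * x r)))

        y≥0 : ∀ r → y r ≥0
        y≥0 zero    = 0≤1
        y≥0 (suc r) = *≥0 (y≥0 r) (diff≥0 ε≤1)

        1-≤1 : ∀ {e} → e ≥0 → 1ℚ - e ≤ℚ 1ℚ
        1-≤1 {e} e0 = ≤-by e0 (solve 1 (λ e → con 1ℚ := con 1ℚ :- e :+ e) refl e)

        y≤1 : ∀ r → y r ≤ℚ 1ℚ
        y≤1 zero    = ≤-refl
        y≤1 (suc r) = *-mono {d = 1ℚ} (y≥0 r) (diff≥0 ε≤1) (y≤1 r) (1-≤1 ε≥0)

        x≥0 : ∀ r → x r ≥0
        x≤1 : ∀ r → x r ≤ℚ 1ℚ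
        z≥0 : ∀ r → z r ≥0
        z≤ε : ∀ r → z r ≤ℚ ε * Δ
        z≤1 : ∀ r → z r ≤ℚ 1ℚ
        x≥0 zero    = 0≤1
        x≥0 (suc r) = *≥0 (x≥0 r) (diff≥0 (z≤1 r))
        x≤1 zero    = ≤-refl
        x≤1 (suc r) = *-mono {d = 1ℚ} (x≥0 r) (diff≥0 (z≤1 r)) (x≤1 r) (1-≤1 (z≥0 r))
        z≥0 r = *≥0 ε≥0 (*≥0 d≥0 (*≥0 (y≥0 r) (*≥0 (x≥0 r) (x≥0 r))))
        z≤ε r = *-monoˡ ε≥0 (subst (d * (y r * (x r * x r)) ≤ℚ_) (*-identityʳ Δ)
          (*-mono {d = 1ℚ} d≥0 (*≥0 (y≥0 r) (*≥0 (x≥0 r) (x≥0 r))) d≤Δ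
            (*-mono {b = 1ℚ} {d = 1ℚ} (y≥0 r) (*≥0 (x≥0 r) (x≥0 r)) (y≤1 r) (*-mono {b = 1ℚ} {d = 1ℚ} (x≥0 r) (x≥0 r) (x≤1 r) (x≤1 r)))))
        z≤1 r = ≤-trans (z≤ε r) εΔ≤1

        -- Discrete version of d(x⁻²) = 2 d dy for the equation x' = - d y x³.
        x-bound : ∀ r → x r * x r * (1ℚ + 2ℚ * (d * (1ℚ - y r))) ≤ℚ 1ℚ
        x-bound zero    = ≤-reflexive (solve 1 (λ d → con 1ℚ :* con 1ℚ :* (con 1ℚ :+ con 2ℚ :* (d :* (con 1ℚ :- con 1ℚ))) := con 1ℚ) refl d)
        x-bound (suc r) = ≤-trans
          (≤-by (*≥0 (*≥0 (diff≥0 (z≤1 r)) (diff≥0 (z≤1 r))) (diff≥0 (x-bound r)))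
            (solve 4 (λ x y e d → let z = e :* (d :* (y :* (x :* x))) in
              (con 1ℚ :- z) :* (con 1ℚ :- z) :* (con 1ℚ :+ con 2ℚ :* z) :=
              x :* (con 1ℚ :- z) :* (x :* (con 1ℚ :- z)) :* (con 1ℚ :+ con 2ℚ :* (d :* (con 1ℚ :- y :* (con 1ℚ :- e)))) :+
              (con 1ℚ :- z) :* (con 1ℚ :- z) :* (con 1ℚ :- x :* x :* (con 1ℚ :+ con 2ℚ :* (d :* (con 1ℚ :- y))))) refl (x r) (y r) ε d))
          (≤-by (*≥0 (*≥0 (z≥0 r) (z≥0 r)) (+≥0 0≤1 (*≥0 (+≥0 0≤1 0≤1) (diff≥0 (z≤1 r)))))
            (solve 1 (λ z → con 1ℚ := (con 1ℚ :- z) :* (con 1ℚ :- z) :* (con 1ℚ :+ con 2ℚ :* z) :+ z :* z :* (con 1ℚ :+ con 2ℚ :* (con 1ℚ :- z))) refl (z r)))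

        y-pow : ∀ r → y r ≡ (1ℚ - ε) ^ℚ r
        y-pow zero    = refl
        y-pow (suc r) = trans (cong (_* (1ℚ - ε)) (y-pow r)) (*-comm _ (1ℚ - ε))

        I : ℕ → ℕ → ℕ → ℚ
        I r m k = x r ^ℚ m * y r ^ℚ k

        I≥0 : ∀ r m k → I r m k ≥0
        I≥0 r m k = *≥0 (^≥0 (x≥0 r) m) (^≥0 (y≥0 r) k)

        I≤1 : ∀ r m k → I r m k ≤ℚ 1ℚ
        I≤1 r m k = *-mono {d = 1ℚ} (^≥0 (x≥0 r) m) (^≥0 (y≥0 r) k) (^≤1 (x≥0 r) (x≤1 r) m) (^≤1 (y≥0 r) (y≤1 r) k)

        -- A weight exponential in |S| lets the bound for two more elements be expressed through the
        -- one for S, at the cost of a factor λ'².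
        Close : ℕ → ℚ → ℚ → Set
        Close r δ λ' = ∀ {S} → Valid S → ℚ.∣ a r S - I r (length S) (θ S) ∣ ≤ℚ δ * λ' ^ℚ length S

        -- The 2 pays for hyperedges meeting S more than once and for clashes, the square for the
        -- second-order terms of `product-expansion`.
        C : ℚ
        C = 2ℚ + (1ℚ + Δ) * (1ℚ + Δ)

        module Step {r δ λ'} (δ≥0 : δ ≥0) (λ≥16 : 16ℚ ≤ℚ λ') (close : Close r δ λ') {S} (v : Valid S) where

          m = length S
          M = ⟨ m ⟩
          k = θ S
          Θ = ⟨ k ⟩
          pp = p * p
          J = I r (2 ℕ.+ m) (suc k)
          B = δ * λ' ^ℚ (2 ℕ.+ m)

          λ≥0 : λ' ≥0
          λ≥0 = ≤-trans (nonNegative⁻¹ 16ℚ) λ≥16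

          pp≥0 = *≥0 p≥0 p≥0
          pp≤p : pp ≤ℚ p
          pp≤p = subst (pp ≤ℚ_) (*-identityʳ p) (*-monoˡ p≥0 p≤1)
          J≥0 = I≥0 r (2 ℕ.+ m) (suc k)
          J≤1 = I≤1 r (2 ℕ.+ m) (suc k)
          B≥0 = *≥0 δ≥0 (^≥0 λ≥0 (2 ℕ.+ m))

          -- `target` treats t as if it met S in single vertices, counted by `meet S t`, because the
          -- sum of `meet` over all hyperedges is exactly |S| D. Hyperedges inside S keep their
          -- exact term; meets of size at least two and clashes are charged to `error`.
          term target error : T → ℚ
          term t = 𝟙 (touch? S t) * (p ^ℚ length (fresh S t) * a r (fresh S t ++ S))
          target t = 𝟙 (inc t ⊆? S) * a r S + meet S t * (pp * J)
          error t = p * (meet S t * meet S t - meet S t + clashes S t) + meet S t * (pp * B)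

          inside-fresh : ∀ {t} → inc t ⊆ S → length (fresh S t) ≡ 0
          inside-fresh {t} h = cong length (Listₚ.filter-none (λ x → ¬? (x ∈? S)) (All.map (λ j k → k j) h))

          ¬touch : ∀ {t} → ¬ Any (_∈ S) (inc t) → length (fresh S t) ≡ 3
          ¬touch {t} h = trans (cong length (Listₚ.filter-all (λ x → ¬? (x ∈? S)) (Allₚ.¬Any⇒All¬ (inc t) h))) (inc-length t)

          touches : ∀ {t} → length (fresh S t) ≢ 3 → 𝟙 (touch? S t) ≡ 1ℚ
          touches {t} h = 𝟙-elim (_≡ 1ℚ) (touch? S t) (λ _ → refl) (λ ¬a → contradiction (¬touch ¬a) h)

          not-inside : ∀ {t} → length (fresh S t) ≢ 0 → 𝟙 (inc t ⊆? S) ≡ 0ℚ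
          not-inside {t} h = 𝟙-no (inc t ⊆? S) (h ∘ inside-fresh)

          module _ {t} (i : t ∈ ts) where

            a′ : ℚ
            a′ = a r (fresh S t ++ S)

            v′ : Valid (fresh S t ++ S)
            v′ = fresh-Valid v i

            Bound : Set
            Bound = ℚ.∣ term t - target t ∣ ≤ℚ error t

            via : ∀ {l b c} → length (fresh S t) ≡ l → 𝟙 (touch? S t) ≡ b → 𝟙 (inc t ⊆? S) ≡ c →
                  ∀ {u w} → b * (p ^ℚ l * a′) - (c * a r S + (3ℚ - ⟨ l ⟩) * (pp * J)) ≡ u →
                  w ≡ p * ((3ℚ - ⟨ l ⟩) * (3ℚ - ⟨ l ⟩) - (3ℚ - ⟨ l ⟩) + clashes S t) + (3ℚ - ⟨ l ⟩) * (pp * B) →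
                  ℚ.∣ u ∣ ≤ℚ w → Bound
            via refl refl refl refl refl h = subst (λ e → ℚ.∣ 𝟙 (touch? S t) * (p ^ℚ length (fresh S t) * a′) - (𝟙 (inc t ⊆? S) * a r S + e * (pp * J)) ∣
                ≤ℚ p * (e * e - e + clashes S t) + e * (pp * B)) (sym (meet-fresh (proj₁ v) i)) h

            fresh-3 : length (fresh S t) ≡ 3 → Bound
            fresh-3 eq = via eq
                (𝟙-no (touch? S t) λ b → ℕₚ.<-irrefl (trans eq (sym (inc-length t)))
                    (Listₚ.filter-notAll (λ x → ¬? (x ∈? S)) (inc t) (Any.map (λ j k → k j) b)))
                (not-inside {t} λ h → case trans (sym eq) h of λ ())
                (solve 3 (λ a b c → con 0ℚ :* a :- (con 0ℚ :* b :+ con 0ℚ :* c) := con 0ℚ) refl (p ^ℚ 3 * a′) (a r S) (pp * J))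
                refl (≤-by (*≥0 p≥0 (clashes≥0 S t))
                  (solve 3 (λ p c b → p :* (con 0ℚ :+ c) :+ con 0ℚ :* b := con 0ℚ :+ p :* c) refl p (clashes S t) (pp * B)))

            fresh-2 : length (fresh S t) ≡ 2 → Bound
            fresh-2 eq = via eq (touches {t} λ h → case trans (sym eq) h of λ ()) (not-inside {t} λ h → case trans (sym eq) h of λ ())
                (solve 4 (λ p a b c → con 1ℚ :* (p :* (p :* con 1ℚ) :* a) :- (con 0ℚ :* b :+ con 1ℚ :* (p :* p :* c)) := p :* p :* (a :- c)) refl p a′ (a r S) J)
                (solve 3 (λ p c b → p :* c :+ p :* p :* b := p :* (con 1ℚ :* con 1ℚ :- con 1ℚ :+ c) :+ con 1ℚ :* (p :* p :* b)) refl p (clashes S t) B)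
                (split (Any.any? (clash? S t) ts))
              where
              len : length (fresh S t ++ S) ≡ 2 ℕ.+ m
              len = trans (Listₚ.length-++ (fresh S t)) (cong (ℕ._+ m) eq)
              -- After a clash θ of the enlarged set is not known, and only the fact that `a` and
              -- `I` lie between 0 and 1 is used; `clashes` is at least 1 and pays for it.
              split : Dec (Any (Clash S t) ts) → ℚ.∣ pp * (a′ - J) ∣ ≤ℚ p * clashes S t + pp * B
              split (yes c) = ≤-trans (∣∣-scale pp≥0 (∣∣-unit (a≥0 r v′) (a≤1 r v′) J≥0 J≤1))
                (≤-by (+≥0 (+≥0 (diff≥0 pp≤p) (*≥0 p≥0 (diff≥0 (clashes≥1 (trans (meet-fresh (proj₁ v) i) (cong (λ l → 3ℚ - ⟨ l ⟩) eq)) c)))) (*≥0 pp≥0 B≥0))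
                  (solve 3 (λ p c b → p :* c :+ p :* p :* b := p :* p :* con 1ℚ :+ (p :- p :* p :+ p :* (c :- con 1ℚ) :+ p :* p :* b)) refl p (clashes S t) B))
              split (no ¬c) = ≤-trans (∣∣-scale pp≥0 (subst (λ w → ℚ.∣ a′ - w ∣ ≤ℚ B)
                  (cong₂ (I r) len (θ-fresh v i eq ¬c)) (subst (λ l → ℚ.∣ a′ - I r (length (fresh S t ++ S)) (θ (fresh S t ++ S)) ∣ ≤ℚ δ * λ' ^ℚ l) len (close v′))))
                (≤-by (*≥0 p≥0 (clashes≥0 S t)) (+-comm (p * clashes S t) (pp * B)))

            fresh-1 : length (fresh S t) ≡ 1 → Bound
            fresh-1 eq = via eq (touches {t} λ h → case trans (sym eq) h of λ ()) (not-inside {t} λ h → case trans (sym eq) h of λ ())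
                (solve 4 (λ p a b c → con 1ℚ :* (p :* con 1ℚ :* a) :- (con 0ℚ :* b :+ con 2ℚ :* (p :* p :* c)) := p :* a :- con 2ℚ :* (p :* p :* c)) refl p a′ (a r S) J)
                (solve 3 (λ p c b → con 2ℚ :* p :+ (p :* c :+ con 2ℚ :* (p :* p :* b)) := p :* (con 2ℚ :* con 2ℚ :- con 2ℚ :+ c) :+ con 2ℚ :* (p :* p :* b)) refl p (clashes S t) B)
                (≤-trans (∣∣-unit (*≥0 p≥0 (a≥0 r v′))
                    (≤-by (+≥0 p≥0 (*≥0 p≥0 (diff≥0 (a≤1 r v′)))) (solve 2 (λ p a → con 2ℚ :* p := p :* a :+ (p :+ p :* (con 1ℚ :- a))) refl p a′))
                    (*≥0 (+≥0 0≤1 0≤1) (*≥0 pp≥0 J≥0))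
                    (*-monoˡ (+≥0 0≤1 0≤1) (≤-trans (subst (pp * J ≤ℚ_) (*-identityʳ pp) (*-monoˡ pp≥0 J≤1)) pp≤p)))
                  (≤-by (+≥0 (*≥0 p≥0 (clashes≥0 S t)) (*≥0 (+≥0 0≤1 0≤1) (*≥0 pp≥0 B≥0))) refl))

            fresh-0 : fresh S t ≡ [] → Bound
            fresh-0 empty = via (cong length empty) (touches {t} λ h → case trans (sym (cong length empty)) h of λ ())
                (𝟙-yes (inc t ⊆? S) (subst (λ W → inc t ⊆ (W ++ S)) empty (inc-⊆-fresh S t)))
                (trans (cong (λ W → 1ℚ * (1ℚ * a r (W ++ S)) - (1ℚ * a r S + 3ℚ * (pp * J))) empty)
                  (solve 3 (λ p b c → con 1ℚ :* (con 1ℚ :* b) :- (con 1ℚ :* b :+ con 3ℚ :* (p :* p :* c)) := con 0ℚ :- con 3ℚ :* (p :* p :* c)) refl p (a r S) J))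
                (solve 3 (λ p c b → con 3ℚ :* p :+ (con 3ℚ :* p :+ p :* c :+ con 3ℚ :* (p :* p :* b)) := p :* (con 3ℚ :* con 3ℚ :- con 3ℚ :+ c) :+ con 3ℚ :* (p :* p :* b)) refl p (clashes S t) B)
                (≤-trans (∣∣-unit {0ℚ} ≤-refl (*≥0 3≥0 p≥0) (*≥0 3≥0 (*≥0 pp≥0 J≥0))
                    (*-monoˡ 3≥0 (≤-trans (subst (pp * J ≤ℚ_) (*-identityʳ pp) (*-monoˡ pp≥0 J≤1)) pp≤p)))
                  (≤-by (+≥0 (+≥0 (*≥0 3≥0 p≥0) (*≥0 p≥0 (clashes≥0 S t))) (*≥0 3≥0 (*≥0 pp≥0 B≥0))) refl))
              where
              3≥0 : 3ℚ ≥0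
              3≥0 = nonNegative⁻¹ 3ℚ

            pointwise : Bound
            pointwise = go (fresh S t) refl (fresh≤3 S t)
              where
              go : ∀ F → fresh S t ≡ F → length (fresh S t) ≤ 3 → Bound
              go []              eq _ = fresh-0 eq
              go (_ ∷ [])        eq _ = fresh-1 (cong length eq)
              go (_ ∷ _ ∷ [])    eq _ = fresh-2 (cong length eq)
              go (_ ∷ _ ∷ _ ∷ []) eq _ = fresh-3 (cong length eq)
              go (_ ∷ _ ∷ _ ∷ _ ∷ _) eq q with subst (λ F → length F ≤ 3) eq q
              ... | s≤s (s≤s (s≤s ()))

          ∑target : ∑ ts target ≡ Θ * a r S + M * (d * J)
          ∑target = trans (∑-+ ts _ _) (cong₂ _+_
            (trans (∑-*ʳ ts (a r S) _) (cong (_* a r S) (sym (length-filter (λ t → inc t ⊆? S) ts))))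
            (trans (∑-*ʳ ts (pp * J) _) (trans (cong (_* (pp * J)) (∑-meet (proj₂ v)))
              (solve 4 (λ M D p J → M :* D :* (p :* J) := M :* (D :* p :* J)) refl M D pp J))))

          ∑error : ∑ ts error ≤ℚ p * (M * M + M * (M * M)) + M * (d * B)
          ∑error = subst (_≤ℚ p * (M * M + M * (M * M)) + M * (d * B)) (sym (trans (∑-+ ts _ _) (cong₂ _+_
              (trans (∑-*ˡ ts p _) (cong (p *_) (∑-+ ts _ _)))
              (trans (∑-*ʳ ts (pp * B) _) (trans (cong (_* (pp * B)) (∑-meet (proj₂ v)))
                (solve 4 (λ M D p J → M :* D :* (p :* J) := M :* (D :* p :* J)) refl M D pp B))))))
            (+-monoˡ-≤ (M * (d * B)) (*-monoˡ p≥0 (+-mono-≤ (∑-pairs-meet v) (∑-clashes v))))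

          E₁ : ℚ.∣ ∑ ts term - (Θ * a r S + M * (d * J)) ∣ ≤ℚ p * (M * M + M * (M * M)) + M * (d * B)
          E₁ = ≤-trans (subst (λ w → ℚ.∣ w ∣ ≤ℚ ∑ ts error)
              (trans (∑-cong ts λ {t} _ → solve 2 (λ a b → a :- b := a :+ con (- 1ℚ) :* b) refl (term t) (target t))
                (trans (∑-+ ts term _) (trans (cong (∑ ts term +_) (trans (∑-*ˡ ts (- 1ℚ) target) (cong (- 1ℚ *_) ∑target)))
                  (solve 2 (λ a b → a :+ con (- 1ℚ) :* b := a :- b) refl (∑ ts term) (Θ * a r S + M * (d * J))))))
              (∣∣-∑ ts pointwise)) ∑error

          s = M * z r + Θ * ε

          E₂ : ℚ.∣ I r m k * ((1ℚ - s) - (1ℚ - z r) ^ℚ m * (1ℚ - ε) ^ℚ k) ∣ ≤ℚ s * s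
          E₂ = ≤-trans (∣∣-scale (I≥0 r m k) (product-expansion (z≥0 r) (z≤1 r) ε≥0 ε≤1 m k))
            (subst (I r m k * (s * s) ≤ℚ_) (*-identityˡ (s * s)) (*-monoʳ (sq≥0 s) (I≤1 r m k)))

          Θε≤1 : Θ * ε ≤ℚ 1ℚ
          Θε≤1 = subst (Θ * ε ≤ℚ_) ε-total (*-monoʳ ε≥0 (⟨⟩-mono (θ≤ts S)))

          a-suc : a (suc r) S ≡ a r S - ε * ∑ ts term
          a-suc = cong (a r S +_) (trans (∑-cong ts λ {t} _ → solve 3 (λ e b x → (:- e) :* b :* x := (:- e) :* (b :* x)) refl ε (𝟙 (touch? S t)) (p ^ℚ length (fresh S t) * a r (fresh S t ++ S)))
            (trans (∑-*ˡ ts (- ε) term) (solve 2 (λ e x → (:- e) :* x := :- (e :* x)) refl ε (∑ ts term))))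

          I-suc : I (suc r) m k ≡ I r m k * ((1ℚ - z r) ^ℚ m * (1ℚ - ε) ^ℚ k)
          I-suc = trans (cong₂ _*_ (*-^ (x r) (1ℚ - z r) m) (*-^ (y r) (1ℚ - ε) k))
            (solve 4 (λ a b c e → a :* b :* (c :* e) := a :* c :* (b :* e)) refl (x r ^ℚ m) ((1ℚ - z r) ^ℚ m) (y r ^ℚ k) ((1ℚ - ε) ^ℚ k))

          -- The old error times 1 - Θ ε, the pointwise errors in the sum over hyperedges, and the
          -- second-order error with which `I` solves the linearised recursion.
          decomposition : a (suc r) S - I (suc r) m k ≡
            (1ℚ - Θ * ε) * (a r S - I r m k) + (- (ε * (∑ ts term - (Θ * a r S + M * (d * J))))
              + I r m k * ((1ℚ - s) - (1ℚ - z r) ^ℚ m * (1ℚ - ε) ^ℚ k))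
          decomposition = trans (cong₂ _-_ a-suc I-suc)
            (solve 11 (λ a e σ Θ M d xm yk w x y →
               a :- e :* σ :- xm :* yk :* w :=
               (con 1ℚ :- Θ :* e) :* (a :- xm :* yk) :+ (:- (e :* (σ :- (Θ :* a :+ M :* (d :* (x :* (x :* xm) :* (y :* yk))))))
                 :+ xm :* yk :* ((con 1ℚ :- (M :* (e :* (d :* (y :* (x :* x)))) :+ Θ :* e)) :- w))) refl
              (a r S) ε (∑ ts term) Θ M d (x r ^ℚ m) (y r ^ℚ k) ((1ℚ - z r) ^ℚ m * (1ℚ - ε) ^ℚ k) (x r) (y r))

          Λ = λ' ^ℚ m
          Λ≥0 = ^≥0 λ≥0 m
          M≥0 = ⟨⟩≥0 m
          M⁴ = M ^ℚ 4
          M² = M * M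
          growth = 1ℚ + ε * (Δ * (λ' * λ'))

          M≤M² : M ≤ℚ M²
          M≤M² = n≤n² m
          M²≤M⁴ : M² ≤ℚ M⁴
          M²≤M⁴ = subst (M² ≤ℚ_) (solve 1 (λ m → m :* m :* (m :* m) := m :^ 4) refl M) (*-mono M≥0 M≥0 M≤M² M≤M²)
          M³≤M⁴ : M * M² ≤ℚ M⁴
          M³≤M⁴ = subst (M * M² ≤ℚ_) (solve 1 (λ m → m :* m :* (m :* m) := m :^ 4) refl M) (*-monoʳ (*≥0 M≥0 M≥0) M≤M²)
          M⁴≥0 = ^≥0 M≥0 4
          M⁴≤Λ : M⁴ ≤ℚ Λ
          M⁴≤Λ = ≤-trans (n⁴≤16^n m) (^-mono (nonNegative⁻¹ 16ℚ) λ≥16 m)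

          s≤ : s ≤ℚ ε * ((1ℚ + Δ) * M²)
          s≤ = ≤-trans (+-mono-≤ (*-mono M≥0 (z≥0 r) M≤M² (z≤ε r)) (*-monoʳ ε≥0 (θ≤ v)))
            (≤-reflexive (solve 3 (λ m e D → m :* (e :* D) :+ m :* e := e :* ((con 1ℚ :+ D) :* m)) refl M² ε Δ))

          s²≤ : s * s ≤ℚ ε * (p * ((1ℚ + Δ) * (1ℚ + Δ) * M⁴))
          s²≤ = ≤-trans (*-mono s≥0 s≥0 s≤ s≤) (subst₂ _≤ℚ_
              (solve 3 (λ m e D → e :* (e :* ((con 1ℚ :+ D) :* (con 1ℚ :+ D) :* (m :^ 4))) := e :* ((con 1ℚ :+ D) :* (m :* m)) :* (e :* ((con 1ℚ :+ D) :* (m :* m)))) refl M ε Δ) refl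
              (*-monoˡ ε≥0 (*-monoʳ (*≥0 (*≥0 (+≥0 0≤1 Δ≥0) (+≥0 0≤1 Δ≥0)) M⁴≥0) ε≤p)))
            where s≥0 = +≥0 (*≥0 M≥0 (z≥0 r)) (*≥0 (⟨⟩≥0 k) ε≥0)

          -- The coupling term M Δ δ λ'^(m+2) is absorbed by enlarging the base: by Bernoulli, 1 + M
          -- ε Δ λ'² is at most `growth` to the power m.
          conclusion : ℚ.∣ a (suc r) S - I (suc r) m k ∣ ≤ℚ (δ + ε * (p * C)) * (λ' * growth) ^ℚ m
          conclusion = ≤-trans (subst (λ w → ℚ.∣ w ∣ ≤ℚ (1ℚ - Θ * ε) * (δ * Λ) + (ε * (p * (M² + M * M²) + M * (d * B)) + s * s)) (sym decomposition)
              (≤-trans (ℚₚ.∣p+q∣≤∣p∣+∣q∣ P₁ (P₂ + P₃)) (+-mono-≤ (∣∣-scale (diff≥0 Θε≤1) (close v))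
                (≤-trans (ℚₚ.∣p+q∣≤∣p∣+∣q∣ P₂ P₃) (+-mono-≤ (subst (_≤ℚ ε * (p * (M² + M * M²) + M * (d * B))) (sym (ℚₚ.∣-p∣≡∣p∣ (ε * X))) (∣∣-scale ε≥0 E₁)) E₂)))))
            (≤-trans bound₁ (≤-trans bound₂ bound₃))
            where
            X = ∑ ts term - (Θ * a r S + M * (d * J))
            P₁ = (1ℚ - Θ * ε) * (a r S - I r m k)
            P₂ = - (ε * X)
            P₃ = I r m k * ((1ℚ - s) - (1ℚ - z r) ^ℚ m * (1ℚ - ε) ^ℚ k)
            K₂ = (1ℚ + Δ) * (1ℚ + Δ)
            bound₁ : (1ℚ - Θ * ε) * (δ * Λ) + (ε * (p * (M² + M * M²) + M * (d * B)) + s * s)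
                     ≤ℚ δ * Λ + (ε * (p * (M⁴ + M⁴) + M * (Δ * B)) + ε * (p * (K₂ * M⁴)))
            bound₁ = +-mono-≤
              (≤-by {x = (1ℚ - Θ * ε) * (δ * Λ)} (*≥0 (*≥0 (⟨⟩≥0 k) ε≥0) (*≥0 δ≥0 Λ≥0)) (solve 2 (λ t w → w := (con 1ℚ :- t) :* w :+ t :* w) refl (Θ * ε) (δ * Λ)))
              (+-mono-≤ (*-monoˡ ε≥0 (+-mono-≤ (*-monoˡ p≥0 (+-mono-≤ M²≤M⁴ M³≤M⁴)) (*-monoˡ M≥0 (*-monoʳ B≥0 d≤Δ)))) s²≤)
            bound₂ : δ * Λ + (ε * (p * (M⁴ + M⁴) + M * (Δ * B)) + ε * (p * (K₂ * M⁴))) ≤ℚ (δ + ε * (p * C)) * (Λ * (1ℚ + M * (ε * (Δ * (λ' * λ')))))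
            bound₂ = ≤-by (+≥0 (*≥0 εpC≥0 (diff≥0 M⁴≤Λ)) (*≥0 εpC≥0 (*≥0 Λ≥0 (*≥0 M≥0 (*≥0 ε≥0 (*≥0 Δ≥0 (*≥0 λ≥0 λ≥0)))))))
              (solve 9 (λ δ Λ e p q M D K l → (δ :+ e :* (p :* (con 2ℚ :+ K))) :* (Λ :* (con 1ℚ :+ M :* (e :* (D :* (l :* l))))) :=
                 δ :* Λ :+ (e :* (p :* (q :+ q) :+ M :* (D :* (δ :* (l :* (l :* Λ))))) :+ e :* (p :* (K :* q))) :+
                 (e :* (p :* (con 2ℚ :+ K)) :* (Λ :- q) :+ e :* (p :* (con 2ℚ :+ K)) :* (Λ :* (M :* (e :* (D :* (l :* l)))))))
                refl δ Λ ε p M⁴ M Δ K₂ λ')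
              where εpC≥0 : ε * (p * C) ≥0
                    εpC≥0 = *≥0 ε≥0 (*≥0 p≥0 (+≥0 (+≥0 0≤1 0≤1) (sq≥0 (1ℚ + Δ))))
            bound₃ : (δ + ε * (p * C)) * (Λ * (1ℚ + M * (ε * (Δ * (λ' * λ'))))) ≤ℚ (δ + ε * (p * C)) * (λ' * growth) ^ℚ m
            bound₃ = *-monoˡ (+≥0 δ≥0 (*≥0 ε≥0 (*≥0 p≥0 (+≥0 (+≥0 0≤1 0≤1) (sq≥0 (1ℚ + Δ))))))
              (subst (Λ * (1ℚ + M * (ε * (Δ * (λ' * λ')))) ≤ℚ_) (sym (*-^ λ' growth m))
                (*-monoˡ Λ≥0 (bernoulli⁺ (*≥0 ε≥0 (*≥0 Δ≥0 (*≥0 λ≥0 λ≥0))) m)))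

        Close-mono : ∀ {r δ δ′ l l′} → δ ≥0 → l ≥0 → δ ≤ℚ δ′ → l ≤ℚ l′ → Close r δ l → Close r δ′ l′
        Close-mono δ0 l0 δ≤ l≤ c {S} v = ≤-trans (c v) (*-mono δ0 (^≥0 l0 (length S)) δ≤ (^-mono l0 l≤ (length S)))

        C≥0 : C ≥0
        C≥0 = +≥0 (+≥0 0≤1 0≤1) (sq≥0 (1ℚ + Δ))

        -- The growth rate Δ λ² of the base at its ceiling λ = 256.
        W = Δ * (256ℚ * 256ℚ)

        16≥0 : 16ℚ ≥0
        16≥0 = nonNegative⁻¹ 16ℚ

        g : ℚ
        g = 1ℚ + ε * W

        W≥0 : W ≥0
        W≥0 = *≥0 Δ≥0 (nonNegative⁻¹ (256ℚ * 256ℚ))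

        1≤g^ : ∀ k → 1ℚ ≤ℚ g ^ℚ k
        1≤g^ k = ≤-trans (≤-by (*≥0 (⟨⟩≥0 k) (*≥0 ε≥0 W≥0)) refl) (bernoulli⁺ (*≥0 ε≥0 W≥0) k)

        16≤ : ∀ k → 16ℚ ≤ℚ 16ℚ * g ^ℚ k
        16≤ k = *-monoˡ {16ℚ} {1ℚ} 16≥0 (1≤g^ k)

        -- As long as the base stays below 256, a step multiplies it by at most `g` and adds ε p C
        -- to the error.
        block : ∀ {r δ} → δ ≥0 → Close r δ 16ℚ → ∀ {l} → (∀ k → k ≤ l → 16ℚ * g ^ℚ k ≤ℚ 256ℚ) →
                Close (l ℕ.+ r) (δ + ⟨ l ⟩ * (ε * (p * C))) (16ℚ * g ^ℚ l)
        block {r} {δ} δ0 c {zero} h v = Close-mono {r} δ0 16≥0 (≤-by ≤-refl (solve 2 (λ d e → d :+ con 0ℚ :* e := d :+ con 0ℚ) refl δ (ε * (p * C)))) (16≤ 0) c v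
        block {r} {δ} δ0 c {suc l} h v = Close-mono {suc (l ℕ.+ r)} (+≥0 δl≥0 (*≥0 ε≥0 (*≥0 p≥0 C≥0))) (*≥0 l≥0 (+≥0 0≤1 (*≥0 ε≥0 (*≥0 Δ≥0 (sq≥0 λl)))))
            (≤-reflexive (solve 3 (λ d n e → d :+ n :* e :+ e := d :+ (con 1ℚ :+ n) :* e) refl δ ⟨ l ⟩ (ε * (p * C))))
            (subst (λl * (1ℚ + ε * (Δ * (λl * λl))) ≤ℚ_) (solve 3 (λ s g x → s :* x :* g := s :* (g :* x)) refl 16ℚ g (g ^ℚ l))
              (*-monoˡ l≥0 (+-monoʳ-≤ 1ℚ (*-monoˡ ε≥0 (*-monoˡ Δ≥0 (*-mono l≥0 l≥0 (h l (ℕₚ.n≤1+n l)) (h l (ℕₚ.n≤1+n l))))))))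
            (λ v → Step.conclusion {l ℕ.+ r} δl≥0 (16≤ l) (λ v → block {r} δ0 c {l} (λ k q → h k (ℕₚ.m≤n⇒m≤1+n q)) v) v) v
          where
          λl = 16ℚ * g ^ℚ l
          l≥0 : λl ≥0
          l≥0 = ≤-trans 16≥0 (16≤ l)
          δl≥0 : δ + ⟨ l ⟩ * (ε * (p * C)) ≥0
          δl≥0 = +≥0 δ0 (*≥0 (⟨⟩≥0 l) (*≥0 ε≥0 (*≥0 p≥0 C≥0)))

        -- Both a and its approximation lie in [0,1]; taking square roots resets the base 256 to 16.
        blocks : ∀ {l} → ⟨ l ⟩ * ε ≤ℚ 1ℚ → ⟨ l ⟩ * (ε * W) ≤ℚ ½ → ∀ i {η} → η ≥0 → Small C i η p → Close (i ℕ.* l) η 16ℚ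
        blocks {l} lε lW zero {η} η0 _ {S} v = subst (λ w → ℚ.∣ w ∣ ≤ℚ η * 16ℚ ^ℚ length S)
          (sym (trans (cong (λ w → 1ℚ - w) (trans (cong₂ _*_ (1^ (length S)) (1^ (θ S))) refl)) refl)) (*≥0 η0 (^≥0 16≥0 (length S)))
        blocks {l} lε lW (suc i) {η} η0 (sm , pC) {S} v = ≤-sq⇒≤ (*≥0 η0 (^≥0 16≥0 (length S)))
            (∣∣-unit (a≥0 (l ℕ.+ i ℕ.* l) v) (a≤1 (l ℕ.+ i ℕ.* l) v) (I≥0 (l ℕ.+ i ℕ.* l) (length S) (θ S)) (I≤1 (l ℕ.+ i ℕ.* l) (length S) (θ S)))
            (subst (λ w → ℚ.∣ a R S - I R (length S) (θ S) ∣ ≤ℚ w)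
              (trans (cong (η * η *_) (*-^ 16ℚ 16ℚ (length S))) (solve 2 (λ e x → e :* e :* (x :* x) := e :* x :* (e :* x)) refl η (16ℚ ^ℚ length S)))
              (Close-mono {R} (+≥0 half≥0 (*≥0 (⟨⟩≥0 l) (*≥0 ε≥0 (*≥0 p≥0 C≥0)))) (≤-trans 16≥0 (16≤ l)) total (small-base l ℕₚ.≤-refl)
                (block {i ℕ.* l} half≥0 (blocks {l} lε lW i half≥0 sm) {l} small-base) v))
          where
          R = l ℕ.+ i ℕ.* l
          half≥0 : ½ * (η * η) ≥0
          half≥0 = *≥0 (nonNegative⁻¹ ½) (sq≥0 η)
          -- One half of η² is inherited from the earlier blocks; the other half covers this block,
          -- whose l steps add at most p C since l ε ≤ 1.
          total : ½ * (η * η) + ⟨ l ⟩ * (ε * (p * C)) ≤ℚ η * η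
          total = ≤-trans (+-monoʳ-≤ (½ * (η * η)) (≤-trans
              (≤-by (*≥0 (diff≥0 lε) (*≥0 p≥0 C≥0)) (solve 3 (λ l e x → x := l :* (e :* x) :+ (con 1ℚ :- l :* e) :* x) refl ⟨ l ⟩ ε (p * C))) pC))
            (≤-reflexive (solve 1 (λ x → con ½ :* x :+ con ½ :* x := x) refl (η * η)))
          small-base : ∀ k → k ≤ l → 16ℚ * g ^ℚ k ≤ℚ 256ℚ
          small-base k q = *-monoˡ 16≥0 (≤-trans g^k≤2 (toWitness {a? = 2ℚ ℚₚ.≤? 16ℚ} _))
            where
            kW : ⟨ k ⟩ * (ε * W) ≤ℚ ½
            kW = ≤-trans (*-monoʳ (*≥0 ε≥0 W≥0) (⟨⟩-mono q)) lW
            g≥0 : g ≥0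
            g≥0 = +≥0 0≤1 (*≥0 ε≥0 W≥0)
            -- (1 + ε W)^k is at most 1 / (1 - k ε W), so within a block the base does not even
            -- exceed 32.
            g^≤2 : ∀ k → ⟨ k ⟩ * (ε * W) ≤ℚ ½ → g ^ℚ k ≤ℚ 2ℚ
            g^≤2 zero    _ = ≤-by 0≤1 refl
            g^≤2 (suc k) kW = *-cancelˡ {½} (positive⁻¹ ½) (≤-trans (≤-by (*≥0 (^≥0 g≥0 (suc k)) (diff≥0 kW))
                (solve 2 (λ w e → w :* (con 1ℚ :- e) := con ½ :* w :+ w :* (con ½ :- e)) refl (g ^ℚ suc k) (⟨ suc k ⟩ * (ε * W))))
              (pow-growth (*≥0 ε≥0 W≥0) εW≤1 (suc k)))
              where
              εW≤1 : ε * W ≤ℚ 1ℚ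
              εW≤1 = ≤-trans (≤-by (*≥0 (⟨⟩≥0 k) (*≥0 ε≥0 W≥0)) (solve 2 (λ k e → (con 1ℚ :+ k) :* e := e :+ k :* e) refl ⟨ k ⟩ (ε * W)))
                (≤-trans kW (toWitness {a? = ½ ℚₚ.≤? 1ℚ} _))
            g^k≤2 : g ^ℚ k ≤ℚ 2ℚ
            g^k≤2 = g^≤2 k kW

-- The triangle hypergraph of the complete graph

module _ {A B : Set} where

  ∑-× : ∀ (xs : List A) (ys : List B) (f : A × B → ℚ) → ∑ (cartesianProduct xs ys) f ≡ ∑[ x ∈ xs ] ∑[ y ∈ ys ] f (x , y)
  ∑-× []       ys f = refl
  ∑-× (x ∷ xs) ys f = trans (∑-++ (map (x ,_) ys) _ f) (cong₂ _+_ (∑-map (x ,_) ys f) (∑-× xs ys f))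

∑-+₃ : ∀ {A : Set} xs (f g h : A → ℚ) → ∑ xs (λ x → f x + g x + h x) ≡ ∑ xs f + ∑ xs g + ∑ xs h
∑-+₃ xs f g h = trans (∑-+ xs (λ x → f x + g x) h) (cong (_+ ∑ xs h) (∑-+ xs f g))

length-allFin : ∀ n → length (allFin n) ≡ n
length-allFin n = Listₚ.length-tabulate {n = n} id

module CompleteGraph (n : ℕ) where

  private
    V = allFin n
    V-unique : Unique V
    V-unique = Uniqueₚ.allFin⁺ n

  open Containment (_≟ₑ_ {n}) public

  pair? : (e : Edge n) → Dec (proj₁ e Fin.< proj₂ e)
  pair? e = proj₁ e Fin.<? proj₂ e

  Sorted : Triple n → Set
  Sorted (i , j , k) = i Fin.< j × j Fin.< k

  sorted? : (t : Triple n) → Dec (Sorted t)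
  sorted? (i , j , k) = (i Fin.<? j) ×-dec (j Fin.<? k)

  _≟ₜ_ : DecidableEquality (Triple n)
  _≟ₜ_ = ≡-dec Fin._≟_ (≡-dec Fin._≟_ Fin._≟_)

  ∈-pairs⁺ : ∀ {e} → proj₁ e Fin.< proj₂ e → e ∈ pairs n
  ∈-pairs⁺ h = ∈-filter⁺ pair? (∈-cartesianProduct⁺ (∈-allFin _) (∈-allFin _)) h

  ∈-pairs⁻ : ∀ {e} → e ∈ pairs n → proj₁ e Fin.< proj₂ e
  ∈-pairs⁻ i = proj₂ (∈-filter⁻ pair? {xs = cartesianProduct V V} i)

  ∈-triples⁻ : ∀ {t} → t ∈ triples n → Sorted t
  ∈-triples⁻ i = proj₂ (∈-filter⁻ sorted? {xs = cartesianProduct V (cartesianProduct V V)} i)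

  pairs-unique : Unique (pairs n)
  pairs-unique = Uniqueₚ.filter⁺ pair? (Uniqueₚ.cartesianProduct⁺ V-unique V-unique)

  triples-unique : Unique (triples n)
  triples-unique = Uniqueₚ.filter⁺ sorted? (Uniqueₚ.cartesianProduct⁺ V-unique (Uniqueₚ.cartesianProduct⁺ V-unique V-unique))

  tedges-⊆ : ∀ {t} → t ∈ triples n → tedges t ⊆ pairs n
  tedges-⊆ i with ∈-triples⁻ i
  ... | ij , jk = ∈-pairs⁺ ij ∷ ∈-pairs⁺ (Finₚ.<-trans ij jk) ∷ ∈-pairs⁺ jk ∷ []

  tedges-unique : ∀ {t} → t ∈ triples n → Unique (tedges t)
  tedges-unique i with ∈-triples⁻ i
  ... | ij , jk = ((λ { refl → Finₚ.<-irrefl refl jk }) ∷ (λ { refl → Finₚ.<-irrefl refl ij }) ∷ []) ∷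
                  ((λ { refl → Finₚ.<-irrefl refl ij }) ∷ []) ∷ [] ∷ []

  -- The vertices of a triangle, sorted, in terms of any two of its edges.
  corners : Edge n → Edge n → ℕ × ℕ × ℕ
  corners (a , b) (c , d) =
    toℕ a ⊓ toℕ c , (if does (a Fin.≟ c) then toℕ b ⊓ toℕ d else toℕ a ⊔ toℕ c) , toℕ b ⊔ toℕ d

  corners-correct : ∀ {i j k f f′} → Sorted (i , j , k) → f ≢ f′ → f ∈ tedges (i , j , k) → f′ ∈ tedges (i , j , k) →
                    corners f f′ ≡ (toℕ i , toℕ j , toℕ k)
  corners-correct {i} {j} {k} {f} {f′} (ij , jk) ne = go
    where
    i≤j = ℕₚ.<⇒≤ ij
    j≤k = ℕₚ.<⇒≤ jk
    i≢j : i ≢ j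
    i≢j refl = Finₚ.<-irrefl refl ij
    triple : ∀ {a b c a′ b′ c′ : ℕ} → a ≡ a′ → b ≡ b′ → c ≡ c′ → (a , b , c) ≡ (a′ , b′ , c′)
    triple refl refl refl = refl
    same : ∀ {b d : ℕ} → (if does (i Fin.≟ i) then b else d) ≡ b
    same rewrite dec-true (i Fin.≟ i) refl = refl
    diff : ∀ {x y : Fin n} {b d : ℕ} → x ≢ y → (if does (x Fin.≟ y) then b else d) ≡ d
    diff {x} {y} h rewrite dec-false (x Fin.≟ y) h = refl
    go : f ∈ tedges (i , j , k) → f′ ∈ tedges (i , j , k) → corners f f′ ≡ (toℕ i , toℕ j , toℕ k)
    go (here refl) (here refl) = contradiction refl ne
    go (here refl) (there (here refl)) = triple (ℕₚ.⊓-idem _) (trans same (ℕₚ.m≤n⇒m⊓n≡m j≤k)) (ℕₚ.m≤n⇒m⊔n≡n j≤k)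
    go (here refl) (there (there (here refl))) = triple (ℕₚ.m≤n⇒m⊓n≡m i≤j) (trans (diff i≢j) (ℕₚ.m≤n⇒m⊔n≡n i≤j)) (ℕₚ.m≤n⇒m⊔n≡n j≤k)
    go (there (here refl)) (here refl) = triple (ℕₚ.⊓-idem _) (trans same (ℕₚ.m≥n⇒m⊓n≡n j≤k)) (ℕₚ.m≥n⇒m⊔n≡m j≤k)
    go (there (here refl)) (there (here refl)) = contradiction refl ne
    go (there (here refl)) (there (there (here refl))) = triple (ℕₚ.m≤n⇒m⊓n≡m i≤j) (trans (diff i≢j) (ℕₚ.m≤n⇒m⊔n≡n i≤j)) (ℕₚ.⊔-idem _)
    go (there (there (here refl))) (here refl) = triple (ℕₚ.m≥n⇒m⊓n≡n i≤j) (trans (diff (i≢j ∘ sym)) (ℕₚ.m≥n⇒m⊔n≡m i≤j)) (ℕₚ.m≥n⇒m⊔n≡m j≤k)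
    go (there (there (here refl))) (there (here refl)) = triple (ℕₚ.m≥n⇒m⊓n≡n i≤j) (trans (diff (i≢j ∘ sym)) (ℕₚ.m≥n⇒m⊔n≡m i≤j)) (ℕₚ.⊔-idem _)
    go (there (there (here refl))) (there (there (here refl))) = contradiction refl ne

  tedges-linear : ∀ {t t′ f f′} → t ∈ triples n → t′ ∈ triples n → f ≢ f′ →
                  f ∈ tedges t → f′ ∈ tedges t → f ∈ tedges t′ → f′ ∈ tedges t′ → t ≡ t′
  tedges-linear {t} {t′} ti ti′ ne a b c d = cong₂ _,_ (Finₚ.toℕ-injective (cong proj₁ e))
      (cong₂ _,_ (Finₚ.toℕ-injective (cong (proj₁ ∘ proj₂) e)) (Finₚ.toℕ-injective (cong (proj₂ ∘ proj₂) e)))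
    where e = trans (sym (corners-correct (∈-triples⁻ ti) ne a b)) (corners-correct (∈-triples⁻ ti′) ne c d)

  ∑-pairs : ∀ f → ∑ (pairs n) f ≡ ∑[ i ∈ V ] ∑[ j ∈ V ] 𝟙 (i Fin.<? j) * f (i , j)
  ∑-pairs f = trans (∑-filter pair? (cartesianProduct V V) f) (∑-× V V _)

  ∑-triples : ∀ f → ∑ (triples n) f ≡ ∑[ i ∈ V ] ∑[ j ∈ V ] ∑[ k ∈ V ] 𝟙 (i Fin.<? j) * 𝟙 (j Fin.<? k) * f (i , j , k)
  ∑-triples f = trans (∑-filter sorted? (cartesianProduct V (cartesianProduct V V)) f) (trans (∑-× V _ _)
    (∑-cong V λ {i} _ → trans (∑-× V V _) (∑-cong V λ {j} _ → ∑-cong V λ {k} _ → cong (_* f (i , j , k)) (𝟙-× (i Fin.<? j) (j Fin.<? k)))))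

  ∑-V-1 : ∑[ i ∈ V ] 1ℚ ≡ ⟨ n ⟩
  ∑-V-1 = trans (∑-const V 1ℚ) (trans (*-identityʳ _) (cong ⟨_⟩ (length-allFin n)))

  ∑-Fin-≟ : ∀ (u : Fin n) → ∑[ w ∈ V ] 𝟙 (u Fin.≟ w) ≡ 1ℚ
  ∑-Fin-≟ u = trans (∑-cong V λ {w} _ → sym (*-identityʳ _)) (C.∑-≟ V-unique (∈-allFin u) (λ _ → 1ℚ))
    where module C = Containment (Fin._≟_ {n})

  D : ℚ
  D = ⟨ n ⟩ - 2ℚ

  -- The three sums are over the positions of the third vertex: after both ends of f, between them,
  -- or before them. Together with the two ends these exhaust all vertices, which gives n - 2.
  degree : ∀ {f} → f ∈ pairs n → ∑[ t ∈ triples n ] 𝟙 (f ∈? tedges t) ≡ D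
  degree {f@(u , v)} fi = trans (∑-cong (triples n) λ {t} i → 𝟙-∈ {f} {tedges t} (tedges-unique i)) (trans (∑-triples _)
      (trans (∑-cong V λ {i} _ → trans (∑-cong V λ {j} _ → trans (∑-cong V λ {k} _ →
            solve 5 (λ a b x y z → a :* b :* (x :+ (y :+ (z :+ con 0ℚ))) := x :* (a :* b) :+ y :* (a :* b) :+ z :* (a :* b)) refl
              (𝟙 (i Fin.<? j)) (𝟙 (j Fin.<? k)) (𝟙 (f ≟ₑ (i , j))) (𝟙 (f ≟ₑ (i , k))) (𝟙 (f ≟ₑ (j , k))))
          (∑-+₃ V _ _ _)) (∑-+₃ V _ _ _))
      (trans (∑-+₃ V _ _ _) (trans (cong₂ _+_ (cong₂ _+_ first second) third) total))))
    where
    uv : u Fin.< v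
    uv = ∈-pairs⁻ fi
    pick-edge : ∀ (h : Edge n → ℚ) → ∑[ i ∈ V ] ∑[ j ∈ V ] 𝟙 (f ≟ₑ (i , j)) * h (i , j) ≡ h f
    pick-edge h = trans (sym (∑-× V V (λ e → 𝟙 (f ≟ₑ e) * h e)))
      (∑-≟ (Uniqueₚ.cartesianProduct⁺ V-unique V-unique) (∈-cartesianProduct⁺ (∈-allFin u) (∈-allFin v)) h)
    one = 𝟙-yes (u Fin.<? v) uv
    first : ∑[ i ∈ V ] ∑[ j ∈ V ] ∑[ k ∈ V ] 𝟙 (f ≟ₑ (i , j)) * (𝟙 (i Fin.<? j) * 𝟙 (j Fin.<? k)) ≡ ∑[ k ∈ V ] 𝟙 (v Fin.<? k)
    first = trans (∑-cong V λ {i} _ → ∑-cong V λ {j} _ → ∑-*ˡ V (𝟙 (f ≟ₑ (i , j))) _) (trans (pick-edge λ (i , j) → ∑[ k ∈ V ] 𝟙 (i Fin.<? j) * 𝟙 (j Fin.<? k))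
      (∑-cong V λ {k} _ → trans (cong (_* 𝟙 (v Fin.<? k)) one) (*-identityˡ _)))
    second : ∑[ i ∈ V ] ∑[ j ∈ V ] ∑[ k ∈ V ] 𝟙 (f ≟ₑ (i , k)) * (𝟙 (i Fin.<? j) * 𝟙 (j Fin.<? k)) ≡ ∑[ j ∈ V ] 𝟙 (u Fin.<? j) * 𝟙 (j Fin.<? v)
    second = trans (∑-cong V λ {i} _ → trans (∑-swap V V _) (∑-cong V λ {k} _ → ∑-*ˡ V (𝟙 (f ≟ₑ (i , k))) _)) (pick-edge λ (i , k) → ∑[ j ∈ V ] 𝟙 (i Fin.<? j) * 𝟙 (j Fin.<? k))
    third : ∑[ i ∈ V ] ∑[ j ∈ V ] ∑[ k ∈ V ] 𝟙 (f ≟ₑ (j , k)) * (𝟙 (i Fin.<? j) * 𝟙 (j Fin.<? k)) ≡ ∑[ i ∈ V ] 𝟙 (i Fin.<? u)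
    third = trans (trans (∑-swap V V _) (∑-cong V λ {j} _ → trans (∑-swap V V _) (∑-cong V λ {k} _ → ∑-*ˡ V (𝟙 (f ≟ₑ (j , k))) _)))
      (trans (pick-edge λ (j , k) → ∑[ i ∈ V ] 𝟙 (i Fin.<? j) * 𝟙 (j Fin.<? k))
        (∑-cong V λ {i} _ → trans (cong (𝟙 (i Fin.<? u) *_) one) (*-identityʳ _)))
    third-vertex : ∀ w → 𝟙 (v Fin.<? w) + 𝟙 (u Fin.<? w) * 𝟙 (w Fin.<? v) + 𝟙 (w Fin.<? u) + (𝟙 (u Fin.≟ w) + 𝟙 (v Fin.≟ w)) ≡ 1ℚ
    third-vertex w with Finₚ.<-cmp w u | Finₚ.<-cmp w v
    ... | tri< a b c | tri< a′ b′ c′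
      rewrite 𝟙-no (v Fin.<? w) c′ | 𝟙-no (u Fin.<? w) c | 𝟙-yes (w Fin.<? v) a′ | 𝟙-yes (w Fin.<? u) a | 𝟙-no (u Fin.≟ w) (b ∘ sym) | 𝟙-no (v Fin.≟ w) (b′ ∘ sym) = refl
    ... | tri≈ a b c | tri< a′ b′ c′
      rewrite 𝟙-no (v Fin.<? w) c′ | 𝟙-no (u Fin.<? w) c | 𝟙-yes (w Fin.<? v) a′ | 𝟙-no (w Fin.<? u) a | 𝟙-yes (u Fin.≟ w) (sym b) | 𝟙-no (v Fin.≟ w) (b′ ∘ sym) = refl
    ... | tri> a b c | tri< a′ b′ c′
      rewrite 𝟙-no (v Fin.<? w) c′ | 𝟙-yes (u Fin.<? w) c | 𝟙-yes (w Fin.<? v) a′ | 𝟙-no (w Fin.<? u) a | 𝟙-no (u Fin.≟ w) (b ∘ sym) | 𝟙-no (v Fin.≟ w) (b′ ∘ sym) = refl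
    ... | tri> a b c | tri≈ a′ b′ c′
      rewrite 𝟙-no (v Fin.<? w) c′ | 𝟙-yes (u Fin.<? w) c | 𝟙-no (w Fin.<? v) a′ | 𝟙-no (w Fin.<? u) a | 𝟙-no (u Fin.≟ w) (b ∘ sym) | 𝟙-yes (v Fin.≟ w) (sym b′) = refl
    ... | tri> a b c | tri> a′ b′ c′
      rewrite 𝟙-yes (v Fin.<? w) c′ | 𝟙-yes (u Fin.<? w) c | 𝟙-no (w Fin.<? v) a′ | 𝟙-no (w Fin.<? u) a | 𝟙-no (u Fin.≟ w) (b ∘ sym) | 𝟙-no (v Fin.≟ w) (b′ ∘ sym) = refl
    ... | tri< a _ _ | tri≈ _ refl _ = contradiction (Finₚ.<-trans a uv) (Finₚ.<-irrefl refl)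
    ... | tri< a _ _ | tri> _ _ c′ = contradiction (Finₚ.<-trans a (Finₚ.<-trans uv c′)) (Finₚ.<-irrefl refl)
    ... | tri≈ _ refl _ | tri≈ _ refl _ = contradiction uv (Finₚ.<-irrefl refl)
    ... | tri≈ _ refl _ | tri> _ _ c′ = contradiction (Finₚ.<-trans uv c′) (Finₚ.<-irrefl refl)
    total : ∑[ k ∈ V ] 𝟙 (v Fin.<? k) + ∑[ j ∈ V ] 𝟙 (u Fin.<? j) * 𝟙 (j Fin.<? v) + ∑[ i ∈ V ] 𝟙 (i Fin.<? u) ≡ D
    total = trans (solve 4 (λ a b c n → a :+ b :+ c := a :+ b :+ c :+ con 2ℚ :- con 2ℚ) refl (∑[ k ∈ V ] 𝟙 (v Fin.<? k)) (∑[ j ∈ V ] 𝟙 (u Fin.<? j) * 𝟙 (j Fin.<? v)) (∑[ i ∈ V ] 𝟙 (i Fin.<? u)) D) (cong (_- 2ℚ) (trans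
      (sym (trans (∑-+ V _ _) (cong₂ _+_ (∑-+₃ V _ _ _) (trans (∑-+ V _ _) (cong₂ _+_ (∑-Fin-≟ u) (∑-Fin-≟ v))))))
      (trans (∑-cong V λ {w} _ → third-vertex w) ∑-V-1)))

  N : ℚ
  N = ⟨ length (pairs n) ⟩

  N≡∑ : N ≡ ∑[ e ∈ pairs n ] 1ℚ
  N≡∑ = sym (trans (∑-const (pairs n) 1ℚ) (*-identityʳ N))

  N-double : N + N + ⟨ n ⟩ ≡ ⟨ n ⟩ * ⟨ n ⟩
  N-double = trans (cong₂ _+_ (cong₂ _+_ as-sum (trans as-sum (∑-swap V V _))) (trans (sym ∑-V-1) (∑-cong V λ {i} _ → sym (∑-Fin-≟ i))))
      (trans (sym (trans (∑-cong V λ _ → ∑-+₃ V _ _ _) (∑-+₃ V _ _ _)))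
      (trans (∑-cong V λ {i} _ → trans (∑-cong V λ {j} _ → trichotomy i j) ∑-V-1)
        (trans (∑-const V ⟨ n ⟩) (cong (λ k → ⟨ k ⟩ * ⟨ n ⟩) (length-allFin n)))))
    where
    as-sum : N ≡ ∑[ i ∈ V ] ∑[ j ∈ V ] 𝟙 (i Fin.<? j)
    as-sum = trans N≡∑ (trans (∑-pairs (λ _ → 1ℚ)) (∑-cong V λ _ → ∑-cong V λ _ → *-identityʳ _))
    trichotomy : ∀ (i j : Fin n) → 𝟙 (i Fin.<? j) + 𝟙 (j Fin.<? i) + 𝟙 (i Fin.≟ j) ≡ 1ℚ
    trichotomy i j with Finₚ.<-cmp i j
    ... | tri< a b c rewrite 𝟙-yes (i Fin.<? j) a | 𝟙-no (j Fin.<? i) c | 𝟙-no (i Fin.≟ j) b = refl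
    ... | tri≈ a b c rewrite 𝟙-no (i Fin.<? j) a | 𝟙-no (j Fin.<? i) c | 𝟙-yes (i Fin.≟ j) b = refl
    ... | tri> a b c rewrite 𝟙-no (i Fin.<? j) a | 𝟙-yes (j Fin.<? i) c | 𝟙-no (i Fin.≟ j) b = refl

  Tr : ℚ
  Tr = ⟨ length (triples n) ⟩

  -- Double counting of the incidences between edges and triangles.
  triple-count : 3ℚ * Tr ≡ N * D
  triple-count = trans (trans (*-comm 3ℚ Tr) (trans (sym (∑-const (triples n) 3ℚ)) (∑-cong (triples n) λ {t} i → sym (edges-of i))))
      (trans (∑-swap (triples n) (pairs n) _) (trans (∑-cong (pairs n) degree) (∑-const (pairs n) D)))
    where
    edges-of : ∀ {t} → t ∈ triples n → ∑[ f ∈ pairs n ] 𝟙 (f ∈? tedges t) ≡ 3ℚ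
    edges-of {t} i = trans (∑-∈-comm pairs-unique (tedges-unique i)) (trans (∑-cong (tedges t) λ {f} j → 𝟙-yes (f ∈? pairs n) (All.lookup (tedges-⊆ i) j)) refl)

-- Packings and covers of a fixed graph

module _ {A : Set} where

  max-attained : ∀ (g : A → ℕ) xs → maxℕ (map g xs) ≡ 0 ⊎ ∃[ x ] (x ∈ xs × g x ≡ maxℕ (map g xs))
  max-attained g []       = inj₁ refl
  max-attained g (x ∷ xs) with ℕₚ.⊔-sel (g x) (maxℕ (map g xs)) | max-attained g xs
  ... | inj₁ e | _ = inj₂ (x , here refl , sym e)
  ... | inj₂ e | inj₁ z = inj₁ (trans e z)
  ... | inj₂ e | inj₂ (y , i , h) = inj₂ (y , there i , trans h (sym e))

  ≤-max : ∀ (g : A → ℕ) {xs x} → x ∈ xs → g x ≤ maxℕ (map g xs)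
  ≤-max g {y ∷ xs} (here refl) = ℕₚ.m≤m⊔n (g y) _
  ≤-max g {y ∷ xs} (there i)   = ℕₚ.≤-trans (≤-max g i) (ℕₚ.m≤n⊔m (g y) _)

  min-attained : ∀ m (g : A → ℕ) xs → foldr _⊓_ m (map g xs) ≡ m ⊎ ∃[ x ] (x ∈ xs × g x ≡ foldr _⊓_ m (map g xs))
  min-attained m g []       = inj₁ refl
  min-attained m g (x ∷ xs) with ℕₚ.⊓-sel (g x) (foldr _⊓_ m (map g xs)) | min-attained m g xs
  ... | inj₁ e | _ = inj₂ (x , here refl , sym e)
  ... | inj₂ e | inj₁ z = inj₁ (trans e z)
  ... | inj₂ e | inj₂ (y , i , h) = inj₂ (y , there i , trans h (sym e))

  min-≤ : ∀ m (g : A → ℕ) {xs x} → x ∈ xs → foldr _⊓_ m (map g xs) ≤ g x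
  min-≤ m g {y ∷ xs} (here refl) = ℕₚ.m⊓n≤m (g y) _
  min-≤ m g {y ∷ xs} (there i)   = ℕₚ.≤-trans (ℕₚ.m⊓n≤n (g y) _) (min-≤ m g i)

  Insert-∈ : ∀ {x y : A} {G G′} → Insert x G G′ → y ∈ G′ → y ≡ x ⊎ y ∈ G
  Insert-∈ here      (here e)  = inj₁ e
  Insert-∈ here      (there i) = inj₂ i
  Insert-∈ (there _) (here e)  = inj₂ (here e)
  Insert-∈ (there s) (there i) = [ inj₁ , inj₂ ∘ there ]′ (Insert-∈ s i)

  ∈-Insert : ∀ {x y : A} {G G′} → Insert x G G′ → y ∈ G → y ∈ G′
  ∈-Insert here      i         = there i
  ∈-Insert (there _) (here e)  = here e
  ∈-Insert (there s) (there i) = there (∈-Insert s i)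

  Insert-⊑ : ∀ {x : A} {G G′} → Insert x G G′ → G ⊑ G′
  Insert-⊑ here      = _ ∷ʳ Sub.⊆-refl
  Insert-⊑ (there s) = refl ∷ Insert-⊑ s

  Split-⊑ˡ : ∀ {G₁ G₂ G : List A} → Split G₁ G₂ G → G₁ ⊑ G
  Split-⊑ˡ []      = []
  Split-⊑ˡ (x ◂ s) = refl ∷ Split-⊑ˡ s
  Split-⊑ˡ (x ▸ s) = x ∷ʳ Split-⊑ˡ s

  Split-⊑ʳ : ∀ {G₁ G₂ G : List A} → Split G₁ G₂ G → G₂ ⊑ G
  Split-⊑ʳ []      = []
  Split-⊑ʳ (x ◂ s) = x ∷ʳ Split-⊑ʳ s
  Split-⊑ʳ (x ▸ s) = refl ∷ Split-⊑ʳ s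

  Split-disjoint : ∀ {G₁ G₂ G : List A} {x} → Split G₁ G₂ G → Unique G → x ∈ G₁ → x ∉ G₂
  Split-disjoint (x ◂ s) (n ∷ u) (here refl) j = All.lookup n (Sub.lookup (Split-⊑ʳ s) j) refl
  Split-disjoint (x ◂ s) (n ∷ u) (there i)   j = Split-disjoint s u i j
  Split-disjoint (x ▸ s) (n ∷ u) i (here refl) = All.lookup n (Sub.lookup (Split-⊑ˡ s) i) refl
  Split-disjoint (x ▸ s) (n ∷ u) i (there j)   = Split-disjoint s u i j

  AllPairs-lookup : ∀ {R : A → A → Set} {xs} → (∀ {x y} → R x y → R y x) → AllPairs R xs →
                    ∀ {x y} → x ∈ xs → y ∈ xs → x ≢ y → R x y
  AllPairs-lookup s (r ∷ rs) (here refl) (here refl) ne = contradiction refl ne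
  AllPairs-lookup s (r ∷ rs) (here refl) (there j)   ne = All.lookup r j
  AllPairs-lookup s (r ∷ rs) (there i)   (here refl) ne = s (All.lookup r i)
  AllPairs-lookup s (r ∷ rs) (there i)   (there j)   ne = AllPairs-lookup s rs i j ne

  AllPairs-tabulate : ∀ {R : A → A → Set} {xs} → Unique xs → (∀ {x y} → x ∈ xs → y ∈ xs → x ≢ y → R x y) → AllPairs R xs
  AllPairs-tabulate []      h = []
  AllPairs-tabulate (n ∷ u) h = All.tabulate (λ i → h (here refl) (there i) (All.lookup n i)) ∷
    AllPairs-tabulate u λ i j → h (there i) (there j)

module Length {A : Set} (_≟_ : DecidableEquality A) where

  open Containment _≟_

  -- Counts the coincidences between the two lists: each entry of `xs` has at least one, each entry
  -- of `ys` at most one.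
  length-⊆ : ∀ {xs ys} → Unique xs → xs ⊆ ys → length xs ≤ length ys
  length-⊆ {xs} {ys} u s = ⟨⟩-pred _ _ (subst₂ _≤ℚ_
    (trans (∑-const xs 1ℚ) (*-identityʳ _)) (trans (∑-const ys 1ℚ) (*-identityʳ _))
    (≤-trans (∑-mono xs λ {x} i → subst (_≤ℚ ∑[ y ∈ ys ] 𝟙 (x ≟ y)) (𝟙-yes (x ≟ x) refl) (∑-∈ ys (λ {y} _ → 𝟙≥0 (x ≟ y)) (All.lookup s i)))
    (subst (_≤ℚ ∑[ y ∈ ys ] 1ℚ) (sym (∑-swap xs ys _)) (∑-mono ys λ {y} _ → ∑-atMost1 (_≟ y) u λ _ _ e e′ → trans e (sym e′)))))

-- By integrality failure costs a whole unit. Chebyshev only needs the sign, but `bad≤` relies on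
-- the -1.
deficit-cases : ∀ v t (d : Dec (t ≤ 2 ℕ.* v)) → let b = if does d then 0ℚ else 1ℚ in
                b ≡ 0ℚ ⊎ (b ≡ 1ℚ × 2ℚ * ⟨ v ⟩ - ⟨ t ⟩ ≤ℚ - 1ℚ)
deficit-cases v t (yes _) = inj₁ refl
deficit-cases v t (no h)  = inj₂ (refl , ≤-by (diff≥0 (subst (λ w → 1ℚ + w ≤ℚ ⟨ t ⟩) (⟨⟩-* 2 v) (⟨⟩-mono (ℕₚ.≰⇒> h))))
  (solve 2 (λ v t → con (- 1ℚ) := con 2ℚ :* v :- t :+ (t :- (con 1ℚ :+ con 2ℚ :* v))) refl ⟨ v ⟩ ⟨ t ⟩))

-- Both increments are 0 or 1, so 2 v - t changes by -1, 0, 1 or 2.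
deficit-lipschitz : ∀ {v t v′ t′} → v′ ≡ v ⊎ v′ ≡ suc v → t′ ≡ t ⊎ t′ ≡ suc t →
  let x = 2ℚ * ⟨ v ⟩ - ⟨ t ⟩ ; x′ = 2ℚ * ⟨ v′ ⟩ - ⟨ t′ ⟩ in (x′ - x) * (x′ - x) ≤ℚ 4ℚ
deficit-lipschitz {v} {t} (inj₁ refl) (inj₁ refl) = ≤-by (nonNegative⁻¹ 4ℚ)
  (solve 2 (λ v t → let x = con 2ℚ :* v :- t in con 4ℚ := (x :- x) :* (x :- x) :+ con 4ℚ) refl ⟨ v ⟩ ⟨ t ⟩)
deficit-lipschitz {v} {t} (inj₁ refl) (inj₂ refl) = ≤-by (nonNegative⁻¹ 3ℚ)
  (solve 2 (λ v t → let x = con 2ℚ :* v :- t ; x′ = con 2ℚ :* v :- (con 1ℚ :+ t) in con 4ℚ := (x′ :- x) :* (x′ :- x) :+ con 3ℚ) refl ⟨ v ⟩ ⟨ t ⟩)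
deficit-lipschitz {v} {t} (inj₂ refl) (inj₁ refl) = ≤-by (≤-refl {0ℚ})
  (solve 2 (λ v t → let x = con 2ℚ :* v :- t ; x′ = con 2ℚ :* (con 1ℚ :+ v) :- t in con 4ℚ := (x′ :- x) :* (x′ :- x) :+ con 0ℚ) refl ⟨ v ⟩ ⟨ t ⟩)
deficit-lipschitz {v} {t} (inj₂ refl) (inj₂ refl) = ≤-by (nonNegative⁻¹ 3ℚ)
  (solve 2 (λ v t → let x = con 2ℚ :* v :- t ; x′ = con 2ℚ :* (con 1ℚ :+ v) :- (con 1ℚ :+ t) in con 4ℚ := (x′ :- x) :* (x′ :- x) :+ con 3ℚ) refl ⟨ v ⟩ ⟨ t ⟩)

0-or-1 : ∀ {a b} → a ≤ b → b ≤ suc a → b ≡ a ⊎ b ≡ suc a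
0-or-1 p q with ℕₚ.m≤n⇒m<n∨m≡n p
... | inj₁ r = inj₂ (ℕₚ.≤-antisym q r)
... | inj₂ r = inj₁ (sym r)

module Packing (n : ℕ) where

  open CompleteGraph n
  private
    module Lₑ = Length (_≟ₑ_ {n})
    module Lₜ = Length _≟ₜ_

  Graph : Set
  Graph = List (Edge n)

  inside? : (G : Graph) (t : Triple n) → Dec (tedges t ⊆ G)
  inside? G t = tedges t ⊆? G

  ∈-triangles⁺ : ∀ {G t} → t ∈ triples n → tedges t ⊆ G → t ∈ triangles G
  ∈-triangles⁺ {G} = ∈-filter⁺ (inside? G)

  ∈-triangles⁻ : ∀ {G t} → t ∈ triangles G → t ∈ triples n × tedges t ⊆ G
  ∈-triangles⁻ {G} = ∈-filter⁻ (inside? G)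

  triangles-unique : ∀ G → Unique (triangles G)
  triangles-unique G = Uniqueₚ.filter⁺ (inside? G) triples-unique

  ED-sym : ∀ {t u : Triple n} → EdgeDisjoint t u → EdgeDisjoint u t
  ED-sym d = All.tabulate λ i j → All.lookup d j i

  ED-irrefl : ∀ {t : Triple n} → ¬ EdgeDisjoint t t
  ED-irrefl (h ∷ _) = h (here refl)

  packing-unique : ∀ {T : List (Triple n)} → AllPairs EdgeDisjoint T → Unique T
  packing-unique = AllPairs.map λ { d refl → ED-irrefl d }

  IsPacking : Graph → List (Triple n) → Set
  IsPacking G T = AllPairs EdgeDisjoint T × All (_∈ triangles G) T

  -- The maximum in `ν` runs over sublists of `triangles G`, while T may list its triangles in any
  -- order; `T′` is the sublist with the same members.
  ν-lower : ∀ {G T} → IsPacking G T → length T ≤ ν G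
  ν-lower {G} {T} (d , i) = ℕₚ.≤-trans (Lₜ.length-⊆ (packing-unique d) (All.tabulate λ j → ∈-filter⁺ T? (All.lookup i j) j))
      (subst (_≤ ν G) value (≤-max size (⊑-sublists (Subₚ.filter-⊆ T? (triangles G)))))
    where
    module Cₜ = Containment _≟ₜ_
    T? = λ t → t Cₜ.∈? T
    T′ = filter T? (triangles G)
    size = λ U → if does (allPairs? edgeDisjoint? U) then length U else 0
    T′-disjoint : AllPairs EdgeDisjoint T′
    T′-disjoint = AllPairs-tabulate (Uniqueₚ.filter⁺ T? (triangles-unique G)) λ a b →
      AllPairs-lookup ED-sym d (proj₂ (∈-filter⁻ T? {xs = triangles G} a)) (proj₂ (∈-filter⁻ T? {xs = triangles G} b))
    value : size T′ ≡ length T′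
    value = cong (if_then length T′ else 0) (dec-true (allPairs? edgeDisjoint? T′) T′-disjoint)

  -- Wherever a default 0 is the maximum, the empty packing attains it.
  ν-attained : ∀ G → ∃[ T ] (IsPacking G T × length T ≡ ν G)
  ν-attained G with max-attained (λ U → if does (allPairs? edgeDisjoint? U) then length U else 0) (sublists (triangles G))
  ... | inj₁ e = [] , ([] , []) , sym e
  ... | inj₂ (T , i , e) with allPairs? edgeDisjoint? T
  ...   | yes d = T , (d , All.tabulate (Sub.lookup (sublists-⊑ _ i))) , e
  ...   | no _  = [] , ([] , []) , e

  ν-mono : ∀ {G G′} → (∀ {e} → e ∈ G → e ∈ G′) → ν G ≤ ν G′
  ν-mono {G} {G′} s with ν-attained G
  ... | T , (d , i) , e = subst (_≤ ν G′) e (ν-lower {G′} (d , All.map (λ j → let a , b = ∈-triangles⁻ {G} j in ∈-triangles⁺ {G′} a (All.map s b)) i))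

  -- At most one triangle of an edge-disjoint family contains e, and the others are triangles of G.
  ν-insert : ∀ {e G G′} → Insert e G G′ → ν G′ ≤ suc (ν G)
  ν-insert {e} {G} {G′} s with ν-attained G′
  ... | T , (d , i) , q = subst (_≤ suc (ν G)) q (ℕₚ.≤-trans (count d) (s≤s (ν-lower {G} (AllPairsₚ.filter⁺ avoid? d ,
      All.tabulate λ j → let j₁ , j₂ = ∈-filter⁻ avoid? {xs = T} j ; a , b = ∈-triangles⁻ {G′} (All.lookup i j₁) in
        ∈-triangles⁺ {G} a (All.tabulate λ k → [ (λ { refl → contradiction k j₂ }) , id ]′ (Insert-∈ s (All.lookup b k)))))))
    where
    avoid? = λ t → ¬? (e ∈? tedges t)
    count : ∀ {T} → AllPairs EdgeDisjoint T → length T ≤ suc (length (filter avoid? T))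
    count [] = z≤n
    count {t ∷ T} (r ∷ rs) = go (e ∈? tedges t)
      where
      go : Dec (e ∈ tedges t) → length (t ∷ T) ≤ suc (length (filter avoid? (t ∷ T)))
      go (yes h) = s≤s (ℕₚ.≤-reflexive (cong length (sym (trans (Listₚ.filter-reject avoid? (λ k → k h)) (Listₚ.filter-all avoid? (All.map (λ d k → All.lookup d h k) r))))))
      go (no h)  = subst (λ l → length (t ∷ T) ≤ suc l) (sym (cong length (Listₚ.filter-accept avoid? h))) (s≤s (count rs))

  triangles-mono : ∀ {G G′ t} → (∀ {e} → e ∈ G → e ∈ G′) → t ∈ triangles G → t ∈ triangles G′
  triangles-mono {G} {G′} s i = ∈-triangles⁺ {G′} (proj₁ (∈-triangles⁻ {G} i)) (All.map s (proj₂ (∈-triangles⁻ {G} i)))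

  disjoint-triangles : ∀ {G G′ t u} → (∀ {e} → e ∈ G → e ∉ G′) → t ∈ triangles G → u ∈ triangles G′ → EdgeDisjoint t u
  disjoint-triangles {G} {G′} s i j = All.tabulate λ a b →
    s (All.lookup (proj₂ (∈-triangles⁻ {G} i)) a) (All.lookup (proj₂ (∈-triangles⁻ {G′} j)) b)

  ν-remove : ∀ {U t} → t ∈ triples n → tedges t ⊆ U → suc (ν (U ∖ tedges t)) ≤ ν U
  ν-remove {U} {t} ti s with ν-attained (U ∖ tedges t)
  ... | T , (d , i) , q = subst (λ l → suc l ≤ ν U) q (ν-lower {U} {t ∷ T} (All.map disjoint i ∷ d ,
      ∈-triangles⁺ {U} ti s ∷ All.map (triangles-mono {U ∖ tedges t} (λ j → proj₁ (∈-∖⁻ {S = U} {tedges t} j))) i))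
    where
    disjoint : ∀ {u} → u ∈ triangles (U ∖ tedges t) → EdgeDisjoint t u
    disjoint j = All.tabulate λ a b → proj₂ (∈-∖⁻ {S = U} {tedges t} (All.lookup (proj₂ (∈-triangles⁻ {U ∖ tedges t} j)) b)) a

  ν-split : ∀ {G₁ G₂ G} → Split G₁ G₂ G → Unique G → ν G₁ ℕ.+ ν G₂ ≤ ν G
  ν-split {G₁} {G₂} {G} s u with ν-attained G₁ | ν-attained G₂
  ... | T₁ , (d₁ , i₁) , q₁ | T₂ , (d₂ , i₂) , q₂ = subst (_≤ ν G) (trans (Listₚ.length-++ T₁) (cong₂ ℕ._+_ q₁ q₂)) (ν-lower {G} {T₁ ++ T₂}
      (AllPairsₚ.++⁺ d₁ d₂ (All.map (λ j → All.map (disjoint-triangles {G₁} {G₂} (Split-disjoint s u) j) i₂) i₁) ,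
       Allₚ.++⁺ (All.map (triangles-mono {G₁} (Sub.lookup (Split-⊑ˡ s))) i₁) (All.map (triangles-mono {G₂} (Sub.lookup (Split-⊑ʳ s))) i₂)))

  -- F may repeat edges or leave G, while `τ` minimises over sublists of G. The edges of G lying in
  -- F form such a sublist, and it still covers because a triangle of G has all its edges in G.
  τ-upper : ∀ {G F} → Unique G → Covers G F → τ G ≤ length F
  τ-upper {G} {F} u c = ℕₚ.≤-trans (subst (τ G ≤_) value (min-≤ (length G) size (⊑-sublists (Subₚ.filter-⊆ F? G))))
      (Lₑ.length-⊆ (Uniqueₚ.filter⁺ F? u) (All.tabulate λ i → proj₂ (∈-filter⁻ F? {xs = G} i)))
    where
    F? = λ e → e ∈? F
    F′ = filter F? G
    size = λ H → if does (covers? G H) then length H else length G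
    F′-covers : Covers G F′
    F′-covers = All.tabulate λ {t} i → let e , e∈t , e∈F = find (All.lookup c i) in
        lose e∈t (∈-filter⁺ F? (All.lookup (proj₂ (∈-triangles⁻ {G} i)) e∈t) e∈F)
    value : size F′ ≡ length F′
    value = cong (if_then length F′ else length G) (dec-true (covers? G F′) F′-covers)

  τ-attained : ∀ G → ∃[ F ] (Covers G F × length F ≡ τ G)
  τ-attained G with min-attained (length G) (λ H → if does (covers? G H) then length H else length G) (sublists G)
  ... | inj₁ e = G , self , sym e
    where self : Covers G G
          self = All.tabulate λ {t} i → here (All.head (proj₂ (∈-triangles⁻ {G} i)))
  ... | inj₂ (F , i , e) with covers? G F
  ...   | yes c = F , c , e
  ...   | no _  = G , self , e
    where self : Covers G G
          self = All.tabulate λ {t} i → here (All.head (proj₂ (∈-triangles⁻ {G} i)))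

  τ-mono : ∀ {G G′} → Unique G → (∀ {e} → e ∈ G → e ∈ G′) → τ G ≤ τ G′
  τ-mono {G} {G′} u s with τ-attained G′
  ... | F , c , e = subst (τ G ≤_) e (τ-upper u (All.tabulate λ i → let a , b = ∈-triangles⁻ {G} i in All.lookup c (∈-triangles⁺ {G′} a (All.map s b))))

  τ-insert : ∀ {e G G′} → Unique G′ → Insert e G G′ → τ G′ ≤ suc (τ G)
  τ-insert {e} {G} {G′} u s with τ-attained G
  ... | F , c , q = subst (λ l → τ G′ ≤ suc l) q (τ-upper {G′} {e ∷ F} u (All.tabulate λ {t} i → case e ∈? tedges t of λ
    { (yes h) → Any.map (here ∘ sym) h
    ; (no h) → let a , b = ∈-triangles⁻ {G′} i in Any.map there (All.lookup c (∈-triangles⁺ {G} a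
        (All.tabulate λ k → [ (λ { refl → contradiction k h }) , id ]′ (Insert-∈ s (All.lookup b k))))) }))

  τ≤triangles : ∀ {G} → Unique G → τ G ≤ length (triangles G)
  τ≤triangles {G} u = subst (τ G ≤_) (Listₚ.length-map first (triangles G)) (τ-upper u (All.tabulate λ i → here (∈-map⁺ first i)))
    where first : Triple n → Edge n
          first (i , j , k) = i , j

  X : Graph → ℚ
  X G = 2ℚ * ⟨ ν G ⟩ - ⟨ τ G ⟩

  bad : Graph → ℚ
  bad G = if does (τ G ℕ.≤? 2 ℕ.* ν G) then 0ℚ else 1ℚ

  bad-cases : ∀ G → bad G ≡ 0ℚ ⊎ (bad G ≡ 1ℚ × X G ≤ℚ - 1ℚ)
  bad-cases G = deficit-cases (ν G) (τ G) (τ G ℕ.≤? 2 ℕ.* ν G)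

  X-lipschitz : ∀ {e G G′} → Insert e G G′ → G′ ⊑ pairs n → (X G′ - X G) * (X G′ - X G) ≤ℚ 4ℚ
  X-lipschitz {e} {G} {G′} s sub = deficit-lipschitz (0-or-1 (ν-mono (∈-Insert s)) (ν-insert s))
      (0-or-1 (τ-mono (⊑-Unique (Insert-⊑ s) u) (∈-Insert s)) (τ-insert u s))
    where u = ⊑-Unique sub pairs-unique

  Conflict : Triple n → Triple n → Set
  Conflict t u = t ≢ u × ¬ EdgeDisjoint t u

  conflict? : ∀ t u → Dec (Conflict t u)
  conflict? t u = ¬? (t ≟ₜ u) ×-dec ¬? (edgeDisjoint? t u)

  conflict-sym : ∀ {t u} → Conflict t u → Conflict u t
  conflict-sym (a , b) = a ∘ sym , b ∘ ED-sym

  conflicts : List (Triple n) → Triple n → ℚ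
  conflicts T t = ∑[ u ∈ T ] 𝟙 (conflict? t u)

  -- Keep the triples without a later conflict.
  independent : ∀ T → Unique T → ∃[ K ] (K ⊑ T × AllPairs EdgeDisjoint K × 2ℚ * ⟨ length T ⟩ ≤ℚ 2ℚ * ⟨ length K ⟩ + (∑[ t ∈ T ] conflicts T t))
  independent []      u = [] , [] , [] , ≤-refl
  independent (x ∷ T) (n ∷ u) with independent T u
  ... | K , s , d , le = go (All.all? (edgeDisjoint? x) T)
    where
    c = conflicts T x
    total : ∑[ t ∈ x ∷ T ] conflicts (x ∷ T) t ≡ 2ℚ * c + (∑[ t ∈ T ] conflicts T t)
    total = trans (cong₂ _+_ (cong (_+ c) (𝟙-no (conflict? x x) λ h → proj₁ h refl)) (trans (∑-+ T (λ t → 𝟙 (conflict? t x)) (conflicts T))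
        (cong (_+ ∑ T (conflicts T)) (∑-cong T λ {t} _ → 𝟙-cong (conflict? t x) (conflict? x t) conflict-sym conflict-sym))))
      (solve 2 (λ c s → con 0ℚ :+ c :+ (c :+ s) := con 2ℚ :* c :+ s) refl c (∑ T (conflicts T)))
    c≥0 : c ≥0
    c≥0 = ∑≥0 T λ {t} _ → 𝟙≥0 (conflict? x t)
    go : Dec (All (EdgeDisjoint x) T) → _
    go (yes h) = x ∷ K , refl ∷ s , Subₚ.All-resp-⊆ s h ∷ d ,
      subst (λ w → 2ℚ * ⟨ length (x ∷ T) ⟩ ≤ℚ 2ℚ * ⟨ length (x ∷ K) ⟩ + w) (sym total) (≤-by (+≥0 (diff≥0 le) (*≥0 (+≥0 0≤1 0≤1) c≥0))
        (solve 4 (λ l k c s → con 2ℚ :* (con 1ℚ :+ k) :+ (con 2ℚ :* c :+ s) := con 2ℚ :* (con 1ℚ :+ l) :+ (con 2ℚ :* k :+ s :- con 2ℚ :* l :+ con 2ℚ :* c)) refl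
          ⟨ length T ⟩ ⟨ length K ⟩ c (∑ T (conflicts T))))
    go (no h) = K , x ∷ʳ s , d ,
      subst (λ w → 2ℚ * ⟨ length (x ∷ T) ⟩ ≤ℚ 2ℚ * ⟨ length K ⟩ + w) (sym total) (≤-by (+≥0 (diff≥0 le) (*≥0 (+≥0 0≤1 0≤1) (diff≥0 1≤c)))
        (solve 4 (λ l k c s → con 2ℚ :* k :+ (con 2ℚ :* c :+ s) := con 2ℚ :* (con 1ℚ :+ l) :+ (con 2ℚ :* k :+ s :- con 2ℚ :* l :+ con 2ℚ :* (c :- con 1ℚ))) refl
          ⟨ length T ⟩ ⟨ length K ⟩ c (∑ T (conflicts T))))
      where
      1≤c : 1ℚ ≤ℚ c
      1≤c with find (Allₚ.¬All⇒Any¬ (edgeDisjoint? x) T h)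
      ... | y , yi , yd = subst (_≤ℚ c) (𝟙-yes (conflict? x y) (All.lookup n yi , yd)) (∑-∈ T (λ {t} _ → 𝟙≥0 (conflict? x t)) yi)

  -- Combines τ ≤ T with ν ≥ T - P / 2 from `independent`, where T counts the triangles and P the
  -- ordered pairs in conflict.
  X-lower : ∀ {G} → Unique G → ⟨ length (triangles G) ⟩ - (∑[ t ∈ triangles G ] conflicts (triangles G) t) ≤ℚ X G
  X-lower {G} u with independent (triangles G) (triangles-unique G)
  ... | K , s , d , le = ≤-by (+≥0 (+≥0 (diff≥0 le) (*≥0 (+≥0 0≤1 0≤1) (diff≥0 (⟨⟩-mono (ν-lower {G} (d , All.tabulate (Sub.lookup s)))))))
      (diff≥0 (⟨⟩-mono (τ≤triangles u))))
    (solve 5 (λ v t k T c → con 2ℚ :* v :- t := T :- c :+ (con 2ℚ :* k :+ c :- con 2ℚ :* T :+ con 2ℚ :* (v :- k) :+ (T :- t))) refl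
      ⟨ ν G ⟩ ⟨ τ G ⟩ ⟨ length K ⟩ ⟨ length (triangles G) ⟩ (∑[ t ∈ triangles G ] conflicts (triangles G) t))

-- Expected packing number for bounded codegree

𝔼-length : ∀ {A : Set} p (xs : List A) → 𝔼 p xs (λ G → ⟨ length G ⟩) ≡ p * ⟨ length xs ⟩
𝔼-length p []       = sym (*-zeroʳ p)
𝔼-length p (x ∷ xs) = trans (cong₂ (λ a b → p * a + (1ℚ - p) * b)
    (trans (𝔼-+ p xs (λ _ → 1ℚ) (λ G → ⟨ length G ⟩)) (cong₂ _+_ (𝔼-const p xs 1ℚ) (𝔼-length p xs))) (𝔼-length p xs))
  (solve 2 (λ p l → p :* (con 1ℚ :+ p :* l) :+ (con 1ℚ :- p) :* (p :* l) := p :* (con 1ℚ :+ l)) refl p ⟨ length xs ⟩)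

floor : ∀ {q} → q ≥0 → ∃[ l ] (⟨ l ⟩ ≤ℚ q × q ≤ℚ 1ℚ + ⟨ l ⟩)
floor {q} q≥0 = go (proj₁ (archimedean q)) (proj₂ (archimedean q))
  where
  go : ∀ n → q ≤ℚ ⟨ n ⟩ → ∃[ l ] (⟨ l ⟩ ≤ℚ q × q ≤ℚ 1ℚ + ⟨ l ⟩)
  go zero    h = 0 , q≥0 , ≤-trans h (≤-by 0≤1 refl)
  go (suc n) h with ≤-total q ⟨ n ⟩
  ... | inj₁ p = go n p
  ... | inj₂ p = n , p , h

sq-cancel : ∀ {a b} → b ≥0 → a * a ≤ℚ b * b → a ≤ℚ b
sq-cancel {a} {b} b0 h with <-cmp b a
... | tri≈ _ e _ = ≤-reflexive (sym e)
... | tri> _ _ a<b = <⇒≤ a<b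
... | tri< b<a _ _ = *-cancelˡ a>0 (≤-trans h (*-monoʳ b0 (<⇒≤ b<a)))
  where a>0 = ≤-<-trans b0 b<a

module Sizes (n : ℕ) (5≤n : 5 ≤ n) where

  open CompleteGraph n

  5≤⟨n⟩ : ⟨ 5 ⟩ ≤ℚ ⟨ n ⟩
  5≤⟨n⟩ = ⟨⟩-mono 5≤n

  n≥0 : ⟨ n ⟩ ≥0
  n≥0 = ⟨⟩≥0 n

  3≤D : 3ℚ ≤ℚ D
  3≤D = ≤-by (diff≥0 5≤⟨n⟩) (solve 1 (λ n → n :- con 2ℚ := con 3ℚ :+ (n :- con ⟨ 5 ⟩)) refl ⟨ n ⟩)

  D≥0 : D ≥0
  D≥0 = ≤-trans (nonNegative⁻¹ 3ℚ) 3≤D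

  n≤2D : ⟨ n ⟩ ≤ℚ 2ℚ * D
  n≤2D = ≤-by (+≥0 (diff≥0 5≤⟨n⟩) 0≤1) (solve 1 (λ n → con 2ℚ :* (n :- con 2ℚ) := n :+ (n :- con ⟨ 5 ⟩ :+ con 1ℚ)) refl ⟨ n ⟩)

  N≥0 : N ≥0
  N≥0 = ⟨⟩≥0 (length (pairs n))

  n≤N : ⟨ n ⟩ ≤ℚ N
  n≤N = *-cancelˡ (positive⁻¹ 2ℚ) (≤-by (*≥0 n≥0 (diff≥0 (≤-trans (toWitness {a? = 3ℚ ℚₚ.≤? ⟨ 5 ⟩} _) 5≤⟨n⟩)))
    (trans (solve 2 (λ N n → con 2ℚ :* N := N :+ N :+ n :- n) refl N ⟨ n ⟩) (trans (cong (_- ⟨ n ⟩) N-double)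
      (solve 1 (λ n → n :* n :- n := con 2ℚ :* n :+ n :* (n :- con 3ℚ)) refl ⟨ n ⟩))))

  N≤Tr : N ≤ℚ Tr
  N≤Tr = *-cancelˡ (positive⁻¹ 3ℚ) (subst (3ℚ * N ≤ℚ_) (sym triple-count) (subst (_≤ℚ N * D) (*-comm N 3ℚ) (*-monoˡ N≥0 3≤D)))

  Tr>0 : 0ℚ <ℚ Tr
  Tr>0 = <-≤-trans (<-≤-trans (positive⁻¹ ⟨ 5 ⟩) 5≤⟨n⟩) (≤-trans n≤N N≤Tr)

-- x bounds the proportion of edges left over by the greedy packing; the constants come from y ≤ 1/100 in x² (1 + 2 d (1 - y)) ≤ 1.
PackingBound : ℚ → ℚ → ℕ → Set
PackingBound Δ η n = ∀ {p} → 0ℚ <ℚ p → p ≤ℚ 1ℚ → D * (p * p) ≤ℚ Δ → 1ℚ ≤ℚ ⟨ 12 ⟩ * (D * (p * p)) →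
    ∃[ x ] (x ≥0 × x * x * (⟨ 100 ⟩ + ⟨ 198 ⟩ * (D * (p * p))) ≤ℚ ⟨ 100 ⟩ × N * p * (1ℚ - x - η * 16ℚ) ≤ℚ 3ℚ * 𝔼 p (pairs n) (λ G → ⟨ ν G ⟩))
  where open CompleteGraph n

module _ {Δ : ℚ} (1≤Δ : 1ℚ ≤ℚ Δ) where

  private
    W′ = Δ * (256ℚ * 256ℚ)
    W≥0 : W′ ≥0
    W≥0 = *≥0 (≤-trans 0≤1 1≤Δ) (nonNegative⁻¹ (256ℚ * 256ℚ))
    1≤W : 1ℚ ≤ℚ W′
    1≤W = *-mono {1ℚ} {Δ} {1ℚ} {256ℚ * 256ℚ} 0≤1 0≤1 1≤Δ (toWitness {a? = 1ℚ ℚₚ.≤? 256ℚ * 256ℚ} _)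
    W>0 : 0ℚ <ℚ W′
    W>0 = <-≤-trans 0<1 1≤W
    Δ≤W : Δ ≤ℚ W′
    Δ≤W = subst (_≤ℚ W′) (*-identityʳ Δ) (*-monoˡ (≤-trans 0≤1 1≤Δ) (toWitness {a? = 1ℚ ℚₚ.≤? 256ℚ * 256ℚ} _))
    C′ = 2ℚ + (1ℚ + Δ) * (1ℚ + Δ)
    C>0 : 0ℚ <ℚ C′
    C>0 = <-≤-trans (positive⁻¹ 2ℚ) (≤-by (sq≥0 (1ℚ + Δ)) refl)

  module GreedyPacking {η} (η>0 : 0ℚ <ℚ η) {i} (i≥ : ⟨ 396 ⟩ * W′ ≤ℚ ⟨ i ⟩)
      {ρ} (ρ>0 : 0ℚ <ℚ ρ) (ρ-small : ∀ {p} → p ≤ℚ ρ → Small C′ i η p) {ρ⁻¹} (ρ⁻¹>0 : 0ℚ <ℚ ρ⁻¹) (ρ-inv : ρ⁻¹ * ρ ≡ 1ℚ)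
      {n} (36≤n : 36 ≤ n) (4W≤n : 4ℚ * W′ ≤ℚ ⟨ n ⟩) (n-large : 2ℚ * Δ * (ρ⁻¹ * ρ⁻¹) ≤ℚ ⟨ n ⟩)
      {p} (p>0 : 0ℚ <ℚ p) (p≤1 : p ≤ℚ 1ℚ) (d≤Δ : CompleteGraph.D n * (p * p) ≤ℚ Δ)
      (d≥ : 1ℚ ≤ℚ ⟨ 12 ⟩ * (CompleteGraph.D n * (p * p))) where

    open CompleteGraph n
    open Sizes n (ℕₚ.≤-trans (ℕₚ.m≤m+n 5 31) 36≤n)
    open Packing n using (ν-remove)
    ε-data = inverse Tr>0
    ε = proj₁ ε-data
    ε≥0 : ε ≥0
    ε≥0 = <⇒≤ (proj₁ (proj₂ ε-data))
    Trε : Tr * ε ≡ 1ℚ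
    Trε = trans (*-comm Tr ε) (proj₂ (proj₂ ε-data))
    n≤Tr : ⟨ n ⟩ ≤ℚ Tr
    n≤Tr = ≤-trans n≤N N≤Tr
    ε-small : ∀ {c} → c ≤ℚ Tr → ε * c ≤ℚ 1ℚ
    ε-small {c} h = subst (ε * c ≤ℚ_) (trans (*-comm ε Tr) Trε) (*-monoˡ ε≥0 h)
    4W≤Tr : 4ℚ * W′ ≤ℚ Tr
    4W≤Tr = ≤-trans 4W≤n n≤Tr
    ε4W : ε * (4ℚ * W′) ≤ℚ 1ℚ
    ε4W = ε-small 4W≤Tr
    W≤4W : W′ ≤ℚ 4ℚ * W′
    W≤4W = ≤-by (*≥0 (nonNegative⁻¹ 3ℚ) W≥0) (solve 1 (λ w → con 4ℚ :* w := w :+ con 3ℚ :* w) refl W′)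
    εΔ≤1 : ε * Δ ≤ℚ 1ℚ
    εΔ≤1 = ε-small (≤-trans Δ≤W (≤-trans W≤4W 4W≤Tr))
    ε≤1 : ε ≤ℚ 1ℚ
    ε≤1 = subst (_≤ℚ 1ℚ) (*-identityʳ ε) (ε-small (≤-trans 1≤W (≤-trans W≤4W 4W≤Tr)))
    p≥0 = <⇒≤ p>0
    pp≤p : p * p ≤ℚ p
    pp≤p = subst (p * p ≤ℚ_) (*-identityʳ p) (*-monoˡ p≥0 p≤1)
    -- To show is 1 ≤ Tr p = N D p / 3. Given 1 ≤ 12 D p² this follows from N ≥ 36, whence the
    -- hypothesis `36≤n`.
    ε≤p : ε ≤ℚ p
    ε≤p = subst₂ _≤ℚ_ (*-identityʳ ε) (trans (solve 3 (λ e t p → e :* (t :* p) := t :* e :* p) refl ε Tr p) (trans (cong (_* p) Trε) (*-identityˡ p)))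
      (*-monoˡ ε≥0 (≤-trans d≥ (*-cancelˡ (positive⁻¹ 3ℚ) (≤-trans
        (subst (_≤ℚ N * (D * p)) (*-assoc 3ℚ ⟨ 12 ⟩ (D * (p * p))) (*-mono {a = 3ℚ * ⟨ 12 ⟩} {b = N} (nonNegative⁻¹ (3ℚ * ⟨ 12 ⟩)) (*≥0 D≥0 (*≥0 p≥0 p≥0)) (≤-trans (⟨⟩-mono 36≤n) n≤N) (*-monoˡ D≥0 pp≤p)))
        (≤-reflexive (trans (sym (*-assoc N D p)) (trans (cong (_* p) (sym triple-count)) (*-assoc 3ℚ Tr p))))))))
    -- Bounded d forces p to be small: p² ≤ Δ / D ≤ 2 Δ / n ≤ ρ².
    p≤ρ : p ≤ℚ ρ
    p≤ρ = sq-cancel (<⇒≤ ρ>0) (*-cancelˡ (*>0 ρ⁻¹>0 ρ⁻¹>0) (subst (ρ⁻¹ * ρ⁻¹ * (p * p) ≤ℚ_)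
        (sym (trans (solve 2 (λ a b → a :* a :* (b :* b) := a :* b :* (a :* b)) refl ρ⁻¹ ρ) (cong (λ k → k * k) ρ-inv)))
        (*-cancelˡ 2Δ>0 (≤-trans (≤-trans (≤-reflexive (sym (*-assoc (2ℚ * Δ) (ρ⁻¹ * ρ⁻¹) (p * p)))) (*-monoʳ (*≥0 p≥0 p≥0) (≤-trans n-large n≤2D)))
          (subst₂ _≤ℚ_ (sym (*-assoc 2ℚ D (p * p))) (sym (*-identityʳ (2ℚ * Δ))) (*-monoˡ (nonNegative⁻¹ 2ℚ) d≤Δ))))))
      where 2Δ>0 : 0ℚ <ℚ 2ℚ * Δ
            2Δ>0 = *>0 (positive⁻¹ 2ℚ) (<-≤-trans 0<1 1≤Δ)
    -- The block length l is Tr / (2 W) rounded down, so that l ε W ≤ 1/2 as `blocks` requires.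
    -- Rounding loses at most half, hence l ε ≥ 1 / (4 W), and i ≥ 396 W blocks last for a time R ε
    -- ≥ 99.
    W⁻¹ = inverse (*>0 (positive⁻¹ 2ℚ) W>0)
    w = proj₁ W⁻¹
    q = Tr * w
    l-data = floor {q} (*≥0 (⟨⟩≥0 (length (triples n))) (<⇒≤ (proj₁ (proj₂ W⁻¹))))
    l = proj₁ l-data
    l2W≤Tr : ⟨ l ⟩ * (2ℚ * W′) ≤ℚ Tr
    l2W≤Tr = subst (⟨ l ⟩ * (2ℚ * W′) ≤ℚ_) (trans (*-assoc Tr w (2ℚ * W′)) (trans (cong (Tr *_) (proj₂ (proj₂ W⁻¹))) (*-identityʳ Tr)))
      (*-monoʳ (*≥0 (nonNegative⁻¹ 2ℚ) W≥0) (proj₁ (proj₂ l-data)))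
    Tr≤l : Tr ≤ℚ (1ℚ + ⟨ l ⟩) * (2ℚ * W′)
    Tr≤l = subst (_≤ℚ (1ℚ + ⟨ l ⟩) * (2ℚ * W′)) (trans (*-assoc Tr w (2ℚ * W′)) (trans (cong (Tr *_) (proj₂ (proj₂ W⁻¹))) (*-identityʳ Tr)))
      (*-monoʳ (*≥0 (nonNegative⁻¹ 2ℚ) W≥0) (proj₂ (proj₂ l-data)))
    lεW : ⟨ l ⟩ * (ε * W′) ≤ℚ ½
    lεW = *-cancelˡ (positive⁻¹ 2ℚ) (subst (_≤ℚ 1ℚ) (solve 3 (λ e l w → e :* (l :* (con 2ℚ :* w)) := con 2ℚ :* (l :* (e :* w))) refl ε ⟨ l ⟩ W′) (ε-small l2W≤Tr))
    lε : ⟨ l ⟩ * ε ≤ℚ 1ℚ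
    lε = ≤-trans (≤-trans (*-monoˡ (⟨⟩≥0 l) (subst (_≤ℚ ε * W′) (*-identityʳ ε) (*-monoˡ ε≥0 1≤W))) lεW) (toWitness {a? = ½ ℚₚ.≤? 1ℚ} _)
    1≤4Wlε : 1ℚ ≤ℚ 4ℚ * W′ * (⟨ l ⟩ * ε)
    1≤4Wlε = ≤-by (+≥0 (*≥0 (nonNegative⁻¹ 2ℚ) (*≥0 ε≥0 (diff≥0 Tr≤l))) (diff≥0 ε4W))
      (trans (solve 3 (λ w l e → con 4ℚ :* w :* (l :* e) := con 1ℚ :+ (con 2ℚ :* (e :* ((con 1ℚ :+ l) :* (con 2ℚ :* w)) :- con 1ℚ) :+ (con 1ℚ :- e :* (con 4ℚ :* w)))) refl W′ ⟨ l ⟩ ε)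
        (cong (λ k → 1ℚ + (k + (1ℚ - ε * (4ℚ * W′)))) (trans (cong (λ k → 2ℚ * (ε * ((1ℚ + ⟨ l ⟩) * (2ℚ * W′)) - k)) (sym Trε))
          (solve 3 (λ e x t → con 2ℚ :* (e :* x :- t :* e) := con 2ℚ :* (e :* (x :- t))) refl ε ((1ℚ + ⟨ l ⟩) * (2ℚ * W′)) Tr))))
    R = i ℕ.* l
    99≤Rε : ⟨ 99 ⟩ ≤ℚ ⟨ R ⟩ * ε
    99≤Rε = ≤-trans (subst₂ _≤ℚ_ (*-identityʳ ⟨ 99 ⟩) (solve 3 (λ w l e → con ⟨ 99 ⟩ :* (con 4ℚ :* w :* (l :* e)) := con ⟨ 396 ⟩ :* w :* (l :* e)) refl W′ ⟨ l ⟩ ε)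
        (*-monoˡ (nonNegative⁻¹ ⟨ 99 ⟩) 1≤4Wlε))
      (subst (⟨ 396 ⟩ * W′ * (⟨ l ⟩ * ε) ≤ℚ_) (trans (sym (*-assoc ⟨ i ⟩ ⟨ l ⟩ ε)) (cong (_* ε) (sym (⟨⟩-* i l))))
        (*-monoʳ (*≥0 (⟨⟩≥0 l) ε≥0) i≥))
    module H = Hypergraph (_≟ₑ_ {n}) (pairs n) (triples n) tedges pairs-unique triples-unique tedges-⊆ tedges-unique (λ _ → refl) tedges-linear D D≥0 degree
    module P = H.Process ε≥0 Trε
    open P.Trajectory p>0 p≤1 ε≤1 ε≤p d≤Δ εΔ≤1
    y-small : ⟨ 100 ⟩ * y R ≤ℚ 1ℚ
    y-small = ≤-trans (subst (_≤ℚ y R * (1ℚ + ⟨ R ⟩ * ε)) (*-comm (y R) ⟨ 100 ⟩) (*-monoˡ (y≥0 R) (+-monoʳ-≤ 1ℚ 99≤Rε)))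
      (subst (λ k → k * (1ℚ + ⟨ R ⟩ * ε) ≤ℚ 1ℚ) (sym (y-pow R)) (pow-decay ε≥0 ε≤1 R))
    x-quality : x R * x R * (⟨ 100 ⟩ + ⟨ 198 ⟩ * d) ≤ℚ ⟨ 100 ⟩
    x-quality = ≤-by (+≥0 (*≥0 (nonNegative⁻¹ ⟨ 100 ⟩) (diff≥0 (x-bound R))) (*≥0 (*≥0 (sq≥0 (x R)) (*≥0 (nonNegative⁻¹ 2ℚ) d≥0)) (diff≥0 y-small)))
      (solve 3 (λ x d y → con ⟨ 100 ⟩ := x :* x :* (con ⟨ 100 ⟩ :+ con ⟨ 198 ⟩ :* d) :+ (con ⟨ 100 ⟩ :* (con 1ℚ :- x :* x :* (con 1ℚ :+ con 2ℚ :* (d :* (con 1ℚ :- y))))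
        :+ x :* x :* (con 2ℚ :* d) :* (con 1ℚ :- con ⟨ 100 ⟩ :* y))) refl (x R) d (y R))
    close : Close R η 16ℚ
    close = blocks lε lεW i (<⇒≤ η>0) (ρ-small p≤ρ)
    a≤ : ∀ {e} → e ∈ pairs n → P.a p>0 p≤1 R [ e ] ≤ℚ x R + η * 16ℚ
    a≤ {e} j = ≤-trans (≤-by (diff≥0 (≤-trans (u≤∣u∣ (aR - IR)) (close {[ e ]} ([] ∷ [] , j ∷ []))))
        (solve 3 (λ a i b → i :+ b := a :+ (b :- (a :- i))) refl aR IR (η * 16ℚ ^ℚ 1)))
      (+-mono-≤ (subst (IR ≤ℚ_) (trans (*-identityʳ _) (*-identityʳ (x R))) (*-monoˡ (^≥0 (x≥0 R) 1) (^≤1 (y≥0 R) (y≤1 R) (H.θ [ e ]))))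
        (≤-reflexive (cong (η *_) (*-identityʳ 16ℚ))))
      where
      aR = P.a p>0 p≤1 R [ e ]
      IR = I R 1 (H.θ [ e ])
      u≤∣u∣ : ∀ u → u ≤ℚ ℚ.∣ u ∣
      u≤∣u∣ u = [ (λ h → ≤-reflexive (sym (ℚₚ.0≤p⇒∣p∣≡p h))) , (λ h → ≤-trans h (ℚₚ.0≤∣p∣ u)) ]′ (≤-total 0ℚ u)
    -- Removing a triangle lowers the number of edges by 3 and ν by at least 1, so this potential
    -- does not increase.
    φ : List (Edge n) → ℚ
    φ G = 3ℚ * ⟨ ν G ⟩ - ⟨ length G ⟩
    φ-low : ∀ {U} → H.Valid U → - ⟨ length U ⟩ ≤ℚ φ U
    φ-low {U} _ = ≤-by (*≥0 (nonNegative⁻¹ 3ℚ) (⟨⟩≥0 (ν U))) (solve 2 (λ v l → con 3ℚ :* v :- l := (:- l) :+ con 3ℚ :* v) refl ⟨ ν U ⟩ ⟨ length U ⟩)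
    φ-dec : ∀ {U t} → H.Valid U → t ∈ triples n → tedges t ⊆ U → φ (U ∖ tedges t) ≤ℚ φ U
    φ-dec {U} {t} (u , _) ti s = ≤-by (*≥0 (nonNegative⁻¹ 3ℚ) (diff≥0 (⟨⟩-mono (ν-remove {U} ti s))))
      (trans (cong (λ k → 3ℚ * ⟨ ν U ⟩ - k) (trans (sym (length-∖ U (tedges t))) (cong (⟨ length (U ∖ tedges t) ⟩ +_)
          (trans (∑-∈-comm u (tedges-unique ti)) (trans (∑-cong (tedges t) λ {f} j → 𝟙-yes (f ∈? U) (All.lookup s j)) refl)))))
        (solve 3 (λ v w l → con 3ℚ :* v :- (l :+ con 3ℚ) := con 3ℚ :* w :- l :+ con 3ℚ :* (v :- (con 1ℚ :+ w))) refl ⟨ ν U ⟩ ⟨ ν (U ∖ tedges t) ⟩ ⟨ length (U ∖ tedges t) ⟩))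
    bound : N * p * (1ℚ - x R - η * 16ℚ) ≤ℚ 3ℚ * 𝔼 p (pairs n) (λ G → ⟨ ν G ⟩)
    bound = ≤-by (+≥0 (diff≥0 (P.greedy p>0 p≤1 R φ (λ {U} → φ-low {U}) (λ {U} {t} → φ-dec {U} {t}))) (diff≥0 sum≤))
      (trans (solve 6 (λ N p x h E S → E := N :* p :* (con 1ℚ :- x :- h) :+ (E :- p :* N :- (:- S) :+ (N :* (p :* (x :+ h)) :- S))) refl N p (x R) (η * 16ℚ) (3ℚ * 𝔼 p (pairs n) (λ G → ⟨ ν G ⟩)) (∑[ e ∈ pairs n ] p * P.a p>0 p≤1 R [ e ]))
        (cong (λ k → N * p * (1ℚ - x R - η * 16ℚ) + (k - (- (∑[ e ∈ pairs n ] p * P.a p>0 p≤1 R [ e ])) + (N * (p * (x R + η * 16ℚ)) - (∑[ e ∈ pairs n ] p * P.a p>0 p≤1 R [ e ]))))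
          (sym (trans (𝔼-- p (pairs n) _ _) (cong₂ _-_ (𝔼-* p (pairs n) 3ℚ (λ G → ⟨ ν G ⟩)) (𝔼-length p (pairs n)))))))
      where
      sum≤ : ∑[ e ∈ pairs n ] p * P.a p>0 p≤1 R [ e ] ≤ℚ N * (p * (x R + η * 16ℚ))
      sum≤ = subst (∑[ e ∈ pairs n ] p * P.a p>0 p≤1 R [ e ] ≤ℚ_) (∑-const (pairs n) (p * (x R + η * 16ℚ))) (∑-mono (pairs n) λ j → *-monoˡ p≥0 (a≤ j))

    result : ∃[ x ] (x ≥0 × x * x * (⟨ 100 ⟩ + ⟨ 198 ⟩ * (D * (p * p))) ≤ℚ ⟨ 100 ⟩ × N * p * (1ℚ - x - η * 16ℚ) ≤ℚ 3ℚ * 𝔼 p (pairs n) (λ G → ⟨ ν G ⟩))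
    result = x R , x≥0 R , x-quality , bound

  -- The order of choices matters: i depends on Δ, then ρ on i and η, and finally n on all of them.
  -- None depends on p.
  packing-lower : ∀ {η} → 0ℚ <ℚ η → ∃[ n₀ ] (∀ n → n₀ ≤ n → PackingBound Δ η n)
  packing-lower {η} η>0 = 36 ℕ.+ (proj₁ n₁ ℕ.+ proj₁ n₂) , λ n n≥ p>0 p≤1 d≤Δ d≥ →
      GreedyPacking.result η>0 (proj₂ i) ρ>0 (proj₂ (proj₂ ρ)) (proj₁ (proj₂ ρ⁻¹)) (proj₂ (proj₂ ρ⁻¹))
        (ℕₚ.≤-trans (ℕₚ.m≤m+n 36 _) n≥)
        (≤-trans (proj₂ n₁) (⟨⟩-mono (ℕₚ.≤-trans (ℕₚ.≤-trans (ℕₚ.m≤m+n (proj₁ n₁) (proj₁ n₂)) (ℕₚ.m≤n+m (proj₁ n₁ ℕ.+ proj₁ n₂) 36)) n≥)))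
        (≤-trans (proj₂ n₂) (⟨⟩-mono (ℕₚ.≤-trans (ℕₚ.≤-trans (ℕₚ.m≤n+m (proj₁ n₂) (proj₁ n₁)) (ℕₚ.m≤n+m (proj₁ n₁ ℕ.+ proj₁ n₂) 36)) n≥)))
        p>0 p≤1 d≤Δ d≥
    where
    i = archimedean (⟨ 396 ⟩ * W′)
    ρ = small C>0 (proj₁ i) η>0
    ρ>0 = proj₁ (proj₂ ρ)
    ρ⁻¹ = inverse ρ>0
    n₁ = archimedean (4ℚ * W′)
    n₂ = archimedean (2ℚ * Δ * (proj₁ ρ⁻¹ * proj₁ ρ⁻¹))

-- Expected cover number from a balanced cut

∏ : ∀ {A : Set} → List A → (A → ℚ) → ℚ
∏ []       f = 1ℚ
∏ (x ∷ xs) f = f x * ∏ xs f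

module _ {A : Set} where

  ∏-cong : ∀ xs {f g : A → ℚ} → (∀ {x} → x ∈ xs → f x ≡ g x) → ∏ xs f ≡ ∏ xs g
  ∏-cong []       h = refl
  ∏-cong (x ∷ xs) h = cong₂ _*_ (h (here refl)) (∏-cong xs (h ∘ there))

  𝟙-All : ∀ {P : A → Set} (P? : ∀ x → Dec (P x)) xs → 𝟙 (All.all? P? xs) ≡ ∏ xs (λ x → 𝟙 (P? x))
  𝟙-All P? []       = refl
  𝟙-All P? (x ∷ xs) = trans (𝟙-cong (All.all? P? (x ∷ xs)) (P? x ×-dec All.all? P? xs) (λ { (a ∷ b) → a , b }) (λ (a , b) → a ∷ b))
    (trans (𝟙-× (P? x) (All.all? P? xs)) (cong (𝟙 (P? x) *_) (𝟙-All P? xs)))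

module Independence {A : Set} (_≟_ : DecidableEquality A) where

  open Containment _≟_

  χ-++ : ∀ S T G → χ (T ++ S) G ≡ χ S G * χ T G
  χ-++ S T G = trans (𝟙-cong ((T ++ S) ⊆? G) ((S ⊆? G) ×-dec (T ⊆? G)) (λ h → Allₚ.++⁻ʳ T h , Allₚ.++⁻ˡ T h) (λ (a , b) → Allₚ.++⁺ b a))
    (𝟙-× (S ⊆? G) (T ⊆? G))

  -- Independence of the factors reduces to 𝔼-χ, each factor being a linear combination of indicators χ.
  𝔼-factors : ∀ {B K : Set} p {xs} → Unique xs → (ks : List K) (c : K → ℚ) (len : K → ℕ) (part : K → B → List A) →
    ∀ {ws} → Unique ws →
    (∀ {k w} → k ∈ ks → w ∈ ws → Unique (part k w) × part k w ⊆ xs × length (part k w) ≡ len k) →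
    (∀ {k k′ w w′ x} → k ∈ ks → k′ ∈ ks → w ∈ ws → w′ ∈ ws → x ∈ part k w → x ∈ part k′ w′ → w ≡ w′) →
    ∀ {S} → Unique S → S ⊆ xs → (∀ {k w x} → k ∈ ks → w ∈ ws → x ∈ part k w → x ∉ S) →
    𝔼 p xs (λ G → χ S G * ∏ ws (λ w → ∑[ k ∈ ks ] c k * χ (part k w) G)) ≡
    p ^ℚ length S * (∑[ k ∈ ks ] c k * p ^ℚ len k) ^ℚ length ws
  𝔼-factors p {xs} ux ks c len part {[]} _ ok dis {S} uS s away =
    trans (𝔼-cong p xs λ {G} _ → *-identityʳ (χ S G)) (trans (𝔼-χ p ux uS s) (sym (*-identityʳ _)))
  𝔼-factors p {xs} ux ks c len part {w ∷ ws} (w∉ ∷ uw) ok dis {S} uS s away = trans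
    (𝔼-cong p xs λ {G} _ → trans (solve 3 (λ a b d → a :* (b :* d) := b :* (a :* d)) refl (χ S G) (∑[ k ∈ ks ] c k * χ (part k w) G) (rest G))
      (trans (sym (∑-*ʳ ks (χ S G * rest G) _)) (∑-cong ks λ {k} _ →
        trans (solve 4 (λ c t s r → c :* t :* (s :* r) := c :* (s :* t :* r)) refl (c k) (χ (part k w) G) (χ S G) (rest G))
          (cong (λ z → c k * (z * rest G)) (sym (χ-++ S (part k w) G))))))
    (trans (𝔼-∑ p xs ks _) (trans (∑-cong ks λ {k} i → trans (𝔼-* p xs (c k) _) (trans (cong (c k *_) (ih i))
        (solve 4 (λ c l m r → c :* (l :* m :* r) := c :* l :* (m :* r)) refl (c k) (p ^ℚ len k) (p ^ℚ length S) (ratio ^ℚ length ws))))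
      (trans (∑-*ʳ ks (p ^ℚ length S * ratio ^ℚ length ws) _)
        (solve 3 (λ q m r → q :* (m :* r) := m :* (q :* r)) refl ratio (p ^ℚ length S) (ratio ^ℚ length ws)))))
    where
    ratio = ∑[ k ∈ ks ] c k * p ^ℚ len k
    rest : List A → ℚ
    rest G = ∏ ws (λ w → ∑[ k ∈ ks ] c k * χ (part k w) G)
    -- The part chosen for `w` joins S; this is why the statement carries a general S disjoint from
    -- all parts.
    ih : ∀ {k} → k ∈ ks → 𝔼 p xs (λ G → χ (part k w ++ S) G * rest G) ≡ p ^ℚ len k * p ^ℚ length S * ratio ^ℚ length ws
    ih {k} i = let u , t , l = ok {k} {w} i (here refl) in trans
      (𝔼-factors p ux ks c len part uw (λ i j → ok i (there j)) (λ q q′ j j′ → dis q q′ (there j) (there j′))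
        (Uniqueₚ.++⁺ u uS (λ (a , b) → away i (here refl) a b)) (Allₚ.++⁺ t s)
        (λ {k′} {w′} q j a b → [ (λ b′ → All.lookup w∉ j (dis i q (here refl) (there j) b′ a)) , away q (there j) a ]′ (∈-++⁻ (part k w) b)))
      (cong (_* ratio ^ℚ length ws) (trans (cong (p ^ℚ_) (trans (Listₚ.length-++ (part k w)) (cong (ℕ._+ length S) l))) (^-+ p (len k) (length S))))

∑-allFin-< : ∀ n h → h ≤ n → ∑[ i ∈ allFin n ] 𝟙 (toℕ i ℕ.<? h) ≡ ⟨ h ⟩
∑-allFin-< n zero h≤n = trans (∑-cong (allFin n) λ {i} _ → 𝟙-no (toℕ i ℕ.<? 0) λ ()) (∑-0 (allFin n))
∑-allFin-< (suc n) (suc h) (s≤s h≤n) = cong (1ℚ +_) (trans (cong (λ l → ∑[ i ∈ l ] 𝟙 (toℕ i ℕ.<? suc h)) (sym (Listₚ.map-tabulate {n = n} id Fin.suc)))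
  (trans (∑-map Fin.suc (allFin n) _) (trans (∑-cong (allFin n) λ {i} _ → 𝟙-cong (suc (toℕ i) ℕ.<? suc h) (toℕ i ℕ.<? h) ℕ.s≤s⁻¹ s≤s) (∑-allFin-< n h h≤n))))

module Cut (n h : ℕ) (h≤n : h ≤ n) where

  open CompleteGraph n
  open Packing n
  open Independence (_≟ₑ_ {n})

  side : Fin n → Bool
  side i = does (toℕ i ℕ.<? h)

  opposite : Bool → List (Fin n)
  opposite b = filter (λ w → ¬? (side w ≟ᵇ b)) (allFin n)

  ∈-opposite⁻ : ∀ {b w} → w ∈ opposite b → side w ≢ b
  ∈-opposite⁻ {b} i = proj₂ (∈-filter⁻ (λ w → ¬? (side w ≟ᵇ b)) {xs = allFin n} i)

  ∈-opposite⁺ : ∀ {b w} → side w ≢ b → w ∈ opposite b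
  ∈-opposite⁺ {b} h = ∈-filter⁺ (λ w → ¬? (side w ≟ᵇ b)) (∈-allFin _) h

  opposite-unique : ∀ b → Unique (opposite b)
  opposite-unique b = Uniqueₚ.filter⁺ (λ w → ¬? (side w ≟ᵇ b)) (Uniqueₚ.allFin⁺ n)

  link : Fin n → Fin n → Edge n
  link i w = if does (i Fin.<? w) then (i , w) else (w , i)

  link-< : ∀ {i w} → i Fin.< w → link i w ≡ (i , w)
  link-< {i} {w} h = cong (if_then (i , w) else (w , i)) (dec-true (i Fin.<? w) h)

  link-> : ∀ {i w} → w Fin.< i → link i w ≡ (w , i)
  link-> {i} {w} h = cong (if_then (i , w) else (w , i)) (dec-false (i Fin.<? w) λ g → Finₚ.<-asym {x = i} {w} g h)

  link-cases : ∀ i w → link i w ≡ (i , w) ⊎ link i w ≡ (w , i)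
  link-cases i w with does (i Fin.<? w)
  ... | true  = inj₁ refl
  ... | false = inj₂ refl

  link-∈ : ∀ {i w} → side w ≢ side i → link i w ∈ pairs n
  link-∈ {i} {w} ne with Finₚ.<-cmp i w
  ... | tri< a _ _ = subst (_∈ pairs n) (sym (link-< a)) (∈-pairs⁺ a)
  ... | tri≈ _ refl _ = contradiction refl ne
  ... | tri> _ _ c = subst (_∈ pairs n) (sym (link-> c)) (∈-pairs⁺ c)

  -- The sides of the endpoints tell which of them is i and which is w.
  link-injective : ∀ {i w i′ w′ b} → side i ≡ b → side i′ ≡ b → side w ≢ b → side w′ ≢ b → link i w ≡ link i′ w′ → i ≡ i′ × w ≡ w′
  link-injective {i} {w} {i′} {w′} a a′ c c′ e with link-cases i w | link-cases i′ w′
  ... | inj₁ x | inj₁ y with trans (sym x) (trans e y)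
  ...   | refl = refl , refl
  link-injective a a′ c c′ e | inj₂ x | inj₂ y with trans (sym x) (trans e y)
  ...   | refl = refl , refl
  link-injective a a′ c c′ e | inj₁ x | inj₂ y with trans (sym x) (trans e y)
  ...   | refl = contradiction a c′
  link-injective a a′ c c′ e | inj₂ x | inj₁ y with trans (sym x) (trans e y)
  ...   | refl = contradiction a′ c

  Mono : Edge n → Set
  Mono (i , j) = side i ≡ side j

  mono? : ∀ e → Dec (Mono e)
  mono? (i , j) = side i ≟ᵇ side j

  wedge : Edge n → Fin n → Graph
  wedge (i , j) w = link i w ∷ link j w ∷ []

  -- For an uncut edge: its ends have no common neighbour across the cut. As a conjunction over the
  -- vertices on the other side, the event factors.
  Private : Graph → Edge n → Set
  Private G e = All (λ w → ¬ (wedge e w ⊆ G)) (opposite (side (proj₁ e)))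

  private? : ∀ G e → Dec (Private G e)
  private? G e = All.all? (λ w → ¬? (wedge e w ⊆? G)) (opposite (side (proj₁ e)))

  Mono₃ : Triple n → Set
  Mono₃ (i , j , k) = side i ≡ side j × side j ≡ side k

  mono₃? : ∀ t → Dec (Mono₃ t)
  mono₃? (i , j , k) = (side i ≟ᵇ side j) ×-dec (side j ≟ᵇ side k)

  crossed? : ∀ G e → Dec (Mono e × ¬ Private G e)
  crossed? G e = mono? e ×-dec ¬? (private? G e)

  isolated? : ∀ G t → Dec (Mono₃ t × All (Private G) (tedges t))
  isolated? G t = mono₃? t ×-dec All.all? (private? G) (tedges t)

  first : Triple n → Edge n
  first (i , j , k) = i , j

  cover₁ cover₂ : Graph → Graph
  cover₁ G = filter (λ e → (e ∈? G) ×-dec crossed? G e) (pairs n)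
  cover₂ G = map first (filter (isolated? G) (triangles G))

  not-private : ∀ {G e w} → Mono e → side w ≢ side (proj₁ e) → wedge e w ⊆ G → ¬ Private G e
  not-private m ne s pr = All.lookup pr (∈-opposite⁺ ne) s

  pigeon : ∀ (x y z : Bool) → x ≢ y → y ≢ z → ¬ (x ≢ z)
  pigeon true  true  _     a b c = a refl
  pigeon false false _     a b c = a refl
  pigeon true  false true  a b c = c refl
  pigeon true  false false a b c = b refl
  pigeon false true  true  a b c = b refl
  pigeon false true  false a b c = c refl

  -- A cut triangle has exactly one uncut edge, and its third vertex puts that edge into `cover₁`.
  -- An uncut triangle has an edge in `cover₁`, or else all its edges are private and its first one
  -- is in `cover₂`.
  covers : ∀ G → Covers G (cover₁ G ++ cover₂ G)
  covers G = All.tabulate λ {t} i → go t i (∈-triples⁻ (proj₁ (∈-triangles⁻ {G} i))) (proj₂ (∈-triangles⁻ {G} i))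
    where
    Hit : Triple n → Set
    Hit t = Any (λ e → Any (e ≡_) (cover₁ G ++ cover₂ G)) (tedges t)
    go : ∀ t → t ∈ triangles G → Sorted t → tedges t ⊆ G → Hit t
    go t@(i , j , k) ti (ij , jk) s@(eij ∷ eik ∷ ejk ∷ []) = sides (side i ≟ᵇ side j) (side j ≟ᵇ side k) (side i ≟ᵇ side k)
      where
      hit : ∀ {e} → e ∈ tedges t → Mono e → ¬ Private G e → Hit t
      hit e∈ m np = lose e∈ (∈-++⁺ˡ (∈-filter⁺ (λ e → (e ∈? G) ×-dec crossed? G e) (All.lookup (tedges-⊆ (proj₁ (∈-triangles⁻ {G} ti))) e∈) (All.lookup s e∈ , m , np)))
      inside : side i ≡ side j → side j ≡ side k → Dec (All (Private G) (tedges t)) → Hit t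
      inside a b (yes pr) = here (∈-++⁺ʳ (cover₁ G) (∈-map⁺ first (∈-filter⁺ (isolated? G) ti ((a , b) , pr))))
      inside a b (no ¬pr) with Allₚ.¬All⇒Any¬ (private? G) (tedges t) ¬pr
      ... | here np = hit (here refl) a np
      ... | there (here np) = hit (there (here refl)) (trans a b) np
      ... | there (there (here np)) = hit (there (there (here refl))) b np
      sides : Dec (side i ≡ side j) → Dec (side j ≡ side k) → Dec (side i ≡ side k) → Hit t
      sides (no a)  (no b)  (no c)  = contradiction c (pigeon (side i) (side j) (side k) a b)
      sides (yes a) (yes b) _       = inside a b (All.all? (private? G) (tedges t))
      sides (yes a) (no b)  _       = hit (here refl) a (not-private {G} {i , j} {k} a (λ e → b (trans (sym a) (sym e)))
        (subst (_∈ G) (sym (link-< (Finₚ.<-trans ij jk))) eik ∷ subst (_∈ G) (sym (link-< jk)) ejk ∷ []))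
      sides (no a)  (yes b) _       = hit (there (there (here refl))) b (not-private {G} {j , k} {i} b a
        (subst (_∈ G) (sym (link-> ij)) eij ∷ subst (_∈ G) (sym (link-> (Finₚ.<-trans ij jk))) eik ∷ []))
      sides (no a)  (no b)  (yes c) = hit (there (here refl)) c (not-private {G} {i , k} {j} c (a ∘ sym)
        (subst (_∈ G) (sym (link-< ij)) eij ∷ subst (_∈ G) (sym (link-> jk)) ejk ∷ []))

  τ≤cover : ∀ {G} → Unique G → ⟨ τ G ⟩ ≤ℚ ⟨ length (cover₁ G) ⟩ + ⟨ length (cover₂ G) ⟩
  τ≤cover {G} u = subst (⟨ τ G ⟩ ≤ℚ_) (trans (cong ⟨_⟩ (Listₚ.length-++ (cover₁ G))) (⟨⟩-+ (length (cover₁ G)) _)) (⟨⟩-mono (τ-upper u (covers G)))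

  -- A polynomial in the indicators of the edges at one vertex w: each monomial is a coefficient
  -- with the list of other endpoints.
  Combination : Set
  Combination = List (ℚ × List (Fin n))

  value : Combination → Fin n → Graph → ℚ
  value ks w G = ∑[ k ∈ ks ] proj₁ k * χ (map (λ a → link a w) (proj₂ k)) G

  -- Cut edges with different ends w are distinct, and none of them lies in S, whose edges are
  -- uncut; so the factors are independent of each other and of S.
  𝔼-value : ∀ p b ks → All (λ k → Unique (proj₂ k) × All (λ a → side a ≡ b) (proj₂ k)) ks →
    ∀ {S} → Unique S → S ⊆ pairs n → All (λ e → side (proj₁ e) ≡ b × side (proj₂ e) ≡ b) S →
    𝔼 p (pairs n) (λ G → χ S G * ∏ (opposite b) (λ w → value ks w G)) ≡
    p ^ℚ length S * (∑[ k ∈ ks ] proj₁ k * p ^ℚ length (proj₂ k)) ^ℚ length (opposite b)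
  𝔼-value p b ks ok {S} u s ends = 𝔼-factors p pairs-unique ks proj₁ (length ∘ proj₂) (λ k w → map (λ a → link a w) (proj₂ k))
      (opposite-unique b) valid disjoint u s away
    where
    end : ∀ {k w x} → k ∈ ks → x ∈ map (λ a → link a w) (proj₂ k) → ∃[ a ] (side a ≡ b × x ≡ link a w)
    end {k} {w} i j with ∈-map⁻ (λ a → link a w) j
    ... | a , a∈ , e = a , All.lookup (proj₂ (All.lookup ok i)) a∈ , e
    valid : ∀ {k w} → k ∈ ks → w ∈ opposite b → let P = map (λ a → link a w) (proj₂ k) in Unique P × P ⊆ pairs n × length P ≡ length (proj₂ k)
    valid {k} {w} i j = distinct (proj₂ k) (proj₁ (All.lookup ok i)) (proj₂ (All.lookup ok i)) ,
        All.tabulate (λ q → let a , sa , e = end {k} i q in subst (_∈ pairs n) (sym e) (link-∈ (λ f → ∈-opposite⁻ j (trans f sa)))) ,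
        Listₚ.length-map (λ a → link a w) (proj₂ k)
      where
      distinct : ∀ as → Unique as → All (λ a → side a ≡ b) as → Unique (map (λ a → link a w) as)
      distinct [] _ _ = []
      distinct (a ∷ as) (ne ∷ u) (sa ∷ sas) = Allₚ.map⁺ (All.map (λ (x , y) e →
        x (proj₁ (link-injective sa y (∈-opposite⁻ j) (∈-opposite⁻ j) e))) (All.zip (ne , sas))) ∷ distinct as u sas
    disjoint : ∀ {k k′ w w′ x} → k ∈ ks → k′ ∈ ks → w ∈ opposite b → w′ ∈ opposite b →
               x ∈ map (λ a → link a w) (proj₂ k) → x ∈ map (λ a → link a w′) (proj₂ k′) → w ≡ w′
    disjoint {k} {k′} i i′ j j′ q q′ = let a , sa , e = end {k} i q ; a′ , sa′ , e′ = end {k′} i′ q′ in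
      proj₂ (link-injective sa sa′ (∈-opposite⁻ j) (∈-opposite⁻ j′) (trans (sym e) e′))
    away : ∀ {k w x} → k ∈ ks → w ∈ opposite b → x ∈ map (λ a → link a w) (proj₂ k) → x ∉ S
    away {k} {w} i j q x∈S with end {k} i q | All.lookup ends x∈S
    ... | a , sa , refl | s₁ , s₂ with link-cases a w
    ...   | inj₁ e = ∈-opposite⁻ j (trans (cong (side ∘ proj₂) (sym e)) s₂)
    ...   | inj₂ e = ∈-opposite⁻ j (trans (cong (side ∘ proj₁) (sym e)) s₁)

  χ-∷ : ∀ x S G → χ (x ∷ S) G ≡ 𝟙 (x ∈? G) * χ S G
  χ-∷ x S G = trans (𝟙-cong ((x ∷ S) ⊆? G) ((x ∈? G) ×-dec (S ⊆? G)) (λ { (a ∷ b) → a , b }) (λ (a , b) → a ∷ b)) (𝟙-× (x ∈? G) (S ⊆? G))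

  χ₂ : ∀ x y G → χ (x ∷ y ∷ []) G ≡ 𝟙 (x ∈? G) * (𝟙 (y ∈? G) * 1ℚ)
  χ₂ x y G = trans (χ-∷ x (y ∷ []) G) (cong (𝟙 (x ∈? G) *_) (χ-∷ y [] G))

  χ₃ : ∀ x y z G → χ (x ∷ y ∷ z ∷ []) G ≡ 𝟙 (x ∈? G) * (𝟙 (y ∈? G) * (𝟙 (z ∈? G) * 1ℚ))
  χ₃ x y z G = trans (χ-∷ x (y ∷ z ∷ []) G) (cong (𝟙 (x ∈? G) *_) (χ₂ y z G))

  edge-factors : Edge n → Combination
  edge-factors (i , j) = (1ℚ , []) ∷ (- 1ℚ , i ∷ j ∷ []) ∷ []

  𝟙-private : ∀ G e → 𝟙 (private? G e) ≡ ∏ (opposite (side (proj₁ e))) (λ w → value (edge-factors e) w G)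
  𝟙-private G e = trans (𝟙-All (λ w → ¬? (wedge e w ⊆? G)) (opposite (side (proj₁ e)))) (∏-cong (opposite (side (proj₁ e))) λ {w} _ →
    trans (𝟙-¬ (wedge e w ⊆? G)) (solve 1 (λ x → con 1ℚ :- x := con 1ℚ :* con 1ℚ :+ (con (- 1ℚ) :* x :+ con 0ℚ)) refl (χ (wedge e w) G)))

  -- Expansion of (1 - x y) (1 - x z) (1 - y z) for x, y, z equal to 0 or 1: the indicator that w is
  -- joined to at most one of i, j, k.
  triple-factors : Triple n → Combination
  triple-factors (i , j , k) =
    (1ℚ , []) ∷ (- 1ℚ , i ∷ j ∷ []) ∷ (- 1ℚ , i ∷ k ∷ []) ∷ (- 1ℚ , j ∷ k ∷ []) ∷ (2ℚ , i ∷ j ∷ k ∷ []) ∷ []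

  𝟙-isolated : ∀ G t → Mono₃ t → 𝟙 (All.all? (private? G) (tedges t)) ≡ ∏ (opposite (side (proj₁ t))) (λ w → value (triple-factors t) w G)
  𝟙-isolated G t@(i , j , k) (a , b) = trans
      (𝟙-cong (All.all? (private? G) (tedges t)) (All.all? none? O) to from)
      (trans (𝟙-All none? O) (∏-cong O λ {w} _ → factor w))
    where
    O = opposite (side i)
    None : Fin n → Set
    None w = ¬ (wedge (i , j) w ⊆ G) × (¬ (wedge (i , k) w ⊆ G) × ¬ (wedge (j , k) w ⊆ G))
    none? : ∀ w → Dec (None w)
    none? w = ¬? (wedge (i , j) w ⊆? G) ×-dec (¬? (wedge (i , k) w ⊆? G) ×-dec ¬? (wedge (j , k) w ⊆? G))
    to : All (Private G) (tedges t) → All None O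
    to (x ∷ y ∷ z ∷ []) = All.zip (x , All.zip (y , subst (λ c → All (λ w → ¬ (wedge (j , k) w ⊆ G)) (opposite c)) (sym a) z))
    from : All None O → All (Private G) (tedges t)
    from h = All.map proj₁ h ∷ All.map (proj₁ ∘ proj₂) h ∷
      subst (λ c → All (λ w → ¬ (wedge (j , k) w ⊆ G)) (opposite c)) a (All.map (proj₂ ∘ proj₂) h) ∷ []
    boolean : ∀ {P Q R : Set} (x : Dec P) (y : Dec Q) (z : Dec R) →
      (1ℚ - 𝟙 x * (𝟙 y * 1ℚ)) * ((1ℚ - 𝟙 x * (𝟙 z * 1ℚ)) * (1ℚ - 𝟙 y * (𝟙 z * 1ℚ))) ≡
      1ℚ * 1ℚ + (- 1ℚ * (𝟙 x * (𝟙 y * 1ℚ)) + (- 1ℚ * (𝟙 x * (𝟙 z * 1ℚ)) + (- 1ℚ * (𝟙 y * (𝟙 z * 1ℚ)) + (2ℚ * (𝟙 x * (𝟙 y * (𝟙 z * 1ℚ))) + 0ℚ))))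
    boolean (yes _) (yes _) (yes _) = refl
    boolean (yes _) (yes _) (no _)  = refl
    boolean (yes _) (no _)  (yes _) = refl
    boolean (yes _) (no _)  (no _)  = refl
    boolean (no _)  (yes _) (yes _) = refl
    boolean (no _)  (yes _) (no _)  = refl
    boolean (no _)  (no _)  (yes _) = refl
    boolean (no _)  (no _)  (no _)  = refl
    cong₄ : ∀ {x x′ y y′ z z′ w w′ : ℚ} → x ≡ x′ → y ≡ y′ → z ≡ z′ → w ≡ w′ →
      1ℚ * 1ℚ + (- 1ℚ * x + (- 1ℚ * y + (- 1ℚ * z + (2ℚ * w + 0ℚ)))) ≡ 1ℚ * 1ℚ + (- 1ℚ * x′ + (- 1ℚ * y′ + (- 1ℚ * z′ + (2ℚ * w′ + 0ℚ))))
    cong₄ refl refl refl refl = refl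
    factor : ∀ w → 𝟙 (none? w) ≡ value (triple-factors t) w G
    factor w = trans (trans (𝟙-× (¬? (wedge (i , j) w ⊆? G)) (¬? (wedge (i , k) w ⊆? G) ×-dec ¬? (wedge (j , k) w ⊆? G))) (cong₂ _*_ (neg i j) (trans (𝟙-× (¬? (wedge (i , k) w ⊆? G)) (¬? (wedge (j , k) w ⊆? G))) (cong₂ _*_ (neg i k) (neg j k)))))
      (trans (boolean (link i w ∈? G) (link j w ∈? G) (link k w ∈? G))
        (sym (cong₄ (χ₂ (link i w) (link j w) G) (χ₂ (link i w) (link k w) G) (χ₂ (link j w) (link k w) G) (χ₃ (link i w) (link j w) (link k w) G))))
      where neg : ∀ x y → 𝟙 (¬? (wedge (x , y) w ⊆? G)) ≡ 1ℚ - 𝟙 (link x w ∈? G) * (𝟙 (link y w ∈? G) * 1ℚ)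
            neg x y = trans (𝟙-¬ (wedge (x , y) w ⊆? G)) (cong (λ z → 1ℚ - z) (χ₂ (link x w) (link y w) G))

  σ : Fin n → ℚ
  σ i = 𝟙 (toℕ i ℕ.<? h)

  ∑σ : ∑ (allFin n) σ ≡ ⟨ h ⟩
  ∑σ = ∑-allFin-< n h h≤n

  ∑1-σ : ∑ (allFin n) (λ i → 1ℚ - σ i) ≡ ⟨ n ⟩ - ⟨ h ⟩
  ∑1-σ = trans (∑-cong (allFin n) λ {i} _ → solve 1 (λ x → con 1ℚ :- x := con 1ℚ :+ con (- 1ℚ) :* x) refl (σ i))
    (trans (∑-+ (allFin n) (λ _ → 1ℚ) _) (trans (cong₂ _+_ ∑-V-1 (trans (∑-*ˡ (allFin n) (- 1ℚ) σ) (cong (- 1ℚ *_) ∑σ)))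
      (solve 2 (λ n h → n :+ con (- 1ℚ) :* h := n :- h) refl ⟨ n ⟩ ⟨ h ⟩)))

  same-side : ∀ {P Q : Set} (x : Dec P) (y : Dec Q) → 𝟙 (does x ≟ᵇ does y) ≡ 𝟙 x * 𝟙 y + (1ℚ - 𝟙 x) * (1ℚ - 𝟙 y)
  same-side (yes _) (yes _) = refl
  same-side (yes _) (no _)  = refl
  same-side (no _)  (yes _) = refl
  same-side (no _)  (no _)  = refl

  monos : ℚ
  monos = ∑[ e ∈ pairs n ] 𝟙 (mono? e)

  -- Ordered pairs of vertices on the same side, the diagonal included, counted in two ways.
  2monos : monos + monos + ⟨ n ⟩ ≡ ⟨ h ⟩ * ⟨ h ⟩ + (⟨ n ⟩ - ⟨ h ⟩) * (⟨ n ⟩ - ⟨ h ⟩)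
  2monos = trans (cong₂ _+_ (cong₂ _+_ as-sum (trans as-sum (∑-swap V V _))) (trans (sym ∑-V-1) (∑-cong V λ {i} _ → sym (∑-Fin-≟ i))))
      (trans (sym (trans (∑-cong V λ _ → ∑-+₃ V _ _ _) (∑-+₃ V _ _ _)))
      (trans (∑-cong V λ {i} _ → ∑-cong V λ {j} _ → cases i j)
      (trans (trans (∑-cong V λ _ → ∑-+ V _ _) (∑-+ V _ _)) (cong₂ _+_
        (trans (sym (∑-*-∑ V V σ σ)) (cong₂ _*_ ∑σ ∑σ)) (trans (sym (∑-*-∑ V V (λ i → 1ℚ - σ i) (λ i → 1ℚ - σ i))) (cong₂ _*_ ∑1-σ ∑1-σ))))))
    where
    V = allFin n
    as-sum : monos ≡ ∑[ i ∈ V ] ∑[ j ∈ V ] 𝟙 (i Fin.<? j) * 𝟙 (side i ≟ᵇ side j)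
    as-sum = ∑-pairs (λ e → 𝟙 (mono? e))
    cases : ∀ (i j : Fin n) → 𝟙 (i Fin.<? j) * 𝟙 (side i ≟ᵇ side j) + 𝟙 (j Fin.<? i) * 𝟙 (side j ≟ᵇ side i) + 𝟙 (i Fin.≟ j) ≡ σ i * σ j + (1ℚ - σ i) * (1ℚ - σ j)
    cases i j = trans (go (Finₚ.<-cmp i j)) (same-side (toℕ i ℕ.<? h) (toℕ j ℕ.<? h))
      where
      flip : 𝟙 (side j ≟ᵇ side i) ≡ 𝟙 (side i ≟ᵇ side j)
      flip = 𝟙-cong (side j ≟ᵇ side i) (side i ≟ᵇ side j) sym sym
      three : ∀ {x y z w v u} → x ≡ u → y ≡ v → z ≡ w → x * 𝟙 (side i ≟ᵇ side j) + y * 𝟙 (side j ≟ᵇ side i) + z ≡ u * 𝟙 (side i ≟ᵇ side j) + v * 𝟙 (side i ≟ᵇ side j) + w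
      three {x} {y} {z} refl refl refl = cong (λ s → x * 𝟙 (side i ≟ᵇ side j) + y * s + z) flip
      m = 𝟙 (side i ≟ᵇ side j)
      go : _ → 𝟙 (i Fin.<? j) * 𝟙 (side i ≟ᵇ side j) + 𝟙 (j Fin.<? i) * 𝟙 (side j ≟ᵇ side i) + 𝟙 (i Fin.≟ j) ≡ m
      go (tri< a b c) = trans (three (𝟙-yes (i Fin.<? j) a) (𝟙-no (j Fin.<? i) c) (𝟙-no (i Fin.≟ j) b)) (solve 1 (λ m → con 1ℚ :* m :+ con 0ℚ :* m :+ con 0ℚ := m) refl m)
      go (tri> a b c) = trans (three (𝟙-no (i Fin.<? j) a) (𝟙-yes (j Fin.<? i) c) (𝟙-no (i Fin.≟ j) b)) (solve 1 (λ m → con 0ℚ :* m :+ con 1ℚ :* m :+ con 0ℚ := m) refl m)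
      go (tri≈ a b c) = trans (three (𝟙-no (i Fin.<? j) a) (𝟙-no (j Fin.<? i) c) (𝟙-yes (i Fin.≟ j) b))
        (trans (solve 1 (λ m → con 0ℚ :* m :+ con 0ℚ :* m :+ con 1ℚ := con 1ℚ) refl m) (sym (𝟙-yes (side i ≟ᵇ side j) (cong side b))))

  mono₃s : ℚ
  mono₃s = ∑[ t ∈ triples n ] 𝟙 (mono₃? t)

  -- A triangle has three uncut edges if it is uncut and exactly one otherwise, and every edge lies
  -- in D triangles.
  mono₃s-count : 2ℚ * mono₃s + Tr ≡ monos * D
  mono₃s-count = trans (trans (cong₂ _+_ (sym (∑-*ˡ (triples n) 2ℚ _)) (sym (trans (∑-const (triples n) 1ℚ) (*-identityʳ Tr))))
        (sym (∑-+ (triples n) _ _)))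
      (trans (∑-cong (triples n) λ {t} i → sym (edges t i))
      (trans (∑-swap (triples n) (pairs n) _) (trans (∑-cong (pairs n) λ {e} j → trans (∑-*ˡ (triples n) (𝟙 (mono? e)) _) (cong (𝟙 (mono? e) *_) (degree j)))
        (∑-*ʳ (pairs n) D _))))
    where
    sides : ∀ x y z → 𝟙 (x ≟ᵇ y) + (𝟙 (x ≟ᵇ z) + (𝟙 (y ≟ᵇ z) + 0ℚ)) ≡ 2ℚ * (𝟙 (x ≟ᵇ y) * 𝟙 (y ≟ᵇ z)) + 1ℚ
    sides true  true  true  = refl
    sides true  true  false = refl
    sides true  false true  = refl
    sides true  false false = refl
    sides false true  true  = refl
    sides false true  false = refl
    sides false false true  = refl
    sides false false false = refl
    edges : ∀ t → t ∈ triples n → ∑[ e ∈ pairs n ] 𝟙 (mono? e) * 𝟙 (e ∈? tedges t) ≡ 2ℚ * 𝟙 (mono₃? t) + 1ℚ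
    edges t@(i , j , k) ti = trans (∑-cong (pairs n) λ {e} _ → trans (cong (𝟙 (mono? e) *_) (𝟙-∈ {e} {tedges t} (tedges-unique ti)))
          (trans (sym (∑-*ˡ (tedges t) (𝟙 (mono? e)) _)) (∑-cong (tedges t) λ {f} _ → trans (*-comm (𝟙 (mono? e)) (𝟙 (e ≟ₑ f))) (cong (_* 𝟙 (mono? e)) (𝟙-cong (e ≟ₑ f) (f ≟ₑ e) sym sym)))))
        (trans (∑-swap (pairs n) (tedges t) _) (trans (∑-cong (tedges t) λ {f} q → ∑-≟ pairs-unique (All.lookup (tedges-⊆ ti) q) (λ e → 𝟙 (mono? e)))
        (trans (sides (side i) (side j) (side k)) (cong (λ z → 2ℚ * z + 1ℚ) (sym (𝟙-× (side i ≟ᵇ side j) (side j ≟ᵇ side k)))))))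

  module Bound (2h≤n : h ℕ.+ h ≤ n) (n≤2h+1 : n ≤ suc (h ℕ.+ h)) (1≤n : 1 ≤ n) (D≥0 : D ≥0) {p} (p≥0 : p ≥0) (p≤1 : p ≤ℚ 1ℚ) where

    -- The probabilities that a given vertex across the cut is not joined to both ends of an edge,
    -- and that it is joined to at most one of three vertices.
    q r : ℚ
    q = 1ℚ - p * p
    r = 1ℚ - (3ℚ * (p * p) - 2ℚ * (p * (p * p)))

    pp≤1 : p * p ≤ℚ 1ℚ
    pp≤1 = *-mono {d = 1ℚ} p≥0 p≥0 p≤1 p≤1

    q≥0 : q ≥0
    q≥0 = diff≥0 pp≤1

    q≤1 : q ≤ℚ 1ℚ
    q≤1 = ≤-by (sq≥0 p) (solve 1 (λ p → con 1ℚ := con 1ℚ :- p :* p :+ p :* p) refl p)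

    r≥0 : r ≥0
    r≥0 = subst _≥0 (solve 1 (λ p → (con 1ℚ :- p) :* (con 1ℚ :- p) :* (con 1ℚ :+ con 2ℚ :* p) := con 1ℚ :- (con 3ℚ :* (p :* p) :- con 2ℚ :* (p :* (p :* p)))) refl p)
      (*≥0 (sq≥0 (1ℚ - p)) (+≥0 0≤1 (*≥0 (nonNegative⁻¹ 2ℚ) p≥0)))

    r≤1 : r ≤ℚ 1ℚ
    r≤1 = ≤-by (*≥0 (sq≥0 p) (+≥0 0≤1 (*≥0 (nonNegative⁻¹ 2ℚ) (diff≥0 p≤1))))
      (solve 1 (λ p → con 1ℚ := con 1ℚ :- (con 3ℚ :* (p :* p) :- con 2ℚ :* (p :* (p :* p))) :+ p :* p :* (con 1ℚ :+ con 2ℚ :* (con 1ℚ :- p))) refl p)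

    ^-antitone : ∀ {x} → x ≥0 → x ≤ℚ 1ℚ → ∀ {a b} → a ≤ b → x ^ℚ b ≤ℚ x ^ℚ a
    ^-antitone x0 x1 {b = b} z≤n = ^≤1 x0 x1 b
    ^-antitone x0 x1 (s≤s le) = *-monoˡ x0 (^-antitone x0 x1 le)

    opposite-size : ∀ b → h ≤ length (opposite b) × length (opposite b) ≤ suc h
    opposite-size false = ℕₚ.≤-reflexive (sym e) , ℕₚ.≤-trans (ℕₚ.≤-reflexive e) (ℕₚ.n≤1+n h)
      where e : length (opposite false) ≡ h
            e = ⟨⟩-injective (trans (length-filter (λ w → ¬? (side w ≟ᵇ false)) (allFin n)) (trans (∑-cong (allFin n) λ {w} _ → go (toℕ w ℕ.<? h)) ∑σ))
              where go : ∀ {P : Set} (x : Dec P) → 𝟙 (¬? (does x ≟ᵇ false)) ≡ 𝟙 x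
                    go (yes _) = refl
                    go (no _)  = refl
                    ⟨⟩-injective : ∀ {a b} → ⟨ a ⟩ ≡ ⟨ b ⟩ → a ≡ b
                    ⟨⟩-injective {a} {b} q = ℕₚ.≤-antisym (⟨⟩-pred a b (≤-reflexive q)) (⟨⟩-pred b a (≤-reflexive (sym q)))
    opposite-size true = ⟨⟩-pred _ _ (≤-by (diff≥0 (subst (_≤ℚ ⟨ n ⟩) (⟨⟩-+ h h) (⟨⟩-mono 2h≤n))) (trans e (solve 2 (λ n h → n :- h := h :+ (n :- (h :+ h))) refl ⟨ n ⟩ ⟨ h ⟩))) ,
        ⟨⟩-pred _ _ (subst (_≤ℚ ⟨ suc h ⟩) (sym e) (≤-by (diff≥0 (subst (⟨ n ⟩ ≤ℚ_) (cong (1ℚ +_) (⟨⟩-+ h h)) (⟨⟩-mono n≤2h+1)))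
          (solve 2 (λ n h → con 1ℚ :+ h := n :- h :+ (con 1ℚ :+ (h :+ h) :- n)) refl ⟨ n ⟩ ⟨ h ⟩)))
      where e : ⟨ length (opposite true) ⟩ ≡ ⟨ n ⟩ - ⟨ h ⟩
            e = trans (length-filter (λ w → ¬? (side w ≟ᵇ true)) (allFin n)) (trans (∑-cong (allFin n) λ {w} _ → go (toℕ w ℕ.<? h)) ∑1-σ)
              where go : ∀ {P : Set} (x : Dec P) → 𝟙 (¬? (does x ≟ᵇ true)) ≡ 1ℚ - 𝟙 x
                    go (yes _) = refl
                    go (no _)  = refl

    -- 2 N - 4 `monos` equals n - (n - 2 h)², and n - 2 h is 0 or 1.
    2monos≤N : 2ℚ * monos ≤ℚ N
    2monos≤N = *-cancelˡ (positive⁻¹ 2ℚ) (≤-by (+≥0 (*≥0 (+≥0 slack₁ 0≤1) slack₂) (diff≥0 (⟨⟩-mono 1≤n)))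
      (trans (solve 2 (λ N n → con 2ℚ :* N := N :+ N :+ n :- n) refl N ⟨ n ⟩) (trans (cong (_- ⟨ n ⟩) N-double)
        (trans (solve 2 (λ n h → n :* n :- n := con 2ℚ :* (h :* h :+ (n :- h) :* (n :- h) :- n) :+ ((n :- (h :+ h) :+ con 1ℚ) :* (con 1ℚ :+ (h :+ h) :- n) :+ (n :- (con 1ℚ :+ con 0ℚ)))) refl ⟨ n ⟩ ⟨ h ⟩)
          (cong (λ z → 2ℚ * z + ((⟨ n ⟩ - (⟨ h ⟩ + ⟨ h ⟩) + 1ℚ) * (1ℚ + (⟨ h ⟩ + ⟨ h ⟩) - ⟨ n ⟩) + (⟨ n ⟩ - ⟨ 1 ⟩)))
            (trans (cong (_- ⟨ n ⟩) (sym 2monos)) (solve 2 (λ m n → m :+ m :+ n :- n := con 2ℚ :* m) refl monos ⟨ n ⟩)))))))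
      where
      slack₁ : ⟨ n ⟩ - (⟨ h ⟩ + ⟨ h ⟩) ≥0
      slack₁ = diff≥0 (subst (_≤ℚ ⟨ n ⟩) (⟨⟩-+ h h) (⟨⟩-mono 2h≤n))
      slack₂ : 1ℚ + (⟨ h ⟩ + ⟨ h ⟩) - ⟨ n ⟩ ≥0
      slack₂ = diff≥0 (subst (⟨ n ⟩ ≤ℚ_) (cong (1ℚ +_) (⟨⟩-+ h h)) (⟨⟩-mono n≤2h+1))

    -- The other side has h or h + 1 vertices. Here the larger number gives the upper bound, in
    -- `E-cover₂` the smaller one.
    E-cover₁ : 𝔼 p (pairs n) (λ G → ⟨ length (cover₁ G) ⟩) ≤ℚ monos * (p * (1ℚ - q ^ℚ suc h))
    E-cover₁ = subst₂ _≤ℚ_ (sym (trans (𝔼-cong p (pairs n) λ {G} _ → length-filter (λ e → (e ∈? G) ×-dec crossed? G e) (pairs n)) (𝔼-∑ p (pairs n) (pairs n) _)))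
        (∑-*ʳ (pairs n) (p * (1ℚ - q ^ℚ suc h)) _) (∑-mono (pairs n) λ {e} i → term e i)
      where
      term : ∀ e → e ∈ pairs n → 𝔼 p (pairs n) (λ G → 𝟙 ((e ∈? G) ×-dec crossed? G e)) ≤ℚ 𝟙 (mono? e) * (p * (1ℚ - q ^ℚ suc h))
      term e i = go (mono? e)
        where
        b = side (proj₁ e)
        expand : ∀ G → 𝟙 ((e ∈? G) ×-dec crossed? G e) ≡ 𝟙 (mono? e) * (χ [ e ] G - χ [ e ] G * ∏ (opposite b) (λ w → value (edge-factors e) w G))
        expand G = trans (𝟙-× (e ∈? G) (crossed? G e)) (trans (cong₂ _*_ (𝟙-cong (e ∈? G) ([ e ] ⊆? G) (λ j → j ∷ []) All.head)
            (trans (𝟙-× (mono? e) (¬? (private? G e))) (cong (𝟙 (mono? e) *_) (trans (𝟙-¬ (private? G e)) (cong (λ z → 1ℚ - z) (𝟙-private G e))))))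
          (solve 3 (λ x m y → x :* (m :* (con 1ℚ :- y)) := m :* (x :- x :* y)) refl (χ [ e ] G) (𝟙 (mono? e)) (∏ (opposite b) (λ w → value (edge-factors e) w G))))
        go : Dec (Mono e) → 𝔼 p (pairs n) (λ G → 𝟙 ((e ∈? G) ×-dec crossed? G e)) ≤ℚ 𝟙 (mono? e) * (p * (1ℚ - q ^ℚ suc h))
        go (no ¬m) = ≤-reflexive (trans (𝔼-cong p (pairs n) λ {G} _ → trans (expand G) (cong (_* (χ [ e ] G - χ [ e ] G * ∏ (opposite b) (λ w → value (edge-factors e) w G))) (𝟙-no (mono? e) ¬m)))
          (trans (𝔼-* p (pairs n) 0ℚ _) (trans (*-zeroˡ (𝔼 p (pairs n) (λ G → χ [ e ] G - χ [ e ] G * ∏ (opposite b) (λ w → value (edge-factors e) w G))))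
            (sym (trans (cong (_* (p * (1ℚ - q ^ℚ suc h))) (𝟙-no (mono? e) ¬m)) (*-zeroˡ (p * (1ℚ - q ^ℚ suc h))))))))
        go (yes m) = subst (_≤ℚ 𝟙 (mono? e) * (p * (1ℚ - q ^ℚ suc h)))
          (sym (trans (𝔼-cong p (pairs n) λ {G} _ → expand G) (trans (𝔼-* p (pairs n) (𝟙 (mono? e)) _) (cong (𝟙 (mono? e) *_)
            (trans (𝔼-- p (pairs n) (χ [ e ]) _) (cong₂ _-_ (𝔼-χ p pairs-unique ([] ∷ []) (i ∷ []))
              (𝔼-value p b (edge-factors e) (([] , []) ∷ (((λ f → Finₚ.<-irrefl f (∈-pairs⁻ i)) ∷ []) ∷ [] ∷ [] , refl ∷ sym m ∷ []) ∷ []) {[ e ]} ([] ∷ []) (i ∷ []) ((refl , sym m) ∷ []))))))))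
          (*-monoˡ (𝟙≥0 (mono? e)) (subst (_≤ℚ p * (1ℚ - q ^ℚ suc h)) (trans (solve 2 (λ p x → p :* (con 1ℚ :- x) := p :* con 1ℚ :- p :* con 1ℚ :* x) refl p (q ^ℚ length (opposite b)))
              (cong (λ z → p * 1ℚ - p * 1ℚ * z ^ℚ length (opposite b)) (solve 1 (λ p → con 1ℚ :- p :* p := con 1ℚ :* con 1ℚ :+ (con (- 1ℚ) :* (p :* (p :* con 1ℚ)) :+ con 0ℚ)) refl p)))
            (*-monoˡ p≥0 (+-monoʳ-≤ 1ℚ (ℚₚ.neg-antimono-≤ (^-antitone q≥0 q≤1 (proj₂ (opposite-size b))))))))

    E-cover₂ : 𝔼 p (pairs n) (λ G → ⟨ length (cover₂ G) ⟩) ≤ℚ mono₃s * (p ^ℚ 3 * r ^ℚ h)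
    E-cover₂ = subst₂ _≤ℚ_ (sym (trans (𝔼-cong p (pairs n) λ {G} _ → trans (cong ⟨_⟩ (Listₚ.length-map first (filter (isolated? G) (triangles G))))
            (trans (length-filter (isolated? G) (triangles G)) (∑-filter (inside? G) (triples n) _))) (𝔼-∑ p (pairs n) (triples n) _)))
        (∑-*ʳ (triples n) (p ^ℚ 3 * r ^ℚ h) _) (∑-mono (triples n) λ {t} i → term t i)
      where
      term : ∀ t → t ∈ triples n → 𝔼 p (pairs n) (λ G → 𝟙 (inside? G t) * 𝟙 (isolated? G t)) ≤ℚ 𝟙 (mono₃? t) * (p ^ℚ 3 * r ^ℚ h)
      term t@(i , j , k) ti = go (mono₃? t)
        where
        b = side i
        go : Dec (Mono₃ t) → _
        go (no ¬m) = ≤-reflexive (trans (𝔼-cong p (pairs n) λ {G} _ → trans (cong (𝟙 (inside? G t) *_) (𝟙-no (isolated? G t) (¬m ∘ proj₁))) (*-zeroʳ (𝟙 (inside? G t))))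
          (trans (𝔼-const p (pairs n) 0ℚ) (sym (trans (cong (_* (p ^ℚ 3 * r ^ℚ h)) (𝟙-no (mono₃? t) ¬m)) (*-zeroˡ (p ^ℚ 3 * r ^ℚ h))))))
        go (yes m@(ij , jk)) = subst₂ _≤ℚ_
          (sym (trans (𝔼-cong p (pairs n) λ {G} _ → cong (χ (tedges t) G *_) (trans (𝟙-× (mono₃? t) (All.all? (private? G) (tedges t)))
                (trans (cong₂ _*_ (𝟙-yes (mono₃? t) m) (𝟙-isolated G t m)) (*-identityˡ _))))
            (𝔼-value p b (triple-factors t) ok {tedges t} (tedges-unique ti) (tedges-⊆ ti) ((refl , sym ij) ∷ (refl , sym (trans ij jk)) ∷ (sym ij , sym (trans ij jk)) ∷ []))))
          (sym (trans (cong (_* (p ^ℚ 3 * r ^ℚ h)) (𝟙-yes (mono₃? t) m)) (*-identityˡ _)))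
          (*-monoˡ (^≥0 p≥0 3) (subst (λ z → z ^ℚ length (opposite b) ≤ℚ r ^ℚ h)
            (solve 1 (λ p → con 1ℚ :- (con 3ℚ :* (p :* p) :- con 2ℚ :* (p :* (p :* p))) :=
               con 1ℚ :* con 1ℚ :+ (con (- 1ℚ) :* (p :* (p :* con 1ℚ)) :+ (con (- 1ℚ) :* (p :* (p :* con 1ℚ)) :+ (con (- 1ℚ) :* (p :* (p :* con 1ℚ)) :+ (con 2ℚ :* (p :* (p :* (p :* con 1ℚ))) :+ con 0ℚ))))) refl p)
            (^-antitone r≥0 r≤1 (proj₁ (opposite-size b)))))
          where
          lt : ∀ {x y : Fin n} → x Fin.< y → x ≢ y
          lt a e = Finₚ.<-irrefl e a
          i<j = proj₁ (∈-triples⁻ ti)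
          j<k = proj₂ (∈-triples⁻ ti)
          i<k = Finₚ.<-trans i<j j<k
          si = refl {x = b}
          sj = sym ij
          sk = sym (trans ij jk)
          ok : All (λ k → Unique (proj₂ k) × All (λ a → side a ≡ b) (proj₂ k)) (triple-factors t)
          ok = ([] , []) ∷ ((lt i<j ∷ []) ∷ [] ∷ [] , si ∷ sj ∷ []) ∷ ((lt i<k ∷ []) ∷ [] ∷ [] , si ∷ sk ∷ []) ∷
            ((lt j<k ∷ []) ∷ [] ∷ [] , sj ∷ sk ∷ []) ∷ ((lt i<j ∷ lt i<k ∷ []) ∷ (lt j<k ∷ []) ∷ [] ∷ [] , si ∷ sj ∷ sk ∷ []) ∷ []

    -- By `mono₃s-count`, twice `mono₃s` is `monos` D - Tr, where `monos` ≤ N / 2 and Tr = N D / 3.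
    12mono₃s≤ : ⟨ 12 ⟩ * mono₃s ≤ℚ N * D
    12mono₃s≤ = ≤-by (*≥0 (nonNegative⁻¹ 3ℚ) (*≥0 (diff≥0 2monos≤N) D≥0))
      (trans (solve 2 (λ N D → N :* D := con 3ℚ :* (N :* D) :- con 2ℚ :* (N :* D)) refl N D) (trans (cong (λ z → 3ℚ * (N * D) - 2ℚ * z) (sym triple-count))
        (trans (solve 3 (λ N D T → con 3ℚ :* (N :* D) :- con 2ℚ :* (con 3ℚ :* T) := con ⟨ 6 ⟩ :* (N :* D) :* con ½ :- con ⟨ 6 ⟩ :* T) refl N D Tr)
          (trans (solve 4 (λ N D T m → con ⟨ 6 ⟩ :* (N :* D) :* con ½ :- con ⟨ 6 ⟩ :* T := con ⟨ 6 ⟩ :* (m :* D :- T) :+ con 3ℚ :* ((N :- con 2ℚ :* m) :* D)) refl N D Tr monos)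
            (cong (_+ 3ℚ * ((N - 2ℚ * monos) * D)) (trans (cong (λ z → ⟨ 6 ⟩ * (z - Tr)) (sym mono₃s-count))
              (solve 2 (λ m T → con ⟨ 6 ⟩ :* (con 2ℚ :* m :+ T :- T) := con ⟨ 12 ⟩ :* m) refl mono₃s Tr)))))))

    covering-upper : ⟨ 12 ⟩ * 𝔼 p (pairs n) (λ G → ⟨ τ G ⟩) ≤ℚ ⟨ 6 ⟩ * (N * p * (1ℚ - q ^ℚ suc h)) + N * p * (D * (p * p) * r ^ℚ h)
    covering-upper = ≤-trans (*-monoˡ (nonNegative⁻¹ ⟨ 12 ⟩) (≤-trans
        (subst (𝔼 p (pairs n) (λ G → ⟨ τ G ⟩) ≤ℚ_) (𝔼-+ p (pairs n) _ _) (𝔼-mono p≥0 p≤1 (pairs n) λ s → τ≤cover (⊑-Unique s pairs-unique)))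
        (+-mono-≤ E-cover₁ E-cover₂)))
      (≤-by (+≥0 (*≥0 (nonNegative⁻¹ ⟨ 6 ⟩) (*≥0 (diff≥0 2monos≤N) (*≥0 p≥0 (diff≥0 (^≤1 q≥0 q≤1 (suc h)))))) (*≥0 (diff≥0 12mono₃s≤) (*≥0 (^≥0 p≥0 3) (^≥0 r≥0 h))))
        (solve 7 (λ N p Q D R m t → con ⟨ 6 ⟩ :* (N :* p :* (con 1ℚ :- Q)) :+ N :* p :* (D :* (p :* p) :* R) :=
          con ⟨ 12 ⟩ :* (m :* (p :* (con 1ℚ :- Q)) :+ t :* (p :* (p :* (p :* con 1ℚ)) :* R)) :+
          (con ⟨ 6 ⟩ :* ((N :- con 2ℚ :* m) :* (p :* (con 1ℚ :- Q))) :+ (N :* D :- con ⟨ 12 ⟩ :* t) :* (p :* (p :* (p :* con 1ℚ)) :* R))) refl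
          N p (q ^ℚ suc h) D (r ^ℚ h) monos mono₃s))

    mono-cover : ∀ G → Covers G (filter mono? G)
    mono-cover G = All.tabulate λ {t} i → go t (proj₂ (∈-triangles⁻ {G} i))
      where
      go : ∀ t → tedges t ⊆ G → Any (λ e → Any (e ≡_) (filter mono? G)) (tedges t)
      go (i , j , k) (a ∷ b ∷ c ∷ []) = sides (side i ≟ᵇ side j) (side j ≟ᵇ side k) (side i ≟ᵇ side k)
        where
        sides : Dec (side i ≡ side j) → Dec (side j ≡ side k) → Dec (side i ≡ side k) → Any (λ e → Any (e ≡_) (filter mono? G)) (tedges (i , j , k))
        sides (yes x) _ _ = here (∈-filter⁺ mono? a x)
        sides (no _) (yes y) _ = there (there (here (∈-filter⁺ mono? c y)))
        sides (no _) (no _) (yes z) = there (here (∈-filter⁺ mono? b z))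
        sides (no x) (no y) (no z) = contradiction z (pigeon (side i) (side j) (side k) x y)

    -- Every triangle has an uncut edge, and at most half of all pairs are uncut.
    half-upper : 2ℚ * 𝔼 p (pairs n) (λ G → ⟨ τ G ⟩) ≤ℚ N * p
    half-upper = ≤-trans (*-monoˡ (nonNegative⁻¹ 2ℚ) (≤-trans
        (𝔼-mono p≥0 p≤1 (pairs n) {F′ = λ G → ∑[ e ∈ pairs n ] 𝟙 (mono? e) * χ [ e ] G} λ {G} s → ≤-trans (⟨⟩-mono (τ-upper (⊑-Unique s pairs-unique) (mono-cover G)))
          (≤-reflexive (trans (length-filter mono? G) (count (⊑-Unique s pairs-unique) (Sub.lookup s)))))
        (≤-reflexive (trans (𝔼-∑ p (pairs n) (pairs n) _) (trans (∑-cong (pairs n) λ {e} i → trans (𝔼-* p (pairs n) (𝟙 (mono? e)) _)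
            (cong (𝟙 (mono? e) *_) (trans (𝔼-χ p pairs-unique ([] ∷ []) (i ∷ [])) (*-identityʳ p)))) (∑-*ʳ (pairs n) p _))))))
      (≤-by (*≥0 (diff≥0 2monos≤N) p≥0) (solve 3 (λ N p m → N :* p := con 2ℚ :* (m :* p) :+ (N :- con 2ℚ :* m) :* p) refl N p monos))
      where
      count : ∀ {G} → Unique G → (∀ {e} → e ∈ G → e ∈ pairs n) → ∑[ e ∈ G ] 𝟙 (mono? e) ≡ ∑[ e ∈ pairs n ] 𝟙 (mono? e) * χ [ e ] G
      count {G} u s = trans (∑-cong G λ {g} i → sym (∑-≟ pairs-unique (s i) (λ e → 𝟙 (mono? e)))) (trans (∑-swap G (pairs n) _)
        (∑-cong (pairs n) λ {e} _ → trans (∑-*ʳ G (𝟙 (mono? e)) _) (trans (*-comm (∑[ g ∈ G ] 𝟙 (g ≟ₑ e)) (𝟙 (mono? e))) (cong (𝟙 (mono? e) *_)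
          (trans (∑-cong G λ {g} _ → 𝟙-cong (g ≟ₑ e) (e ≟ₑ g) sym sym) (trans (sym (𝟙-∈ {e} {G} u)) (𝟙-cong (e ∈? G) ([ e ] ⊆? G) (λ i → i ∷ []) All.head)))))))

-- Sparse graphs

badProb-𝔼 : ∀ n p → badProb n p ≡ 𝔼 p (pairs n) (Packing.bad n)
badProb-𝔼 n p = trans (as-∑ (graphs n)) (trans (∑-cong (graphs n) λ {G} _ → if-* (does (τ G ℕ.≤? 2 ℕ.* ν G))) (𝔼-sublists p (pairs n) (Packing.bad n)))
  where
  as-∑ : ∀ {A : Set} (xs : List A) {f : A → ℚ} → foldr _+_ 0ℚ (map f xs) ≡ ∑ xs f
  as-∑ []       = refl
  as-∑ (x ∷ xs) {f} = cong (f x +_) (as-∑ xs)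
  if-* : ∀ b {w} → (if b then 0ℚ else w) ≡ w * (if b then 0ℚ else 1ℚ)
  if-* true  {w} = sym (*-zeroʳ w)
  if-* false {w} = sym (*-identityʳ w)

module Probability (n : ℕ) (5≤n : 5 ≤ n) {p} (p≥0 : p ≥0) (p≤1 : p ≤ℚ 1ℚ) where

  open CompleteGraph n
  open Sizes n 5≤n
  open Packing n
  open Independence (_≟ₑ_ {n}) using (χ-++)

  private
    E = 𝔼 p (pairs n)
  module H = Hypergraph (_≟ₑ_ {n}) (pairs n) (triples n) tedges pairs-unique triples-unique tedges-⊆ tedges-unique (λ _ → refl) tedges-linear D D≥0 degree

  E-bad≥0 : E bad ≥0
  E-bad≥0 = 𝔼≥0 p≥0 p≤1 (pairs n) λ {G} _ → [ (λ e → ≤-reflexive (sym e)) , (λ (e , _) → subst _≥0 (sym e) 0≤1) ]′ (bad-cases G)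

  E-bad≤ : ∀ {m} → m ≥0 → m ≤ℚ E X → E bad * (m * m) ≤ℚ N * (p * 4ℚ)
  E-bad≤ = chebyshev p≥0 p≤1 (nonNegative⁻¹ 4ℚ) (pairs n) X bad X-lipschitz λ {G} _ →
    [ inj₁ , (λ (e , h) → inj₂ (e , ≤-trans h (toWitness {a? = - 1ℚ ℚₚ.≤? 0ℚ} _))) ]′ (bad-cases G)

  union : Triple n → Triple n → Graph
  union t u = H.fresh (tedges t) u ++ tedges t

  valid : ∀ {t} → t ∈ triples n → H.Valid (tedges t)
  valid i = tedges-unique i , tedges-⊆ i

  union-valid : ∀ {t u} → t ∈ triples n → u ∈ triples n → H.Valid (union t u)
  union-valid i j = H.fresh-Valid (valid i) j

  E-χ : ∀ {S} → H.Valid S → E (χ S) ≡ p ^ℚ length S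
  E-χ (u , s) = 𝔼-χ p pairs-unique u s

  ^-antitone : ∀ {a b} → a ≤ b → p ^ℚ b ≤ℚ p ^ℚ a
  ^-antitone {b = b} z≤n = ^≤1 p≥0 p≤1 b
  ^-antitone (s≤s le) = *-monoˡ p≥0 (^-antitone le)

  shared : ∀ {t u} → ¬ EdgeDisjoint t u → Any (_∈ tedges t) (tedges u)
  shared {t} {u} h = let e , a , b = find (Allₚ.¬All⇒Any¬ (λ e → ¬? (e ∈? tedges u)) (tedges t) h) in
      lose (decidable-stable (e ∈? tedges u) b) a

  fresh<3 : ∀ {S u} → Any (_∈ S) (tedges u) → length (H.fresh S u) ≤ 2
  fresh<3 {S} {u} a = ℕ.s≤s⁻¹ (Listₚ.filter-notAll (λ x → ¬? (x ∈? S)) (tedges u) (Any.map (λ j k → k j) a))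

  -- Distinct triangles share at most one edge, so the union of a conflicting pair has exactly five
  -- edges.
  fresh-conflict : ∀ {t u} → t ∈ triples n → u ∈ triples n → Conflict t u → length (H.fresh (tedges t) u) ≡ 2
  fresh-conflict {t} {u} i j (ne , h) = ℕₚ.≤-antisym (fresh<3 {tedges t} {u} (shared h)) (ℕₚ.≮⇒≥ λ lt → ne (same lt))
    where
    go : ∀ es → Unique es → (∀ {e} → e ∈ es → e ∈ tedges u) → length es ≡ 3 → length (es ∖ tedges t) ≤ 1 → t ≡ u
    go (a ∷ b ∷ c ∷ []) ((ab ∷ ac ∷ []) ∷ (bc ∷ []) ∷ [] ∷ []) s _ le = cases (a ∈? tedges t) (b ∈? tedges t) (c ∈? tedges t)
      where
      big : ∀ {x y} → x ≢ y → x ∈ a ∷ b ∷ c ∷ [] → y ∈ a ∷ b ∷ c ∷ [] → x ∉ tedges t → y ∉ tedges t → ⊥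
      big {x} {y} xy xi yi x∉ y∉ = ℕₚ.<⇒≱ {1} {2} (s≤s (s≤s z≤n)) (ℕₚ.≤-trans
        (Length.length-⊆ (_≟ₑ_ {n}) ((xy ∷ []) ∷ [] ∷ []) (∈-∖⁺ {S = a ∷ b ∷ c ∷ []} {tedges t} xi x∉ ∷ ∈-∖⁺ {S = a ∷ b ∷ c ∷ []} {tedges t} yi y∉ ∷ [])) le)
      eq : ∀ {x y} → x ≢ y → x ∈ a ∷ b ∷ c ∷ [] → y ∈ a ∷ b ∷ c ∷ [] → x ∈ tedges t → y ∈ tedges t → t ≡ u
      eq xy xi yi xt yt = tedges-linear i j xy xt yt (s xi) (s yi)
      cases : Dec (a ∈ tedges t) → Dec (b ∈ tedges t) → Dec (c ∈ tedges t) → t ≡ u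
      cases (yes x) (yes y) _ = eq ab (here refl) (there (here refl)) x y
      cases (yes x) _ (yes z) = eq ac (here refl) (there (there (here refl))) x z
      cases _ (yes y) (yes z) = eq bc (there (here refl)) (there (there (here refl))) y z
      cases (no x) (no y) _ = ⊥-elim (big ab (here refl) (there (here refl)) x y)
      cases (no x) _ (no z) = ⊥-elim (big ac (here refl) (there (there (here refl))) x z)
      cases _ (no y) (no z) = ⊥-elim (big bc (there (here refl)) (there (there (here refl))) y z)
    same : length (H.fresh (tedges t) u) ℕ.< 2 → t ≡ u
    same lt = go (tedges u) (tedges-unique j) id refl (ℕ.s≤s⁻¹ lt)

  -- If the three edges of w are covered by t and u, then two of them belong to t or two of them to u.
  fresh-twice : ∀ {t u w} → t ∈ triples n → u ∈ triples n → w ∈ triples n → Conflict t w → u ≢ w → length (H.fresh (union t u) w) ≢ 0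
  fresh-twice {t} {u} {w} i j k (tw , _) uw le = go (tedges w) (tedges-unique k) id refl inside
    where
    inside : ∀ {e} → e ∈ tedges w → e ∈ union t u
    inside {e} q = decidable-stable (e ∈? union t u) λ e∉ → case subst (e ∈_) (nil (H.fresh (union t u) w) le) (∈-∖⁺ {S = tedges w} {union t u} q e∉) of λ ()
      where nil : ∀ {A : Set} (l : List A) → length l ≡ 0 → l ≡ []
            nil [] _ = refl
    go : ∀ es → Unique es → (∀ {e} → e ∈ es → e ∈ tedges w) → length es ≡ 3 → (∀ {e} → e ∈ tedges w → e ∈ union t u) → ⊥
    go (a ∷ b ∷ c ∷ []) ((ab ∷ ac ∷ []) ∷ (bc ∷ []) ∷ [] ∷ []) s _ ins = cases (where-is (here refl)) (where-is (there (here refl))) (where-is (there (there (here refl))))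
      where
      where-is : ∀ {e} → e ∈ a ∷ b ∷ c ∷ [] → e ∈ tedges t ⊎ e ∈ tedges u
      where-is q = [ (λ x → inj₂ (proj₁ (∈-∖⁻ {S = tedges u} {tedges t} x))) , inj₁ ]′ (∈-++⁻ (H.fresh (tedges t) u) (ins (s q)))
      in-t : ∀ {x y} → x ≢ y → x ∈ a ∷ b ∷ c ∷ [] → y ∈ a ∷ b ∷ c ∷ [] → x ∈ tedges t → y ∈ tedges t → ⊥
      in-t xy xi yi xt yt = tw (tedges-linear i k xy xt yt (s xi) (s yi))
      in-u : ∀ {x y} → x ≢ y → x ∈ a ∷ b ∷ c ∷ [] → y ∈ a ∷ b ∷ c ∷ [] → x ∈ tedges u → y ∈ tedges u → ⊥
      in-u xy xi yi xt yt = uw (tedges-linear j k xy xt yt (s xi) (s yi))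
      cases : a ∈ tedges t ⊎ a ∈ tedges u → b ∈ tedges t ⊎ b ∈ tedges u → c ∈ tedges t ⊎ c ∈ tedges u → ⊥
      cases (inj₁ x) (inj₁ y) _ = in-t ab (here refl) (there (here refl)) x y
      cases (inj₁ x) (inj₂ y) (inj₁ z) = in-t ac (here refl) (there (there (here refl))) x z
      cases (inj₁ x) (inj₂ y) (inj₂ z) = in-u bc (there (here refl)) (there (there (here refl))) y z
      cases (inj₂ x) (inj₂ y) _ = in-u ab (here refl) (there (here refl)) x y
      cases (inj₂ x) (inj₁ y) (inj₂ z) = in-u ac (here refl) (there (there (here refl))) x z
      cases (inj₂ x) (inj₁ y) (inj₁ z) = in-t bc (there (here refl)) (there (there (here refl))) y z

  conflict≤meet : ∀ {t u} → t ∈ triples n → u ∈ triples n → 𝟙 (conflict? t u) ≤ℚ H.meet (tedges t) u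
  conflict≤meet {t} {u} i j = 𝟙-elim (_≤ℚ H.meet (tedges t) u) (conflict? t u)
    (λ c → ≤-reflexive (sym (trans (H.meet-fresh (tedges-unique i) j) (cong (λ l → 3ℚ - ⟨ l ⟩) (fresh-conflict i j c)))))
    (λ _ → H.meet≥0 (tedges t) u)

  ∑-conflict : ∀ {t} → t ∈ triples n → ∑[ u ∈ triples n ] 𝟙 (conflict? t u) ≤ℚ 3ℚ * D
  ∑-conflict {t} i = ≤-trans (∑-mono (triples n) λ j → conflict≤meet i j) (≤-reflexive (H.∑-meet (tedges-⊆ i)))

  ∑-triangles : ∀ G f → ∑ (triangles G) f ≡ ∑[ t ∈ triples n ] χ (tedges t) G * f t
  ∑-triangles G f = ∑-filter (inside? G) (triples n) f

  pair-term : ∀ t u → Graph → ℚ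
  pair-term t u G = 𝟙 (conflict? t u) * χ (union t u) G

  expand₂ : ∀ G → ∑[ t ∈ triangles G ] conflicts (triangles G) t ≡ ∑[ t ∈ triples n ] ∑[ u ∈ triples n ] pair-term t u G
  expand₂ G = trans (∑-triangles G _) (∑-cong (triples n) λ {t} _ → trans (cong (χ (tedges t) G *_) (∑-triangles G _))
    (trans (sym (∑-*ˡ (triples n) (χ (tedges t) G) _)) (∑-cong (triples n) λ {u} _ →
      trans (solve 3 (λ a b c → a :* (b :* c) := c :* (a :* b)) refl (χ (tedges t) G) (χ (tedges u) G) (𝟙 (conflict? t u)))
        (cong (𝟙 (conflict? t u) *_) (χ-pair t u)))))
    where
    χ-pair : ∀ t u → χ (tedges t) G * χ (tedges u) G ≡ χ (union t u) G
    χ-pair t u = trans (sym (χ-++ (tedges t) (tedges u) G)) (𝟙-cong ((tedges u ++ tedges t) ⊆? G) (union t u ⊆? G)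
      (λ h → Allₚ.++⁺ (All.tabulate λ q → All.lookup (Allₚ.++⁻ˡ (tedges u) h) (proj₁ (∈-∖⁻ {S = tedges u} {tedges t} q))) (Allₚ.++⁻ʳ (tedges u) h))
      (λ h → Allₚ.++⁺ (All.map (All.lookup h) (H.inc-⊆-fresh (tedges t) u)) (Allₚ.++⁻ʳ (H.fresh (tedges t) u) h)))

  E-pair : ∀ {t u} → t ∈ triples n → u ∈ triples n → E (pair-term t u) ≡ 𝟙 (conflict? t u) * p ^ℚ 5
  E-pair {t} {u} i j = trans (𝔼-* p (pairs n) (𝟙 (conflict? t u)) _) (go (conflict? t u))
    where
    go : (d : Dec (Conflict t u)) → 𝟙 d * E (χ (union t u)) ≡ 𝟙 d * p ^ℚ 5
    go (yes c) = cong (1ℚ *_) (trans (E-χ (union-valid i j)) (cong (p ^ℚ_) (trans (Listₚ.length-++ (H.fresh (tedges t) u)) (cong (ℕ._+ 3) (fresh-conflict i j c)))))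
    go (no _)  = trans (*-zeroˡ (E (χ (union t u)))) (sym (*-zeroˡ (p ^ℚ 5)))

  E-triangles : E (λ G → ⟨ length (triangles G) ⟩) ≡ Tr * p ^ℚ 3
  E-triangles = trans (𝔼-cong p (pairs n) λ {G} _ → length-filter (inside? G) (triples n))
    (trans (𝔼-∑ p (pairs n) (triples n) _) (trans (∑-cong (triples n) λ i → E-χ (valid i)) (∑-const (triples n) (p ^ℚ 3))))

  E-conflicts : E (λ G → ∑[ t ∈ triangles G ] conflicts (triangles G) t) ≤ℚ Tr * (3ℚ * D * p ^ℚ 5)
  E-conflicts = subst₂ _≤ℚ_ (sym (trans (𝔼-cong p (pairs n) λ {G} _ → expand₂ G) (trans (𝔼-∑ p (pairs n) (triples n) _)
      (∑-cong (triples n) λ i → trans (𝔼-∑ p (pairs n) (triples n) _) (trans (∑-cong (triples n) λ j → E-pair i j) (∑-*ʳ (triples n) (p ^ℚ 5) _))))))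
    (∑-const (triples n) (3ℚ * D * p ^ℚ 5)) (∑-mono (triples n) λ i → *-monoʳ (^≥0 p≥0 5) (∑-conflict i))

  -- From `X-lower`: a triangle conflicts with at most 3 D others, and a conflicting pair is present
  -- with probability p⁵.
  E-X-sparse : Tr * p ^ℚ 3 * (1ℚ - 3ℚ * (D * (p * p))) ≤ℚ E X
  E-X-sparse = ≤-trans (≤-by (diff≥0 E-conflicts) (trans (cong (_- E (λ G → ∑[ t ∈ triangles G ] conflicts (triangles G) t)) E-triangles)
      (solve 4 (λ T D p c → T :* (p :^ 3) :- c := T :* (p :^ 3) :* (con 1ℚ :- con 3ℚ :* (D :* (p :* p))) :+ (T :* (con 3ℚ :* D :* (p :^ 5)) :- c)) refl
        Tr D p (E (λ G → ∑[ t ∈ triangles G ] conflicts (triangles G) t)))))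
    (subst (_≤ℚ E X) (𝔼-- p (pairs n) _ _) (𝔼-mono p≥0 p≤1 (pairs n) λ s → X-lower (⊑-Unique s pairs-unique)))

  -- Of order n⁴ p⁵, like the expected number of conflicting pairs of triangles.
  density : ℚ
  density = N * (D * D) * p ^ℚ 5

  -- For 12 D p² ≤ 1 the mean of `X` is at least m = 3 Tr p³ / 4. As 3 Tr = N D, 16 m² equals N p
  -- times `density`, and Chebyshev applies.
  sparse₁ : 0ℚ <ℚ p → ⟨ 12 ⟩ * (D * (p * p)) ≤ℚ 1ℚ → E bad * density ≤ℚ ⟨ 64 ⟩
  sparse₁ p>0 d≤ = *-cancelˡ (*>0 (<-≤-trans (<-≤-trans (positive⁻¹ ⟨ 5 ⟩) 5≤⟨n⟩) n≤N) p>0) (subst₂ _≤ℚ_ left right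
      (*-monoˡ (nonNegative⁻¹ ⟨ 16 ⟩) (E-bad≤ m≥0 m≤)))
    where
    m = Tr * p ^ℚ 3 * (3ℚ * (½ * ½))
    m≥0 : m ≥0
    m≥0 = *≥0 (*≥0 (<⇒≤ Tr>0) (^≥0 p≥0 3)) (nonNegative⁻¹ (3ℚ * (½ * ½)))
    m≤ : m ≤ℚ E X
    m≤ = ≤-trans (*-monoˡ (*≥0 (<⇒≤ Tr>0) (^≥0 p≥0 3)) (≤-by (*≥0 (nonNegative⁻¹ (½ * ½)) (diff≥0 d≤))
      (solve 1 (λ d → con 1ℚ :- con 3ℚ :* d := con (3ℚ * (½ * ½)) :+ con (½ * ½) :* (con 1ℚ :- con ⟨ 12 ⟩ :* d)) refl (D * (p * p))))) E-X-sparse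
    left : ⟨ 16 ⟩ * (E bad * (m * m)) ≡ N * p * (E bad * density)
    left = trans (solve 3 (λ e T p → con ⟨ 16 ⟩ :* (e :* (T :* (p :^ 3) :* con (3ℚ * (½ * ½)) :* (T :* (p :^ 3) :* con (3ℚ * (½ * ½))))) := e :* (con 3ℚ :* T :* (con 3ℚ :* T)) :* (p :^ 6)) refl (E bad) Tr p)
      (trans (cong (λ z → E bad * (z * z) * p ^ℚ 6) triple-count)
        (solve 4 (λ e N D p → e :* (N :* D :* (N :* D)) :* (p :^ 6) := N :* p :* (e :* (N :* (D :* D) :* (p :^ 5)))) refl (E bad) N D p))
    right : ⟨ 16 ⟩ * (N * (p * 4ℚ)) ≡ N * p * ⟨ 64 ⟩
    right = solve 2 (λ N p → con ⟨ 16 ⟩ :* (N :* (p :* con 4ℚ)) := N :* p :* con ⟨ 64 ⟩) refl N p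

  triple-term : ∀ t u w → Graph → ℚ
  triple-term t u w G = 𝟙 (conflict? t u) * (𝟙 (conflict? t w) * 𝟙 (¬? (u ≟ₜ w))) * χ (H.fresh (union t u) w ++ union t u) G

  private module Cₜ = Containment _≟ₜ_

  consecutive : ∀ k → let c = ⟨ k ⟩ in 2ℚ * (c - 1ℚ) ≤ℚ c * c - c × c * c - c ≥0
  consecutive 0 = toWitness {a? = 2ℚ * (⟨ 0 ⟩ - 1ℚ) ℚₚ.≤? ⟨ 0 ⟩ * ⟨ 0 ⟩ - ⟨ 0 ⟩} _ , toWitness {a? = 0ℚ ℚₚ.≤? ⟨ 0 ⟩ * ⟨ 0 ⟩ - ⟨ 0 ⟩} _
  consecutive 1 = toWitness {a? = 2ℚ * (⟨ 1 ⟩ - 1ℚ) ℚₚ.≤? ⟨ 1 ⟩ * ⟨ 1 ⟩ - ⟨ 1 ⟩} _ , toWitness {a? = 0ℚ ℚₚ.≤? ⟨ 1 ⟩ * ⟨ 1 ⟩ - ⟨ 1 ⟩} _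
  consecutive (suc (suc k)) =
    ≤-by (*≥0 (⟨⟩≥0 (suc k)) (⟨⟩≥0 k)) (solve 1 (λ k → let c = con 1ℚ :+ (con 1ℚ :+ k) in c :* c :- c := con 2ℚ :* (c :- con 1ℚ) :+ (con 1ℚ :+ k) :* k) refl ⟨ k ⟩) ,
    subst _≥0 (solve 1 (λ k → let c = con 1ℚ :+ (con 1ℚ :+ k) in c :* (con 1ℚ :+ k) := c :* c :- c) refl ⟨ k ⟩) (*≥0 (⟨⟩≥0 (suc (suc k))) (⟨⟩≥0 (suc k)))

  -- If τ exceeds 2 ν, then `X` ≤ -1 forces the sum of c t - 1 to be at least 1, where c t is the
  -- number of conflicts of t. Now 2 (c - 1) ≤ c (c - 1), and c (c - 1) counts ordered pairs of
  -- conflicts of the same triangle.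
  bad≤ : ∀ {G} → Unique G → 2ℚ * bad G ≤ℚ ∑[ t ∈ triples n ] ∑[ u ∈ triples n ] ∑[ w ∈ triples n ] triple-term t u w G
  bad≤ {G} ug = subst (2ℚ * bad G ≤ℚ_) expand₃ ([ none , some ]′ (bad-cases G))
    where
    Δs = triangles G
    c : Triple n → ℚ
    c = conflicts Δs
    c-consecutive : ∀ t → 2ℚ * (c t - 1ℚ) ≤ℚ c t * c t - c t × c t * c t - c t ≥0
    c-consecutive t = subst (λ c → 2ℚ * (c - 1ℚ) ≤ℚ c * c - c × c * c - c ≥0) (length-filter (conflict? t) Δs) (consecutive (length (filter (conflict? t) Δs)))
    none : bad G ≡ 0ℚ → 2ℚ * bad G ≤ℚ ∑[ t ∈ Δs ] (c t * c t - c t)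
    none e = subst (_≤ℚ ∑[ t ∈ Δs ] (c t * c t - c t)) (sym (trans (cong (2ℚ *_) e) (*-zeroʳ 2ℚ))) (∑≥0 Δs λ {t} _ → proj₂ (c-consecutive t))
    some : bad G ≡ 1ℚ × X G ≤ℚ - 1ℚ → 2ℚ * bad G ≤ℚ ∑[ t ∈ Δs ] (c t * c t - c t)
    some (e , h) = ≤-trans (subst₂ _≤ℚ_ (cong (2ℚ *_) (sym e)) (trans (cong (2ℚ *_) count) (sym (∑-*ˡ Δs 2ℚ (λ t → c t - 1ℚ))))
        (*-monoˡ (nonNegative⁻¹ 2ℚ) (≤-by (diff≥0 (≤-trans (X-lower ug) h)) (solve 2 (λ s l → s :- l := con 1ℚ :+ (con (- 1ℚ) :- (l :- s))) refl (∑ Δs c) ⟨ length Δs ⟩))))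
      (∑-mono Δs λ {t} _ → proj₁ (c-consecutive t))
      where
      count : ∑ Δs c - ⟨ length Δs ⟩ ≡ ∑[ t ∈ Δs ] (c t - 1ℚ)
      count = sym (trans (∑-+ Δs c (λ _ → - 1ℚ)) (cong (∑ Δs c +_) (trans (∑-const Δs (- 1ℚ)) (solve 1 (λ l → l :* con (- 1ℚ) := :- l) refl ⟨ length Δs ⟩))))
    idem : ∀ {P : Set} (d : Dec P) → 𝟙 d * 𝟙 d ≡ 𝟙 d
    idem (yes _) = refl
    idem (no _)  = refl
    ordered : ∀ t → c t * c t - c t ≡ ∑[ u ∈ Δs ] ∑[ w ∈ Δs ] 𝟙 (conflict? t u) * (𝟙 (conflict? t w) * 𝟙 (¬? (u ≟ₜ w)))
    ordered t = sym (trans (∑-cong Δs λ {u} i → trans (∑-*ˡ Δs (𝟙 (conflict? t u)) _) (cong (𝟙 (conflict? t u) *_)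
          (trans (∑-cong Δs λ {w} _ → trans (cong (𝟙 (conflict? t w) *_) (𝟙-¬ (u ≟ₜ w)))
              (solve 2 (λ a b → a :* (con 1ℚ :- b) := a :+ con (- 1ℚ) :* (b :* a)) refl (𝟙 (conflict? t w)) (𝟙 (u ≟ₜ w))))
            (trans (∑-+ Δs (λ w → 𝟙 (conflict? t w)) _) (cong (c t +_) (trans (∑-*ˡ Δs (- 1ℚ) _) (cong (- 1ℚ *_) (Cₜ.∑-≟ (triangles-unique G) i (λ w → 𝟙 (conflict? t w))))))))))
        (trans (∑-cong Δs λ {u} _ → trans (solve 2 (λ a c → a :* (c :+ con (- 1ℚ) :* a) := a :* c :+ con (- 1ℚ) :* (a :* a)) refl (𝟙 (conflict? t u)) (c t))
            (cong (λ z → 𝟙 (conflict? t u) * c t + - 1ℚ * z) (idem (conflict? t u))))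
          (trans (∑-+ Δs _ _) (trans (cong₂ _+_ (∑-*ʳ Δs (c t) _) (∑-*ˡ Δs (- 1ℚ) _)) (solve 1 (λ c → c :* c :+ con (- 1ℚ) :* c := c :* c :- c) refl (c t))))))
    χ-triple : ∀ t u w → χ (tedges t) G * (χ (tedges u) G * χ (tedges w) G) ≡ χ (H.fresh (union t u) w ++ union t u) G
    χ-triple t u w = trans (trans (sym (*-assoc (χ (tedges t) G) _ _)) (trans (cong (_* χ (tedges w) G) (sym (χ-++ (tedges t) (tedges u) G))) (sym (χ-++ (tedges u ++ tedges t) (tedges w) G))))
      (𝟙-cong ((tedges w ++ (tedges u ++ tedges t)) ⊆? G) ((H.fresh (union t u) w ++ union t u) ⊆? G)
        (λ h → let hw = Allₚ.++⁻ˡ (tedges w) h ; hut = Allₚ.++⁻ʳ (tedges w) h in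
          Allₚ.++⁺ (All.tabulate λ q → All.lookup hw (proj₁ (∈-∖⁻ {S = tedges w} {union t u} q)))
            (Allₚ.++⁺ (All.tabulate λ q → All.lookup (Allₚ.++⁻ˡ (tedges u) hut) (proj₁ (∈-∖⁻ {S = tedges u} {tedges t} q))) (Allₚ.++⁻ʳ (tedges u) hut)))
        (λ h → let htu = Allₚ.++⁻ʳ (H.fresh (union t u) w) h in
          Allₚ.++⁺ (All.map (All.lookup h) (H.inc-⊆-fresh (union t u) w)) (Allₚ.++⁺ (All.map (All.lookup htu) (H.inc-⊆-fresh (tedges t) u)) (Allₚ.++⁻ʳ (H.fresh (tedges t) u) htu))))
    expand₃ : ∑[ t ∈ Δs ] (c t * c t - c t) ≡ ∑[ t ∈ triples n ] ∑[ u ∈ triples n ] ∑[ w ∈ triples n ] triple-term t u w G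
    expand₃ = trans (∑-triangles G _) (∑-cong (triples n) λ {t} _ → trans (cong (χ (tedges t) G *_) (trans (ordered t) (∑-triangles G _)))
      (trans (sym (∑-*ˡ (triples n) (χ (tedges t) G) _)) (∑-cong (triples n) λ {u} _ → trans (cong (λ z → χ (tedges t) G * (χ (tedges u) G * z)) (∑-triangles G _))
        (trans (trans (sym (*-assoc (χ (tedges t) G) (χ (tedges u) G) _)) (sym (∑-*ˡ (triples n) (χ (tedges t) G * χ (tedges u) G) _))) (∑-cong (triples n) λ {w} _ →
          trans (solve 4 (λ a b c x → a :* b :* (c :* x) := x :* (a :* (b :* c))) refl (χ (tedges t) G) (χ (tedges u) G) (χ (tedges w) G) (𝟙 (conflict? t u) * (𝟙 (conflict? t w) * 𝟙 (¬? (u ≟ₜ w)))))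
            (cong (𝟙 (conflict? t u) * (𝟙 (conflict? t w) * 𝟙 (¬? (u ≟ₜ w))) *_) (χ-triple t u w)))))))

  pp = p * p

  -- In the relevant case w shares an edge with t but is not inside the union, so it has one or two
  -- new edges. One new edge means meet 2, where the second summand exceeds p; two mean meet 1,
  -- where the first is p².
  weight-bound : ∀ {t u w} → t ∈ triples n → u ∈ triples n → w ∈ triples n → let S = union t u in
    𝟙 (conflict? t w) * 𝟙 (¬? (u ≟ₜ w)) * p ^ℚ length (H.fresh S w) ≤ℚ pp * H.meet S w + p * (H.meet S w * H.meet S w - H.meet S w)
  weight-bound {t} {u} {w} i j k = 𝟙-elim (λ z → z * 𝟙 (¬? (u ≟ₜ w)) * p ^ℚ length (H.fresh S w) ≤ℚ rhs) (conflict? t w)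
      (λ c → 𝟙-elim (λ z → 1ℚ * z * p ^ℚ length (H.fresh S w) ≤ℚ rhs) (¬? (u ≟ₜ w)) (λ ne → main c ne)
        (λ _ → subst (_≤ℚ rhs) (sym (*-zeroˡ (p ^ℚ length (H.fresh S w)))) rhs≥0))
      (λ _ → subst (_≤ℚ rhs) (solve 2 (λ a b → con 0ℚ := con 0ℚ :* a :* b) refl (𝟙 (¬? (u ≟ₜ w))) (p ^ℚ length (H.fresh S w))) rhs≥0)
    where
    S = union t u
    uS = proj₁ (union-valid i j)
    M = H.meet S w
    rhs = pp * M + p * (M * M - M)
    rhs≥0 : rhs ≥0
    rhs≥0 = +≥0 (*≥0 (*≥0 p≥0 p≥0) (H.meet≥0 S w)) (*≥0 p≥0 (H.pairs-meet≥0 uS k))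
    main : Conflict t w → u ≢ w → 1ℚ * 1ℚ * p ^ℚ length (H.fresh S w) ≤ℚ rhs
    main c ne = go (length (H.fresh S w)) refl (fresh<3 {S} {w} (Any.map (∈-++⁺ʳ (H.fresh (tedges t) u)) (shared (proj₂ c))))
      where
      value : ∀ {l} → length (H.fresh S w) ≡ l → M ≡ 3ℚ - ⟨ l ⟩
      value e = trans (H.meet-fresh uS k) (cong (λ l → 3ℚ - ⟨ l ⟩) e)
      go : ∀ l → length (H.fresh S w) ≡ l → l ≤ 2 → 1ℚ * 1ℚ * p ^ℚ length (H.fresh S w) ≤ℚ rhs
      go 0 e _ = contradiction e (fresh-twice i j k c ne)
      go 1 e _ = subst₂ (λ a M → 1ℚ * 1ℚ * p ^ℚ a ≤ℚ pp * M + p * (M * M - M)) (sym e) (sym (value e))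
        (≤-by (+≥0 (*≥0 (nonNegative⁻¹ 2ℚ) (*≥0 p≥0 p≥0)) p≥0) (solve 1 (λ p → p :* p :* con 2ℚ :+ p :* con 2ℚ := con 1ℚ :* con 1ℚ :* (p :* con 1ℚ) :+ (con 2ℚ :* (p :* p) :+ p)) refl p))
      go 2 e _ = subst₂ (λ a M → 1ℚ * 1ℚ * p ^ℚ a ≤ℚ pp * M + p * (M * M - M)) (sym e) (sym (value e))
        (≤-reflexive (solve 1 (λ p → con 1ℚ :* con 1ℚ :* (p :* (p :* con 1ℚ)) := p :* p :* con 1ℚ :+ p :* con 0ℚ) refl p))
      go (suc (suc (suc _))) _ (s≤s (s≤s ()))

  E-triple : ∀ {t u w} → t ∈ triples n → u ∈ triples n → w ∈ triples n → let M = H.meet (union t u) w in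
    E (triple-term t u w) ≤ℚ 𝟙 (conflict? t u) * (p ^ℚ 5 * (pp * M + p * (M * M - M)))
  E-triple {t} {u} {w} i j k = subst (_≤ℚ 𝟙 (conflict? t u) * (p ^ℚ 5 * rhs)) (sym (𝔼-* p (pairs n) (𝟙 (conflict? t u) * b) (χ (H.fresh S w ++ S)))) (go (conflict? t u))
    where
    S = union t u
    M = H.meet S w
    rhs = pp * M + p * (M * M - M)
    b = 𝟙 (conflict? t w) * 𝟙 (¬? (u ≟ₜ w))
    go : (d : Dec (Conflict t u)) → 𝟙 d * b * E (χ (H.fresh S w ++ S)) ≤ℚ 𝟙 d * (p ^ℚ 5 * rhs)
    go (no _) = ≤-reflexive (solve 3 (λ b e r → con 0ℚ :* b :* e := con 0ℚ :* r) refl b (E (χ (H.fresh S w ++ S))) (p ^ℚ 5 * rhs))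
    go (yes c) = subst₂ _≤ℚ_ (sym (trans (cong (1ℚ * b *_) (trans (E-χ (H.fresh-Valid (union-valid i j) k)) (trans (cong (p ^ℚ_) (trans (Listₚ.length-++ (H.fresh S w))
          (cong (length (H.fresh S w) ℕ.+_) (trans (Listₚ.length-++ (H.fresh (tedges t) u)) (cong (ℕ._+ 3) (fresh-conflict i j c)))))) (^-+ p (length (H.fresh S w)) 5))))
        (solve 3 (λ b x y → con 1ℚ :* b :* (x :* y) := y :* (b :* x)) refl b (p ^ℚ length (H.fresh S w)) (p ^ℚ 5))))
      (sym (*-identityˡ (p ^ℚ 5 * rhs))) (*-monoˡ (^≥0 p≥0 5) (weight-bound i j k))

  -- For the five edges of a conflicting pair the meets sum to 5 D and their ordered pairs to at
  -- most 25. The pairs themselves contribute Tr 3 D p⁵, which is `density`.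
  sparse₂ : 2ℚ * E bad ≤ℚ density * (⟨ 5 ⟩ * (D * pp) + ⟨ 25 ⟩ * p)
  sparse₂ = subst₂ _≤ℚ_ (𝔼-* p (pairs n) 2ℚ bad) total (≤-trans (𝔼-mono p≥0 p≤1 (pairs n) λ s → bad≤ (⊑-Unique s pairs-unique))
      (subst (_≤ℚ Tr * (3ℚ * D * (p ^ℚ 5 * K))) (sym (trans (𝔼-∑ p (pairs n) (triples n) _) (∑-cong (triples n) λ _ → trans (𝔼-∑ p (pairs n) (triples n) _) (∑-cong (triples n) λ _ → 𝔼-∑ p (pairs n) (triples n) _))))
        (subst (∑[ t ∈ triples n ] ∑[ u ∈ triples n ] ∑[ w ∈ triples n ] E (triple-term t u w) ≤ℚ_) (∑-const (triples n) (3ℚ * D * (p ^ℚ 5 * K)))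
          (∑-mono (triples n) λ {t} i → ≤-trans (∑-mono (triples n) λ {u} j → inner i j)
            (subst (_≤ℚ 3ℚ * D * (p ^ℚ 5 * K)) (sym (∑-*ʳ (triples n) (p ^ℚ 5 * K) _)) (*-monoʳ (*≥0 (^≥0 p≥0 5) K≥0) (∑-conflict i)))))))
    where
    K = pp * (⟨ 5 ⟩ * D) + p * ⟨ 25 ⟩
    K≥0 : K ≥0
    K≥0 = +≥0 (*≥0 (*≥0 p≥0 p≥0) (*≥0 (⟨⟩≥0 5) D≥0)) (*≥0 p≥0 (⟨⟩≥0 25))
    inner : ∀ {t u} → t ∈ triples n → u ∈ triples n → ∑[ w ∈ triples n ] E (triple-term t u w) ≤ℚ 𝟙 (conflict? t u) * (p ^ℚ 5 * K)
    inner {t} {u} i j = ≤-trans (∑-mono (triples n) λ k → E-triple i j k) (≤-trans (≤-reflexive (trans (∑-*ˡ (triples n) (𝟙 (conflict? t u)) _) (cong (𝟙 (conflict? t u) *_) (∑-*ˡ (triples n) (p ^ℚ 5) _))))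
        (go (conflict? t u)))
      where
      S = union t u
      M : Triple n → ℚ
      M w = H.meet S w
      go : (d : Dec (Conflict t u)) → 𝟙 d * (p ^ℚ 5 * (∑[ w ∈ triples n ] (pp * M w + p * (M w * M w - M w)))) ≤ℚ 𝟙 d * (p ^ℚ 5 * K)
      go (no _) = ≤-reflexive (trans (*-zeroˡ (p ^ℚ 5 * (∑[ w ∈ triples n ] (pp * M w + p * (M w * M w - M w))))) (sym (*-zeroˡ (p ^ℚ 5 * K))))
      go (yes c) = *-monoˡ 0≤1 (*-monoˡ (^≥0 p≥0 5) (subst (_≤ℚ K) (sym (trans (∑-+ (triples n) _ _) (cong₂ _+_ (∑-*ˡ (triples n) pp M) (∑-*ˡ (triples n) p _))))
          (+-mono-≤ (*-monoˡ (*≥0 p≥0 p≥0) (≤-reflexive (trans (H.∑-meet (proj₂ (union-valid i j))) (cong (λ l → ⟨ l ⟩ * D) size))))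
            (*-monoˡ p≥0 (≤-trans (H.∑-pairs-meet (union-valid i j)) (≤-reflexive (cong (λ l → ⟨ l ⟩ * ⟨ l ⟩) size)))))))
        where size : length (union t u) ≡ 5
              size = trans (Listₚ.length-++ (H.fresh (tedges t) u)) (cong (ℕ._+ 3) (fresh-conflict i j c))
    total : Tr * (3ℚ * D * (p ^ℚ 5 * K)) ≡ density * (⟨ 5 ⟩ * (D * pp) + ⟨ 25 ⟩ * p)
    total = trans (solve 4 (λ T D x K → T :* (con 3ℚ :* D :* (x :* K)) := con 3ℚ :* T :* (D :* (x :* K))) refl Tr D (p ^ℚ 5) K)
      (trans (cong (_* (D * (p ^ℚ 5 * K))) triple-count)
        (solve 4 (λ N D x p → N :* D :* (D :* (x :* (p :* p :* (con ⟨ 5 ⟩ :* D) :+ p :* con ⟨ 25 ⟩))) := N :* (D :* D) :* x :* (con ⟨ 5 ⟩ :* (D :* (p :* p)) :+ con ⟨ 25 ⟩ :* p)) refl N D (p ^ℚ 5) p))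

-- Comparison of the two estimates

⟨⟩-^ : ∀ m j → ⟨ m ℕ.^ j ⟩ ≡ ⟨ m ⟩ ^ℚ j
⟨⟩-^ m zero    = refl
⟨⟩-^ m (suc j) = trans (⟨⟩-* m (m ℕ.^ j)) (cong (⟨ m ⟩ *_) (⟨⟩-^ m j))

lit : ℕ → ℚ
lit k = ℤ.+ k ℚ./ 1

lit≡⟨⟩ : ∀ k → lit k ≡ ⟨ k ⟩
lit≡⟨⟩ k = ℚₚ.toℚᵘ-injective (ℚᵘₚ.≃-trans (ℚₚ.toℚᵘ-fromℚᵘ (ℚᵘ.mkℚᵘ (ℤ.+ k) 0)) (ℚᵘₚ.≃-sym (toℚᵘ-⟨⟩ k)))

-- Certified table for the inequality between the two estimates; t is a multiple of the density, and on the
-- interval [a, b] of values of t the quantities x, Q, R are at most ξ/S, at least κ/S and at most ρ/S.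
module Table (S M c e f g k s J J′ : ℕ) (S>0 : 1 ≤ S) (M>0 : 1 ≤ M) (e>0 : 1 ≤ e) (g>0 : 1 ≤ g) where

  Cell : Set
  Cell = ℕ × ℕ × ℕ × ℕ

  -- Bounds for a whole cell: x and R decrease in t and are bounded above at the left end a; Q
  -- decreases too, but is bounded below, at the right end b, where the factor t is also estimated.
  -- Everything is cleared of denominators so that it can be decided over ℕ.
  Ok : ℕ → Cell → Set
  Ok a (b , ξ , κ , ρ) =
    g ℕ.* (S ℕ.* S) ≤ ξ ℕ.* ξ ℕ.* (g ℕ.+ k ℕ.* a) × c ℕ.* b ≤ M × κ ℕ.* M ℕ.^ J ≤ S ℕ.* (M ∸ c ℕ.* b) ℕ.^ J ×
    S ℕ.* e ℕ.^ J′ ≤ ρ ℕ.* (e ℕ.+ f ℕ.* a) ℕ.^ J′ × 480 ℕ.* ξ ℕ.+ b ℕ.* ρ ℕ.+ s ≤ 120 ℕ.* S ℕ.+ 360 ℕ.* κ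

  ok? : ∀ a z → Dec (Ok a z)
  ok? a (b , ξ , κ , ρ) = (_ ℕ.≤? _) ×-dec (_ ℕ.≤? _) ×-dec (_ ℕ.≤? _) ×-dec (_ ℕ.≤? _) ×-dec (_ ℕ.≤? _)

  data Chain (a : ℕ) : List Cell → ℕ → Set where
    last : ∀ z → Ok a z → Chain a [ z ] (proj₁ z)
    next : ∀ z {zs b} → Ok a z → Chain (proj₁ z) zs b → Chain a (z ∷ zs) b

  end : ℕ → List Cell → ℕ
  end a []       = a
  end a (z ∷ zs) = end (proj₁ z) zs

  chain? : ∀ a z zs → Dec (Chain a (z ∷ zs) (end a (z ∷ zs)))
  chain? a z [] = map′ (last z) (λ { (last _ o) → o ; (next _ o ()) }) (ok? a z)
  chain? a z (z′ ∷ zs) = map′ (λ (o , h) → next z o h) (λ { (next _ o h) → o , h }) (ok? a z ×-dec chain? (proj₁ z) z′ zs)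

  GoalOf : (S M c e f g k s c₁ c₂ c₃ t : ℚ) → Set
  GoalOf S M c e f g k s c₁ c₂ c₃ t = ∀ {x w v Q R} → x ≥0 → x * x * (g + k * t) ≤ℚ g → M * w ≤ℚ c * t → (1ℚ - w) ^ℚ J ≤ℚ Q →
    f * t ≤ℚ e * v → R ≥0 → (1ℚ + v) ^ℚ J′ * R ≤ℚ 1ℚ → c₁ * (x * S) + t * (R * S) + s ≤ℚ c₂ * S + c₃ * (Q * S)

  Goal : ℚ → Set
  Goal = GoalOf ⟨ S ⟩ ⟨ M ⟩ ⟨ c ⟩ ⟨ e ⟩ ⟨ f ⟩ ⟨ g ⟩ ⟨ k ⟩ ⟨ s ⟩ ⟨ 480 ⟩ ⟨ 120 ⟩ ⟨ 360 ⟩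

  private
    pos : ∀ {m} → 1 ≤ m → 0ℚ <ℚ ⟨ m ⟩
    pos {suc m} _ = ⟨suc⟩>0 m

  cell : ∀ {a z} → Ok a z → ∀ {t} → ⟨ a ⟩ ≤ℚ t → t ≤ℚ ⟨ proj₁ z ⟩ → Goal t
  cell {a} {b , ξ , κ , ρ} (o₁ , o₂ , o₃ , o₄ , o₅) {t} a≤t t≤b {x} {w} {v} {Q} {R} x≥0 hx hw hQ hv R≥0 hR = ≤-trans
      (+-monoˡ-≤ ⟨ s ⟩ (+-mono-≤ (*-monoˡ (⟨⟩≥0 480) xS≤ξ) (*-mono t≥0 (*≥0 R≥0 (⟨⟩≥0 S)) t≤b RS≤ρ)))
      (≤-trans (subst₂ _≤ℚ_ (trans (⟨⟩-+ (480 ℕ.* ξ ℕ.+ b ℕ.* ρ) s) (cong (_+ ⟨ s ⟩) (trans (⟨⟩-+ (480 ℕ.* ξ) (b ℕ.* ρ)) (cong₂ _+_ (⟨⟩-* 480 ξ) (⟨⟩-* b ρ)))))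
          (trans (⟨⟩-+ (120 ℕ.* S) (360 ℕ.* κ)) (cong₂ _+_ (⟨⟩-* 120 S) (⟨⟩-* 360 κ))) (⟨⟩-mono o₅))
        (+-monoʳ-≤ (⟨ 120 ⟩ * ⟨ S ⟩) (*-monoˡ (⟨⟩≥0 360) κ≤QS)))
    where
    t≥0 : t ≥0
    t≥0 = ≤-trans (⟨⟩≥0 a) a≤t
    A = ⟨ g ⟩ + ⟨ k ⟩ * ⟨ a ⟩
    A≡ : ⟨ g ℕ.+ k ℕ.* a ⟩ ≡ A
    A≡ = trans (⟨⟩-+ g (k ℕ.* a)) (cong (⟨ g ⟩ +_) (⟨⟩-* k a))
    A>0 : 0ℚ <ℚ A
    A>0 = <-≤-trans (pos g>0) (≤-by (*≥0 (⟨⟩≥0 k) (⟨⟩≥0 a)) refl)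
    xS≤ξ : x * ⟨ S ⟩ ≤ℚ ⟨ ξ ⟩
    xS≤ξ = sq-cancel (⟨⟩≥0 ξ) (*-cancelˡ A>0 (≤-trans
      (≤-by (*≥0 (*≥0 (sq≥0 x) (*≥0 (⟨⟩≥0 k) (diff≥0 a≤t))) (sq≥0 ⟨ S ⟩)) (solve 6 (λ x S g k a t → x :* x :* (g :+ k :* t) :* (S :* S) :=
        (g :+ k :* a) :* (x :* S :* (x :* S)) :+ x :* x :* (k :* (t :- a)) :* (S :* S)) refl x ⟨ S ⟩ ⟨ g ⟩ ⟨ k ⟩ ⟨ a ⟩ t))
      (≤-trans (*-monoʳ (sq≥0 ⟨ S ⟩) hx) (subst₂ _≤ℚ_ (trans (⟨⟩-* g (S ℕ.* S)) (cong (⟨ g ⟩ *_) (⟨⟩-* S S)))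
        (trans (⟨⟩-* (ξ ℕ.* ξ) (g ℕ.+ k ℕ.* a)) (trans (cong₂ _*_ (⟨⟩-* ξ ξ) A≡) (*-comm (⟨ ξ ⟩ * ⟨ ξ ⟩) A))) (⟨⟩-mono o₁)))))
    m = M ∸ c ℕ.* b
    m≡ : ⟨ m ⟩ + ⟨ c ⟩ * ⟨ b ⟩ ≡ ⟨ M ⟩
    m≡ = trans (cong (⟨ m ⟩ +_) (sym (⟨⟩-* c b))) (trans (sym (⟨⟩-+ m (c ℕ.* b))) (cong ⟨_⟩ (ℕₚ.m∸n+n≡m o₂)))
    κ≤QS : ⟨ κ ⟩ ≤ℚ Q * ⟨ S ⟩
    κ≤QS = *-cancelˡ (^>0 (pos M>0) J) (≤-trans (subst₂ _≤ℚ_ (trans (⟨⟩-* κ (M ℕ.^ J)) (trans (cong (⟨ κ ⟩ *_) (⟨⟩-^ M J)) (*-comm ⟨ κ ⟩ _)))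
        (trans (⟨⟩-* S (m ℕ.^ J)) (cong (⟨ S ⟩ *_) (⟨⟩-^ m J))) (⟨⟩-mono o₃))
      (≤-trans (*-monoˡ (⟨⟩≥0 S) (≤-trans (^-mono (⟨⟩≥0 m) m≤ J) (subst (_≤ℚ ⟨ M ⟩ ^ℚ J * Q) (sym (*-^ ⟨ M ⟩ (1ℚ - w) J)) (*-monoˡ (^≥0 (⟨⟩≥0 M) J) hQ))))
        (≤-reflexive (solve 3 (λ s m q → s :* (m :* q) := m :* (q :* s)) refl ⟨ S ⟩ (⟨ M ⟩ ^ℚ J) Q))))
      where
      m≤ : ⟨ m ⟩ ≤ℚ ⟨ M ⟩ * (1ℚ - w)
      m≤ = ≤-by (+≥0 (diff≥0 hw) (*≥0 (⟨⟩≥0 c) (diff≥0 t≤b))) (trans (solve 2 (λ M w → M :* (con 1ℚ :- w) := M :- M :* w) refl ⟨ M ⟩ w)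
        (trans (cong (_- ⟨ M ⟩ * w) (sym m≡)) (solve 5 (λ m c b t z → m :+ c :* b :- z := m :+ (c :* t :- z :+ c :* (b :- t))) refl ⟨ m ⟩ ⟨ c ⟩ ⟨ b ⟩ t (⟨ M ⟩ * w))))
    RS≤ρ : R * ⟨ S ⟩ ≤ℚ ⟨ ρ ⟩
    RS≤ρ = ≤-trans (≤-trans (*-monoˡ R≥0 S≤) (≤-reflexive (solve 3 (λ r p q → r :* (p :* q) := p :* (q :* r)) refl R ⟨ ρ ⟩ ((1ℚ + v) ^ℚ J′))))
      (subst (⟨ ρ ⟩ * ((1ℚ + v) ^ℚ J′ * R) ≤ℚ_) (*-identityʳ ⟨ ρ ⟩) (*-monoˡ (⟨⟩≥0 ρ) hR))
      where
      e≤ : ⟨ e ⟩ + ⟨ f ⟩ * ⟨ a ⟩ ≤ℚ ⟨ e ⟩ * (1ℚ + v)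
      e≤ = ≤-by (+≥0 (diff≥0 hv) (*≥0 (⟨⟩≥0 f) (diff≥0 a≤t))) (solve 5 (λ e f a t v → e :* (con 1ℚ :+ v) := e :+ f :* a :+ (e :* v :- f :* t :+ f :* (t :- a))) refl ⟨ e ⟩ ⟨ f ⟩ ⟨ a ⟩ t v)
      S≤ : ⟨ S ⟩ ≤ℚ ⟨ ρ ⟩ * (1ℚ + v) ^ℚ J′
      S≤ = *-cancelˡ (^>0 (pos e>0) J′) (≤-trans (subst₂ _≤ℚ_ (trans (⟨⟩-* S (e ℕ.^ J′)) (trans (cong (⟨ S ⟩ *_) (⟨⟩-^ e J′)) (*-comm ⟨ S ⟩ _)))
          (trans (⟨⟩-* ρ ((e ℕ.+ f ℕ.* a) ℕ.^ J′)) (cong (⟨ ρ ⟩ *_) (trans (⟨⟩-^ (e ℕ.+ f ℕ.* a) J′) (cong (_^ℚ J′) (trans (⟨⟩-+ e (f ℕ.* a)) (cong (⟨ e ⟩ +_) (⟨⟩-* f a))))))) (⟨⟩-mono o₄))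
        (≤-trans (*-monoˡ (⟨⟩≥0 ρ) (^-mono (+≥0 (⟨⟩≥0 e) (*≥0 (⟨⟩≥0 f) (⟨⟩≥0 a))) e≤ J′))
          (≤-reflexive (trans (cong (⟨ ρ ⟩ *_) (*-^ ⟨ e ⟩ (1ℚ + v) J′)) (solve 3 (λ r e q → r :* (e :* q) := e :* (r :* q)) refl ⟨ ρ ⟩ (⟨ e ⟩ ^ℚ J′) ((1ℚ + v) ^ℚ J′))))))

  sound : ∀ {a zs b} → Chain a zs b → ∀ {t} → ⟨ a ⟩ ≤ℚ t → t ≤ℚ ⟨ b ⟩ → Goal t
  sound (last z o) a≤t t≤b = cell {z = z} o a≤t t≤b
  sound (next z o h) {t} a≤t t≤b = [ (λ p → cell {z = z} o a≤t p) , (λ p → sound h p t≤b) ]′ (≤-total t ⟨ proj₁ z ⟩)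

  -- The unary ⟨_⟩ must not be evaluated at large numerals, hence the restatement with lit.
  sound-lit : ∀ {a zs b} → Chain a zs b → ∀ {t} → lit a ≤ℚ t → t ≤ℚ lit b →
    GoalOf (lit S) (lit M) (lit c) (lit e) (lit f) (lit g) (lit k) (lit s) (lit 480) (lit 120) (lit 360) t
  sound-lit {a} {zs} {b} h {t} a≤t t≤b = transport (eq S) (eq M) (eq c) (eq e) (eq f) (eq g) (eq k) (eq s) (eq 480) (eq 120) (eq 360)
      (sound h (subst (_≤ℚ t) (lit≡⟨⟩ a) a≤t) (subst (t ≤ℚ_) (lit≡⟨⟩ b) t≤b))
    where
    eq : ∀ m → ⟨ m ⟩ ≡ lit m
    eq m = sym (lit≡⟨⟩ m)
    transport : ∀ {S S′ M M′ c c′ e e′ f f′ g g′ k k′ s s′ c₁ c₁′ c₂ c₂′ c₃ c₃′ t} → S ≡ S′ → M ≡ M′ → c ≡ c′ → e ≡ e′ → f ≡ f′ → g ≡ g′ → k ≡ k′ →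
      s ≡ s′ → c₁ ≡ c₁′ → c₂ ≡ c₂′ → c₃ ≡ c₃′ → GoalOf S M c e f g k s c₁ c₂ c₃ t → GoalOf S′ M′ c′ e′ f′ g′ k′ s′ c₁′ c₂′ c₃′ t
    transport refl refl refl refl refl refl refl refl refl refl refl h {x} {w} {v} {Q} {R} = h {x} {w} {v} {Q} {R}

-- Here t = 60 d, running from 5 (d = 1/12) to 540 (d = 9); values are in units of 1/100000.
table : List (ℕ × ℕ × ℕ × ℕ)
table =
  (9 , 92649 , 92765 , 88322) ∷ (15 , 87808 , 88233 , 80025) ∷ (25 , 81787 , 81162 , 69095) ∷ (40 , 74024 , 71598 , 54254) ∷
        (59 , 65654 , 61072 , 38004) ∷ (82 , 58252 , 50366 , 24480) ∷ (107 , 51946 , 40832 , 14602) ∷ (133 , 46979 , 32815 , 8481) ∷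
        (158 , 43078 , 26585 , 4912) ∷ (181 , 40116 , 21897 , 2955) ∷ (201 , 37870 , 18493 , 1878) ∷ (218 , 36196 , 16016 , 1279) ∷
        (233 , 34935 , 14106 , 929) ∷ (246 , 33925 , 12635 , 705) ∷ (257 , 33117 , 11509 , 557) ∷ (267 , 32477 , 10573 , 457) ∷
        (276 , 31926 , 9795 , 383) ∷ (285 , 31454 , 9074 , 327) ∷ (293 , 31002 , 8477 , 280) ∷ (301 , 30616 , 7919 , 244) ∷
        (309 , 30244 , 7398 , 213) ∷ (317 , 29885 , 6911 , 186) ∷ (326 , 29539 , 6401 , 163) ∷ (335 , 29164 , 5928 , 140) ∷
        (346 , 28802 , 5397 , 121) ∷ (359 , 28378 , 4830 , 101) ∷ (376 , 27900 , 4177 , 82) ∷ (401 , 27310 , 3372 , 63) ∷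
        (447 , 26507 , 2272 , 43) ∷ (540 , 25197 , 1019 , 22) ∷ []

-- The exponentials e^(-d/2) and e^(-3d/2) are represented by (1 - d/256)^128 and (1 + 3d/32)^(-16).
-- In terms of t these are d/256 = t/15360, enlarged by 1001/1000, and 3d/32 = 187.5 t/120000,
-- lowered to 187. The term 33 t is 1980 d, and 72000 is the margin 12/1000 times 60 and 100000.
table-ok : Table.Chain 100000 15360000 1001 120000 187 1000 33 72000 128 16 (s≤s z≤n) (s≤s z≤n) (s≤s z≤n) (s≤s z≤n) 5 table 540
table-ok = toWitness {a? = Table.chain? 100000 15360000 1001 120000 187 1000 33 72000 128 16 (s≤s z≤n) (s≤s z≤n) (s≤s z≤n) (s≤s z≤n) 5 (9 , 92649 , 92765 , 88322) (drop 1 table)} _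

-- Dense graphs

lit-≤ : ∀ {k n} → k ≤ n → lit k ≤ℚ ⟨ n ⟩
lit-≤ {k} {n} h = subst (_≤ℚ ⟨ n ⟩) (sym (lit≡⟨⟩ k)) (⟨⟩-mono h)

halve : ∀ n → ∃[ h ] (h ℕ.+ h ≤ n × n ≤ suc (h ℕ.+ h))
halve zero = 0 , z≤n , z≤n
halve (suc zero) = 0 , z≤n , ℕₚ.≤-refl
halve (suc (suc n)) with halve n
... | h , a , b = suc h , subst (_≤ suc (suc n)) (cong suc (sym (ℕₚ.+-suc h h))) (s≤s (s≤s a)) ,
  subst (λ m → suc (suc n) ≤ suc m) (cong suc (sym (ℕₚ.+-suc h h))) (s≤s (s≤s b))

blocks-of : ∀ j m → ∃[ k ] (k ℕ.* suc j ≤ m × m ≤ suc k ℕ.* suc j)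
blocks-of j zero = 0 , z≤n , z≤n
blocks-of j (suc m) with blocks-of j m
... | k , a , b with suc m ℕ.≤? suc k ℕ.* suc j
...   | yes h = k , ℕₚ.m≤n⇒m≤1+n a , h
...   | no  h = suc k , ℕₚ.<⇒≤ (ℕₚ.≰⇒> h) , ℕₚ.≤-trans (s≤s b) (ℕₚ.+-monoˡ-≤ (suc k ℕ.* suc j) (s≤s (z≤n {j})))

-- For the largest r ≥ 1 with 9 r² ≤ d one has d ≤ 9 (r + 1)² ≤ 36 r².
scale : ∀ {d} → ⟨ 9 ⟩ ≤ℚ d → ∃[ r ] (⟨ 9 ⟩ * (⟨ suc r ⟩ * ⟨ suc r ⟩) ≤ℚ d × d ≤ℚ ⟨ 36 ⟩ * (⟨ suc r ⟩ * ⟨ suc r ⟩))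
scale {d} 9≤d = go m (≤-trans d≤m (≤-by (+≥0 (*≥0 (nonNegative⁻¹ ⟨ 9 ⟩) (+≥0 (*≥0 (⟨⟩≥0 m) (⟨⟩≥0 m)) (*≥0 (nonNegative⁻¹ 2ℚ) (⟨⟩≥0 m)))) (+≥0 (*≥0 (nonNegative⁻¹ ⟨ 17 ⟩) (⟨⟩≥0 m)) (nonNegative⁻¹ ⟨ 36 ⟩)))
    (solve 1 (λ m → con ⟨ 9 ⟩ :* ((con 2ℚ :+ m) :* (con 2ℚ :+ m)) := m :+ (con ⟨ 9 ⟩ :* (m :* m :+ con 2ℚ :* m) :+ (con ⟨ 17 ⟩ :* m :+ con ⟨ 36 ⟩))) refl ⟨ m ⟩)))
  where
  m = proj₁ (archimedean d)
  d≤m = proj₂ (archimedean d)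
  Scale : ℕ → Set
  Scale r = ⟨ 9 ⟩ * (⟨ suc r ⟩ * ⟨ suc r ⟩) ≤ℚ d × d ≤ℚ ⟨ 36 ⟩ * (⟨ suc r ⟩ * ⟨ suc r ⟩)
  finish : ∀ r → ⟨ 9 ⟩ * (⟨ suc r ⟩ * ⟨ suc r ⟩) ≤ℚ d → d ≤ℚ ⟨ 9 ⟩ * ((2ℚ + ⟨ r ⟩) * (2ℚ + ⟨ r ⟩)) → Scale r
  finish r a b = a , ≤-trans b (≤-by (*≥0 (⟨⟩≥0 r) (+≥0 (*≥0 (nonNegative⁻¹ ⟨ 27 ⟩) (⟨⟩≥0 r)) (nonNegative⁻¹ ⟨ 36 ⟩)))
    (solve 1 (λ r → con ⟨ 36 ⟩ :* ((con 1ℚ :+ r) :* (con 1ℚ :+ r)) := con ⟨ 9 ⟩ :* ((con 2ℚ :+ r) :* (con 2ℚ :+ r)) :+ r :* (con ⟨ 27 ⟩ :* r :+ con ⟨ 36 ⟩)) refl ⟨ r ⟩))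
  go : ∀ r → d ≤ℚ ⟨ 9 ⟩ * ((2ℚ + ⟨ r ⟩) * (2ℚ + ⟨ r ⟩)) → ∃[ r ] Scale r
  go zero    b = 0 , finish 0 9≤d b
  go (suc r) b with ≤-total (⟨ 9 ⟩ * (⟨ suc (suc r) ⟩ * ⟨ suc (suc r) ⟩)) d
  ... | inj₁ a = suc r , finish (suc r) a b
  ... | inj₂ a = go r (subst (λ z → d ≤ℚ ⟨ 9 ⟩ * (z * z)) (solve 1 (λ r → con 1ℚ :+ (con 1ℚ :+ r) := con 2ℚ :+ r) refl ⟨ r ⟩) a)

module _ (n : ℕ) where

  open CompleteGraph n
  open Packing n

  -- A random graph of density r p contains r edge-disjoint ones of density p; they are split off
  -- one at a time.
  ν-superadditive : ∀ {p} → p ≥0 → ∀ r → ⟨ r ⟩ * p ≤ℚ 1ℚ →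
    ⟨ r ⟩ * 𝔼 p (pairs n) (λ G → ⟨ ν G ⟩) ≤ℚ 𝔼 (⟨ r ⟩ * p) (pairs n) (λ G → ⟨ ν G ⟩)
  ν-superadditive {p} p≥0 zero h = subst (_≤ℚ 𝔼 (0ℚ * p) (pairs n) (λ G → ⟨ ν G ⟩)) (sym (*-zeroˡ (𝔼 p (pairs n) (λ G → ⟨ ν G ⟩))))
    (𝔼≥0 (*≥0 ≤-refl p≥0) h (pairs n) λ {G} _ → ⟨⟩≥0 (ν G))
  ν-superadditive {p} p≥0 (suc r) h = subst₂ _≤ℚ_ (solve 2 (λ e r → e :+ r :* e := (con 1ℚ :+ r) :* e) refl (E p) ⟨ r ⟩) (cong E eq)
      (≤-trans (+-monoʳ-≤ (E p) (ν-superadditive p≥0 r (≤-trans (≤-by p≥0 (trans (sym eq) (+-comm p (⟨ r ⟩ * p)))) h)))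
        (𝔼-superadditive p≥0 (*≥0 (⟨⟩≥0 r) p≥0) (subst (_≤ℚ 1ℚ) (sym eq) h) (pairs n) size size size λ {G₁} {G₂} {G} s sub →
          subst (_≤ℚ ⟨ ν G ⟩) (⟨⟩-+ (ν G₁) (ν G₂)) (⟨⟩-mono (ν-split s (⊑-Unique sub pairs-unique)))))
    where
    size : List (Edge n) → ℚ
    size G = ⟨ ν G ⟩
    E : ℚ → ℚ
    E p = 𝔼 p (pairs n) size
    eq : p + ⟨ r ⟩ * p ≡ (1ℚ + ⟨ r ⟩) * p
    eq = solve 2 (λ p r → p :+ r :* p := (con 1ℚ :+ r) :* p) refl p ⟨ r ⟩

-- Makes 8 times 16 `η₀` equal to 4/1000, a third of the margin 12/1000 that the table certifies.
η₀ : ℚ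
η₀ = ℤ.+ 1 ℚ./ 32000

module Dense (n : ℕ) (large : 10000000 ≤ n) {p} (p>0 : 0ℚ <ℚ p) (p≤1 : p ≤ℚ 1ℚ)
  (packing : PackingBound ⟨ 36 ⟩ η₀ n)
  (d≥ : 1ℚ ≤ℚ ⟨ 12 ⟩ * (CompleteGraph.D n * (p * p))) where

  open CompleteGraph n

  private
    5≤n : 5 ≤ n
    5≤n = ℕₚ.≤-trans (ℕₚ.m≤m+n 5 9999995) large

  open Sizes n 5≤n
  open Packing n

  p≥0 : p ≥0
  p≥0 = <⇒≤ p>0

  private
    h-data = halve n
    h = proj₁ h-data
    2h≤n = proj₁ (proj₂ h-data)
    n≤2h+1 = proj₂ (proj₂ h-data)
    h≤n : h ≤ n
    h≤n = ℕₚ.≤-trans (ℕₚ.m≤m+n h h) 2h≤n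

  module B = Cut.Bound n h h≤n 2h≤n n≤2h+1 (ℕₚ.≤-trans (s≤s z≤n) 5≤n) D≥0 p≥0 p≤1

  private
    d = D * (p * p)
    d≥0 : d ≥0
    d≥0 = *≥0 D≥0 (*≥0 p≥0 p≥0)
    Eν = 𝔼 p (pairs n) (λ G → ⟨ ν G ⟩)
    Eτ = 𝔼 p (pairs n) (λ G → ⟨ τ G ⟩)
    Np≥0 : N * p ≥0
    Np≥0 = *≥0 N≥0 p≥0
    large-n : lit 10000000 ≤ℚ ⟨ n ⟩
    large-n = lit-≤ large

  E-X : 𝔼 p (pairs n) X ≡ 2ℚ * Eν - Eτ
  E-X = trans (𝔼-- p (pairs n) _ _) (cong (_- Eτ) (𝔼-* p (pairs n) 2ℚ (λ G → ⟨ ν G ⟩)))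

  Dense : Set
  Dense = N * p ≤ℚ lit 1500 * 𝔼 p (pairs n) X

  -- Twelve times the mean of `X` is at least N p (8 (1 - x - 16 `η₀`) - T), hence at least N p
  -- times 12/1000 - 4/1000; and 12 / 0.008 = 1500.
  combine : ∀ {x T} → N * p * (1ℚ - x - η₀ * 16ℚ) ≤ℚ 3ℚ * Eν → ⟨ 12 ⟩ * Eτ ≤ℚ N * p * T →
            T + ⟨ 8 ⟩ * x + ℤ.+ 12 ℚ./ 1000 ≤ℚ ⟨ 8 ⟩ → Dense
  combine {x} {T} ν-low τ-up gap = subst (λ z → N * p ≤ℚ lit 1500 * z) (sym E-X) (≤-by
    (+≥0 (+≥0 (*≥0 (nonNegative⁻¹ (lit 1000)) (diff≥0 ν-low)) (*≥0 (nonNegative⁻¹ (lit 125)) (diff≥0 τ-up))) (*≥0 (nonNegative⁻¹ (lit 125)) (*≥0 Np≥0 (diff≥0 gap))))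
    (solve 5 (λ Np x T v t → con (lit 1500) :* (con 2ℚ :* v :- t) := Np :+ (con (lit 1000) :* (con 3ℚ :* v :- Np :* (con 1ℚ :- x :- con (η₀ * 16ℚ))) :+
      con (lit 125) :* (Np :* T :- con ⟨ 12 ⟩ :* t) :+ con (lit 125) :* (Np :* (con ⟨ 8 ⟩ :- (T :+ con ⟨ 8 ⟩ :* x :+ con (ℤ.+ 12 ℚ./ 1000)))))) refl (N * p) x T Eν Eτ))

  middle : d ≤ℚ ⟨ 9 ⟩ → Dense
  middle d≤9 = combine {x} (proj₂ (proj₂ (proj₂ x-data))) (subst (⟨ 12 ⟩ * Eτ ≤ℚ_)
      (solve 4 (λ Np Q d R → con ⟨ 6 ⟩ :* (Np :* (con 1ℚ :- Q)) :+ Np :* (d :* R) := Np :* (con ⟨ 6 ⟩ :* (con 1ℚ :- Q) :+ d :* R)) refl (N * p) Q d R) B.covering-upper) gap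
    where
    x-data = packing p>0 p≤1 (≤-trans d≤9 (toWitness {a? = ⟨ 9 ⟩ ℚₚ.≤? ⟨ 36 ⟩} _)) d≥
    x = proj₁ x-data
    Q = B.q ^ℚ suc h
    R = B.r ^ℚ h
    t = lit 60 * d
    pp = p * p
    pp≥0 = *≥0 p≥0 p≥0
    lower : lit 5 ≤ℚ t
    lower = ≤-by (*≥0 (nonNegative⁻¹ (lit 5)) (diff≥0 d≥)) (solve 1 (λ d → con (lit 60) :* d := con (lit 5) :+ con (lit 5) :* (con ⟨ 12 ⟩ :* d :- con 1ℚ)) refl d)
    upper : t ≤ℚ lit 540
    upper = *-monoˡ (nonNegative⁻¹ (lit 60)) d≤9
    -- `k` is (h + 1) / 128 rounded up: Q needs a lower bound, and q^(h+1) ≥ (q^k)^128 ≥ (1 - k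
    -- p²)^128.
    k-data = blocks-of 127 (suc h)
    k = suc (proj₁ k-data)
    w = ⟨ k ⟩ * pp
    h-upper : ⟨ h ⟩ + ⟨ h ⟩ ≤ℚ ⟨ n ⟩
    h-upper = subst (_≤ℚ ⟨ n ⟩) (⟨⟩-+ h h) (⟨⟩-mono 2h≤n)
    h-lower : ⟨ n ⟩ ≤ℚ 1ℚ + (⟨ h ⟩ + ⟨ h ⟩)
    h-lower = subst (⟨ n ⟩ ≤ℚ_) (cong (1ℚ +_) (⟨⟩-+ h h)) (⟨⟩-mono n≤2h+1)
    k-upper : ⟨ proj₁ k-data ⟩ * lit 128 ≤ℚ 1ℚ + ⟨ h ⟩
    k-upper = subst (_≤ℚ 1ℚ + ⟨ h ⟩) (trans (⟨⟩-* (proj₁ k-data) 128) (cong (⟨ proj₁ k-data ⟩ *_) (sym (lit≡⟨⟩ 128)))) (⟨⟩-mono (proj₁ (proj₂ k-data)))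
    k≤ : lit 256000 * ⟨ k ⟩ ≤ℚ lit 1001 * D
    k≤ = ≤-by (+≥0 (+≥0 (*≥0 (nonNegative⁻¹ (lit 2000)) (diff≥0 k-upper)) (*≥0 (nonNegative⁻¹ (lit 1000)) (diff≥0 h-upper)))
        (+≥0 (diff≥0 large-n) (nonNegative⁻¹ (lit 9739998))))
      (solve 3 (λ k h n → con (lit 1001) :* (n :- con 2ℚ) := con (lit 256000) :* (con 1ℚ :+ k) :+
        (con (lit 2000) :* (con 1ℚ :+ h :- k :* con (lit 128)) :+ con (lit 1000) :* (n :- (h :+ h)) :+ (n :- con (lit 10000000) :+ con (lit 9739998)))) refl ⟨ proj₁ k-data ⟩ ⟨ h ⟩ ⟨ n ⟩)
    hw : lit 15360000 * w ≤ℚ lit 1001 * t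
    hw = ≤-by (*≥0 (nonNegative⁻¹ (lit 60)) (*≥0 pp≥0 (diff≥0 k≤)))
      (solve 3 (λ k D q → con (lit 1001) :* (con (lit 60) :* (D :* q)) := con (lit 15360000) :* (k :* q) :+ con (lit 60) :* (q :* (con (lit 1001) :* D :- con (lit 256000) :* k))) refl ⟨ k ⟩ D pp)
    w≤1 : w ≤ℚ 1ℚ
    w≤1 = *-cancelˡ {lit 15360000} (positive⁻¹ (lit 15360000)) (≤-trans hw (≤-trans (*-monoˡ (nonNegative⁻¹ (lit 1001)) upper)
      (toWitness {a? = lit 1001 * lit 540 ℚₚ.≤? lit 15360000 * 1ℚ} _)))
    hQ : (1ℚ - w) ^ℚ 128 ≤ℚ Q
    hQ = ≤-trans (^-mono (diff≥0 w≤1) (bernoulli B.pp≤1 k) 128) (subst (_≤ℚ Q) (trans (cong (B.q ^ℚ_) (ℕₚ.*-comm k 128)) (^-* B.q 128 k)) (B.^-antitone B.q≥0 B.q≤1 (proj₂ (proj₂ k-data))))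
    -- R needs an upper bound, so the rounding goes the other way: 16 l ≤ h.
    l-data = blocks-of 15 h
    l = proj₁ l-data
    ζ = 3ℚ * pp - 2ℚ * (p * pp)
    v = ⟨ l ⟩ * ζ
    -- Keeps the cubic term of ζ below the loss from 187.5 to 187; it follows from D p² ≤ 9 and n ≥
    -- 10000000.
    p≤ : lit 1000 * p ≤ℚ 1ℚ
    p≤ = sq-cancel 0≤1 (*-cancelˡ {⟨ 9 ⟩} (positive⁻¹ ⟨ 9 ⟩) (≤-trans (≤-by (*≥0 (+≥0 (diff≥0 large-n) (nonNegative⁻¹ (lit 999998))) pp≥0)
        (solve 2 (λ n p → (n :- con 2ℚ) :* (p :* p) := con ⟨ 9 ⟩ :* (con (lit 1000) :* p :* (con (lit 1000) :* p)) :+ (n :- con (lit 10000000) :+ con (lit 999998)) :* (p :* p)) refl ⟨ n ⟩ p))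
      d≤9))
    l-lower : ⟨ h ⟩ ≤ℚ (1ℚ + ⟨ l ⟩) * lit 16
    l-lower = subst (⟨ h ⟩ ≤ℚ_) (trans (⟨⟩-* (suc l) 16) (cong ((1ℚ + ⟨ l ⟩) *_) (sym (lit≡⟨⟩ 16)))) (⟨⟩-mono (proj₂ (proj₂ l-data)))
    l≥ : lit 8 * lit 187 * D ≤ℚ lit 8 * lit 5996 * ⟨ l ⟩
    l≥ = ≤-by (+≥0 (+≥0 (*≥0 (nonNegative⁻¹ (lit 1499 * lit 2)) (diff≥0 l-lower)) (*≥0 (nonNegative⁻¹ (lit 1499)) (diff≥0 h-lower))) (+≥0 (*≥0 (nonNegative⁻¹ (lit 3)) (diff≥0 large-n)) (nonNegative⁻¹ (lit 29953525))))
      (solve 3 (λ l h n → con (lit 8 * lit 5996) :* l := con (lit 8 * lit 187) :* (n :- con 2ℚ) :+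
        (con (lit 1499 * lit 2) :* ((con 1ℚ :+ l) :* con (lit 16) :- h) :+ con (lit 1499) :* (con 1ℚ :+ (h :+ h) :- n) :+ (con (lit 3) :* (n :- con (lit 10000000)) :+ con (lit 29953525)))) refl ⟨ l ⟩ ⟨ h ⟩ ⟨ n ⟩)
    hv : lit 187 * t ≤ℚ lit 120000 * v
    hv = *-cancelˡ {lit 8} (positive⁻¹ (lit 8)) (≤-by (+≥0 (*≥0 (nonNegative⁻¹ (lit 60)) (*≥0 pp≥0 (diff≥0 l≥))) (*≥0 (nonNegative⁻¹ (lit 1920)) (*≥0 (⟨⟩≥0 l) (*≥0 pp≥0 (diff≥0 p≤)))))
      (solve 3 (λ l D p → con (lit 8) :* (con (lit 120000) :* (l :* (con 3ℚ :* (p :* p) :- con 2ℚ :* (p :* (p :* p))))) :=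
        con (lit 8) :* (con (lit 187) :* (con (lit 60) :* (D :* (p :* p)))) :+ (con (lit 60) :* (p :* p :* (con (lit 8 * lit 5996) :* l :- con (lit 8 * lit 187) :* D)) :+
          con (lit 1920) :* (l :* (p :* p :* (con 1ℚ :- con (lit 1000) :* p))))) refl ⟨ l ⟩ D p))
    ζ≥0 : ζ ≥0
    ζ≥0 = subst _≥0 (solve 1 (λ p → p :* p :* (con 1ℚ :+ con 2ℚ :* (con 1ℚ :- p)) := con 3ℚ :* (p :* p) :- con 2ℚ :* (p :* (p :* p))) refl p)
      (*≥0 pp≥0 (+≥0 0≤1 (*≥0 (nonNegative⁻¹ 2ℚ) (diff≥0 p≤1))))
    ζ≤1 : ζ ≤ℚ 1ℚ
    ζ≤1 = ≤-by B.r≥0 (solve 1 (λ z → con 1ℚ := z :+ (con 1ℚ :- z)) refl ζ)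
    hR : (1ℚ + v) ^ℚ 16 * R ≤ℚ 1ℚ
    hR = ≤-trans (*-monoˡ (^≥0 v≥0 16) (subst (R ≤ℚ_) (trans (cong (B.r ^ℚ_) (ℕₚ.*-comm l 16)) (^-* B.r 16 l)) (B.^-antitone B.r≥0 B.r≤1 (proj₁ (proj₂ l-data)))))
        (subst (_≤ℚ 1ℚ) (*-^ (1ℚ + v) (B.r ^ℚ l) 16) (^≤1 (*≥0 v≥0 (^≥0 B.r≥0 l)) (subst (_≤ℚ 1ℚ) (*-comm (B.r ^ℚ l) (1ℚ + v)) (pow-decay ζ≥0 ζ≤1 l)) 16))
      where v≥0 : 1ℚ + v ≥0
            v≥0 = +≥0 0≤1 (*≥0 (⟨⟩≥0 l) ζ≥0)
    hx : x * x * (lit 1000 + lit 33 * t) ≤ℚ lit 1000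
    hx = subst (_≤ℚ lit 1000) (solve 2 (λ x d → con (lit 10) :* (x :* x :* (con ⟨ 100 ⟩ :+ con ⟨ 198 ⟩ :* d)) := x :* x :* (con (lit 1000) :+ con (lit 33) :* (con (lit 60) :* d))) refl x d)
      (*-monoˡ (nonNegative⁻¹ (lit 10)) (proj₁ (proj₂ (proj₂ x-data))))
    certified : lit 480 * (x * lit 100000) + t * (R * lit 100000) + lit 72000 ≤ℚ lit 120 * lit 100000 + lit 360 * (Q * lit 100000)
    certified = Table.sound-lit 100000 15360000 1001 120000 187 1000 33 72000 128 16 (s≤s z≤n) (s≤s z≤n) (s≤s z≤n) (s≤s z≤n) table-ok lower upper
      {x} {w} {v} {Q} {R} (proj₁ (proj₂ x-data)) hx hw hQ hv (^≥0 B.r≥0 h) hR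
    gap : ⟨ 6 ⟩ * (1ℚ - Q) + d * R + ⟨ 8 ⟩ * x + ℤ.+ 12 ℚ./ 1000 ≤ℚ ⟨ 8 ⟩
    gap = *-cancelˡ {lit 6000000} (positive⁻¹ (lit 6000000)) (≤-by (diff≥0 certified)
      (solve 4 (λ x Q d R → con (lit 6000000) :* con ⟨ 8 ⟩ := con (lit 6000000) :* (con ⟨ 6 ⟩ :* (con 1ℚ :- Q) :+ d :* R :+ con ⟨ 8 ⟩ :* x :+ con (ℤ.+ 12 ℚ./ 1000)) :+
        (con (lit 120) :* con (lit 100000) :+ con (lit 360) :* (Q :* con (lit 100000)) :- (con (lit 480) :* (x :* con (lit 100000)) :+ con (lit 60) :* d :* (R :* con (lit 100000)) :+ con (lit 72000)))) refl x Q d R))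

  -- For d ≥ 9 the crude bound τ ≤ half the edges, that is T = 6, is good enough: x ≤ 6/25 and 6 + 8
  -- x stays below 8. Dividing p by r brings d into the range where `packing` applies, and x is
  -- taken there.
  upper-range : ⟨ 9 ⟩ ≤ℚ d → Dense
  upper-range 9≤d = combine {x} ν-low (subst (⟨ 12 ⟩ * Eτ ≤ℚ_) (*-comm ⟨ 6 ⟩ (N * p)) (subst (_≤ℚ ⟨ 6 ⟩ * (N * p)) (solve 1 (λ t → con ⟨ 6 ⟩ :* (con 2ℚ :* t) := con ⟨ 12 ⟩ :* t) refl Eτ)
      (*-monoˡ (nonNegative⁻¹ ⟨ 6 ⟩) B.half-upper)))
      (≤-trans (+-monoˡ-≤ (ℤ.+ 12 ℚ./ 1000) (+-monoʳ-≤ ⟨ 6 ⟩ (*-monoˡ (nonNegative⁻¹ ⟨ 8 ⟩) x≤))) (toWitness {a? = ⟨ 6 ⟩ + ⟨ 8 ⟩ * (ℤ.+ 6 ℚ./ 25) + ℤ.+ 12 ℚ./ 1000 ℚₚ.≤? ⟨ 8 ⟩} _))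
    where
    r-data = scale 9≤d
    r = suc (proj₁ r-data)
    inv = inverse (⟨suc⟩>0 (proj₁ r-data))
    i = proj₁ inv
    i>0 = proj₁ (proj₂ inv)
    p′ = i * p
    rp′ : ⟨ r ⟩ * p′ ≡ p
    rp′ = trans (solve 3 (λ r i p → r :* (i :* p) := i :* r :* p) refl ⟨ r ⟩ i p) (trans (cong (_* p) (proj₂ (proj₂ inv))) (*-identityˡ p))
    p′>0 : 0ℚ <ℚ p′
    p′>0 = *>0 i>0 p>0
    p′≤1 : p′ ≤ℚ 1ℚ
    p′≤1 = ≤-trans (≤-by (*≥0 (⟨⟩≥0 (proj₁ r-data)) (<⇒≤ p′>0)) (trans (sym rp′) (solve 2 (λ k q → (con 1ℚ :+ k) :* q := q :+ k :* q) refl ⟨ proj₁ r-data ⟩ p′))) p≤1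
    rr = ⟨ r ⟩ * ⟨ r ⟩
    rr>0 : 0ℚ <ℚ rr
    rr>0 = *>0 (⟨suc⟩>0 (proj₁ r-data)) (⟨suc⟩>0 (proj₁ r-data))
    d′ = D * (p′ * p′)
    d≡ : d ≡ rr * d′
    d≡ = trans (cong (λ z → D * (z * z)) (sym rp′)) (solve 3 (λ D r q → D :* (r :* q :* (r :* q)) := r :* r :* (D :* (q :* q))) refl D ⟨ r ⟩ p′)
    d′≥9 : ⟨ 9 ⟩ ≤ℚ d′
    d′≥9 = *-cancelˡ rr>0 (subst₂ _≤ℚ_ (*-comm ⟨ 9 ⟩ rr) d≡ (proj₁ (proj₂ r-data)))
    d′≤36 : d′ ≤ℚ ⟨ 36 ⟩
    d′≤36 = *-cancelˡ rr>0 (subst₂ _≤ℚ_ d≡ (*-comm ⟨ 36 ⟩ rr) (proj₂ (proj₂ r-data)))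
    x-data = packing p′>0 p′≤1 d′≤36 (≤-trans (toWitness {a? = 1ℚ ℚₚ.≤? ⟨ 12 ⟩ * ⟨ 9 ⟩} _) (*-monoˡ (nonNegative⁻¹ ⟨ 12 ⟩) d′≥9))
    x = proj₁ x-data
    ν-low : N * p * (1ℚ - x - η₀ * 16ℚ) ≤ℚ 3ℚ * Eν
    ν-low = ≤-trans (subst₂ _≤ℚ_ (trans (solve 4 (λ r N q y → r :* (N :* q :* y) := N :* (r :* q) :* y) refl ⟨ r ⟩ N p′ (1ℚ - x - η₀ * 16ℚ)) (cong (λ z → N * z * (1ℚ - x - η₀ * 16ℚ)) rp′))
        (solve 2 (λ r e → r :* (con 3ℚ :* e) := con 3ℚ :* (r :* e)) refl ⟨ r ⟩ (𝔼 p′ (pairs n) (λ G → ⟨ ν G ⟩)))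
        (*-monoˡ (⟨⟩≥0 r) (proj₂ (proj₂ (proj₂ x-data)))))
      (*-monoˡ (nonNegative⁻¹ 3ℚ) (subst (λ z → ⟨ r ⟩ * 𝔼 p′ (pairs n) (λ G → ⟨ ν G ⟩) ≤ℚ 𝔼 z (pairs n) (λ G → ⟨ ν G ⟩)) rp′
        (ν-superadditive n (<⇒≤ p′>0) r (subst (_≤ℚ 1ℚ) (sym rp′) p≤1))))
    x≤ : x ≤ℚ ℤ.+ 6 ℚ./ 25
    x≤ = sq-cancel (nonNegative⁻¹ (ℤ.+ 6 ℚ./ 25)) (*-cancelˡ {lit 1882} (positive⁻¹ (lit 1882)) (≤-trans
      (≤-by (*≥0 (sq≥0 x) (*≥0 (nonNegative⁻¹ ⟨ 198 ⟩) (diff≥0 d′≥9))) (solve 2 (λ x d → x :* x :* (con ⟨ 100 ⟩ :+ con ⟨ 198 ⟩ :* d) := con (lit 1882) :* (x :* x) :+ x :* x :* (con ⟨ 198 ⟩ :* (d :- con ⟨ 9 ⟩))) refl x d′))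
      (≤-trans (proj₁ (proj₂ (proj₂ x-data))) (toWitness {a? = ⟨ 100 ⟩ ℚₚ.≤? lit 1882 * ((ℤ.+ 6 ℚ./ 25) * (ℤ.+ 6 ℚ./ 25))} _))))

  dense : Dense
  dense = [ middle , upper-range ]′ (≤-total d ⟨ 9 ⟩)

-- The witnesses are huge numerals: unfolding them during conversion checking must be avoided.
opaque

  packing-36 : ∃[ n₁ ] (∀ n → n₁ ≤ n → PackingBound ⟨ 36 ⟩ η₀ n)
  packing-36 = packing-lower (1≤⟨suc⟩ 35) (positive⁻¹ η₀)

  eventually₅ : ∀ a b c d e → ∃[ m ] (∀ {n} → m ≤ n → a ≤ n × b ≤ n × c ≤ n × d ≤ n × e ≤ n)
  eventually₅ a b c d e = a ℕ.+ (b ℕ.+ (c ℕ.+ (d ℕ.+ e))) , λ h₁ →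
    let h₂ = ℕₚ.m+n≤o⇒n≤o a h₁ ; h₃ = ℕₚ.m+n≤o⇒n≤o b h₂ ; h₄ = ℕₚ.m+n≤o⇒n≤o c h₃ in
    ℕₚ.m+n≤o⇒m≤o a h₁ , ℕₚ.m+n≤o⇒m≤o b h₂ , ℕₚ.m+n≤o⇒m≤o c h₃ , ℕₚ.m+n≤o⇒m≤o d h₄ , ℕₚ.m+n≤o⇒n≤o d h₄

-- Choice of the thresholds and the final case distinction

module Threshold {ε : ℚ} (ε>0 : 0ℚ <ℚ ε) where

  private
    inv = inverse ε>0
    e = proj₁ inv
    e>0 : 0ℚ <ℚ e
    e>0 = proj₁ (proj₂ inv)
    eε : e * ε ≡ 1ℚ
    eε = proj₂ (proj₂ inv)
    -- Above `density` 64 / ε the estimate `sparse₁` suffices. Below it, `sparse₂` gives ε once D p²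
    -- and p are at most κ, since B (5 κ + 25 κ) = 2 ε.
    B = ⟨ 64 ⟩ * e
    B>0 : 0ℚ <ℚ B
    B>0 = *>0 (⟨suc⟩>0 63) e>0
    inv-15B = inverse (*>0 (⟨suc⟩>0 14) B>0)
    κ = ε * proj₁ inv-15B
    κ>0 : 0ℚ <ℚ κ
    κ>0 = *>0 ε>0 (proj₁ (proj₂ inv-15B))
    15Bκ : ⟨ 15 ⟩ * B * κ ≡ ε
    15Bκ = trans (solve 3 (λ b ε i → b :* (ε :* i) := ε :* (i :* b)) refl (⟨ 15 ⟩ * B) ε (proj₁ inv-15B))
      (trans (cong (ε *_) (proj₂ (proj₂ inv-15B))) (*-identityʳ ε))
    inv-κ = inverse κ>0
    i = proj₁ inv-κ
    i-pow : ∀ j → i ^ℚ j * κ ^ℚ j ≡ 1ℚ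
    i-pow j = trans (sym (*-^ i κ j)) (trans (cong (_^ℚ j) (proj₂ (proj₂ inv-κ))) (1^ j))
    n₁ = packing-36
    -- `n₂` serves the dense case, `n₃` forces D p² ≤ κ and `n₄` forces p ≤ κ when `density` ≤ B.
    n₂ = archimedean (lit 216000000 * e)
    n₃ = archimedean (2ℚ * B * i ^ℚ 3 + 1ℚ)
    n₄ = archimedean (B * i ^ℚ 5 + 1ℚ)

  n-data : _
  n-data = eventually₅ 10000000 (proj₁ n₁) (proj₁ n₂) (proj₁ n₃) (proj₁ n₄)

  n₀ : ℕ
  n₀ = proj₁ n-data

  private
    ε-from : ∀ {b c} → b * (c * e) ≤ℚ c → 0ℚ <ℚ c → b ≤ℚ ε
    ε-from {b} {c} h c>0 = *-cancelˡ (*>0 c>0 e>0) (subst₂ _≤ℚ_ (*-comm b (c * e))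
      (trans (sym (*-identityʳ c)) (trans (cong (c *_) (sym eε)) (sym (*-assoc c e ε)))) h)

    impossible : ∀ {b j} {n : ℕ} → b * i ^ℚ j + 1ℚ ≤ℚ ⟨ n ⟩ → ⟨ n ⟩ * κ ^ℚ j ≤ℚ b → ⊥
    impossible {b} {j} {n} big h = <-irrefl refl (<-≤-trans (^>0 κ>0 j) (≤-by (diff≥0 (≤-trans (*-monoʳ (<⇒≤ (^>0 κ>0 j)) big) h))
      (trans (solve 2 (λ b k → con 0ℚ := k :+ (b :- (b :* con 1ℚ :+ k))) refl b (κ ^ℚ j))
        (cong (λ z → κ ^ℚ j + (b - z)) (trans (cong (λ z → b * z + κ ^ℚ j) (sym (i-pow j)))
          (solve 3 (λ b i k → b :* (i :* k) :+ k := (b :* i :+ con 1ℚ) :* k) refl b (i ^ℚ j) (κ ^ℚ j)))))))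

  module At (n : ℕ) (n₀≤n : n₀ ≤ n) {p} (p≥0 : p ≥0) (p≤1 : p ≤ℚ 1ℚ) where

    private
      sizes = proj₂ n-data n₀≤n
      large : 10000000 ≤ n
      large = proj₁ sizes
      n₁≤n = proj₁ (proj₂ sizes)
      n₂≤n = ≤-trans (proj₂ n₂) (⟨⟩-mono (proj₁ (proj₂ (proj₂ sizes))))
      n₃≤n = ≤-trans (proj₂ n₃) (⟨⟩-mono (proj₁ (proj₂ (proj₂ (proj₂ sizes)))))
      n₄≤n = ≤-trans (proj₂ n₄) (⟨⟩-mono (proj₂ (proj₂ (proj₂ (proj₂ sizes)))))
      5≤n : 5 ≤ n
      5≤n = ℕₚ.≤-trans (ℕₚ.m≤m+n 5 9999995) large

    open CompleteGraph n
    open Sizes n 5≤n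
    open Packing n using (bad; X)

    private
      E-bad = 𝔼 p (pairs n) bad
      density = Probability.density n 5≤n p≥0 p≤1
      E-bad≥0 : E-bad ≥0
      E-bad≥0 = Probability.E-bad≥0 n 5≤n p≥0 p≤1
      pp = p * p
      pp≥0 : pp ≥0
      pp≥0 = *≥0 p≥0 p≥0
      nD≤2N : ⟨ n ⟩ * D ≤ℚ 2ℚ * N
      nD≤2N = ≤-by n≥0 (trans (solve 2 (λ N n → con 2ℚ :* N := N :+ N :+ n :- n) refl N ⟨ n ⟩) (trans (cong (_- ⟨ n ⟩) N-double)
        (solve 1 (λ n → n :* n :- n := n :* (n :- con 2ℚ) :+ n) refl ⟨ n ⟩)))

    very-sparse : density ≤ℚ B → E-bad ≤ℚ ε
    very-sparse ≤B = *-cancelˡ (positive⁻¹ 2ℚ) (≤-trans (Probability.sparse₂ n 5≤n p≥0 p≤1) (≤-trans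
        (*-mono (*≥0 (*≥0 N≥0 (*≥0 D≥0 D≥0)) (^≥0 p≥0 5)) (+≥0 (*≥0 (⟨⟩≥0 5) (*≥0 D≥0 pp≥0)) (*≥0 (⟨⟩≥0 25) p≥0)) ≤B (+-mono-≤ (*-monoˡ (⟨⟩≥0 5) d≤κ) (*-monoˡ (⟨⟩≥0 25) p≤κ)))
        (≤-reflexive (trans (solve 2 (λ B k → B :* (con ⟨ 5 ⟩ :* k :+ con ⟨ 25 ⟩ :* k) := con 2ℚ :* (con ⟨ 15 ⟩ :* B :* k)) refl B κ) (cong (2ℚ *_) 15Bκ)))))
      where
      -- n (D p²)³ ≤ 2 `density` ≤ 2 B, so that D p² > κ would keep n below 2 B / κ³. Likewise n p⁵
      -- ≤ `density` for the bound on p.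
      d≤κ : D * pp ≤ℚ κ
      d≤κ = [ id , (λ h → ⊥-elim (impossible {2ℚ * B} {3} {n} n₃≤n (≤-trans (*-monoˡ n≥0 (^-mono (<⇒≤ κ>0) h 3)) (≤-trans
          (≤-by (+≥0 (*≥0 (diff≥0 nD≤2N) (*≥0 (*≥0 D≥0 D≥0) (^≥0 p≥0 6))) (*≥0 (nonNegative⁻¹ 2ℚ) (*≥0 (*≥0 (*≥0 N≥0 (*≥0 D≥0 D≥0)) (^≥0 p≥0 5)) (diff≥0 p≤1))))
            (solve 4 (λ n D p N → con 2ℚ :* (N :* (D :* D) :* (p :^ 5)) := n :* ((D :* (p :* p)) :^ 3) :+
              ((con 2ℚ :* N :- n :* D) :* (D :* D :* (p :^ 6)) :+ con 2ℚ :* (N :* (D :* D) :* (p :^ 5) :* (con 1ℚ :- p)))) refl ⟨ n ⟩ D p N))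
          (subst (2ℚ * density ≤ℚ_) refl (*-monoˡ (nonNegative⁻¹ 2ℚ) ≤B)))))) ]′ (≤-total (D * pp) κ)
      p≤κ : p ≤ℚ κ
      p≤κ = [ id , (λ h → ⊥-elim (impossible {B} {5} {n} n₄≤n
          (≤-trans (*-mono n≥0 (^≥0 (<⇒≤ κ>0) 5) n≤ND² (^-mono (<⇒≤ κ>0) h 5)) ≤B))) ]′ (≤-total p κ)
        where
        1≤D : 1ℚ ≤ℚ D
        1≤D = ≤-trans (toWitness {a? = 1ℚ ℚₚ.≤? 3ℚ} _) 3≤D
        n≤ND² : ⟨ n ⟩ ≤ℚ N * (D * D)
        n≤ND² = subst (_≤ℚ N * (D * D)) (*-identityʳ ⟨ n ⟩) (*-mono {c = 1ℚ} n≥0 0≤1 n≤N (*-mono {1ℚ} {D} {1ℚ} {D} 0≤1 0≤1 1≤D 1≤D))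

    -- Chebyshev with mean at least N p / 1500 gives 9000000 / (N p), and N p ≥ n / 24 in this
    -- range.
    dense-case : 0ℚ <ℚ p → 1ℚ ≤ℚ ⟨ 12 ⟩ * (D * pp) → E-bad ≤ℚ ε
    dense-case p>0 d≥ = ε-from (≤-trans (*-monoˡ E-bad≥0 n₂≤n) bound) (positive⁻¹ (lit 216000000))
      where
      third = ℤ.+ 1 ℚ./ 1500
      m = third * (N * p)
      m≥0 : m ≥0
      m≥0 = *≥0 (nonNegative⁻¹ third) (*≥0 N≥0 p≥0)
      m≤ : m ≤ℚ 𝔼 p (pairs n) X
      m≤ = subst (m ≤ℚ_) (trans (sym (*-assoc third (lit 1500) (𝔼 p (pairs n) X))) (*-identityˡ _)) (*-monoˡ (nonNegative⁻¹ third) (Dense.dense n large p>0 p≤1 (proj₂ n₁ n n₁≤n) d≥))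
      Np>0 : 0ℚ <ℚ N * p
      Np>0 = *>0 (<-≤-trans (<-≤-trans (positive⁻¹ ⟨ 5 ⟩) 5≤⟨n⟩) n≤N) p>0
      E-bad-Np : E-bad * (N * p) ≤ℚ lit 9000000
      E-bad-Np = *-cancelˡ Np>0 (subst₂ _≤ℚ_
        (solve 2 (λ b x → con (lit 2250000) :* (b :* (con third :* x :* (con third :* x))) := x :* (b :* x)) refl E-bad (N * p))
        (solve 2 (λ N p → con (lit 2250000) :* (N :* (p :* con 4ℚ)) := N :* p :* con (lit 9000000)) refl N p)
        (*-monoˡ (nonNegative⁻¹ (lit 2250000)) (Probability.E-bad≤ n 5≤n p≥0 p≤1 m≥0 m≤)))
      n≤24Np : ⟨ n ⟩ ≤ℚ ⟨ 24 ⟩ * (N * p)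
      n≤24Np = ≤-by (+≥0 (+≥0 (*≥0 n≥0 (diff≥0 d≥)) (*≥0 (nonNegative⁻¹ ⟨ 12 ⟩) (*≥0 pp≥0 (diff≥0 nD≤2N)))) (*≥0 (nonNegative⁻¹ ⟨ 24 ⟩) (*≥0 N≥0 (*≥0 p≥0 (diff≥0 p≤1)))))
        (solve 4 (λ n D p N → con ⟨ 24 ⟩ :* (N :* p) := n :+ (n :* (con ⟨ 12 ⟩ :* (D :* (p :* p)) :- con 1ℚ) :+ con ⟨ 12 ⟩ :* (p :* p :* (con 2ℚ :* N :- n :* D)) :+
          con ⟨ 24 ⟩ :* (N :* (p :* (con 1ℚ :- p))))) refl ⟨ n ⟩ D p N)
      bound : E-bad * ⟨ n ⟩ ≤ℚ lit 216000000
      bound = ≤-trans (*-monoˡ E-bad≥0 n≤24Np) (subst (_≤ℚ lit 216000000) (solve 2 (λ b x → con ⟨ 24 ⟩ :* (b :* x) := b :* (con ⟨ 24 ⟩ :* x)) refl E-bad (N * p))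
        (*-monoˡ (nonNegative⁻¹ ⟨ 24 ⟩) E-bad-Np))

    conclusion : badProb n p ≤ℚ ε
    conclusion = subst (_≤ℚ ε) (sym (badProb-𝔼 n p)) (cases (<-cmp 0ℚ p))
      where
      cases : _ → E-bad ≤ℚ ε
      cases (tri> _ _ p<0) = contradiction (<-≤-trans p<0 p≥0) (<-irrefl refl)
      -- `sparse₁` cancels N p and so excludes p = 0, where `density` vanishes.
      cases (tri≈ _ 0≡p _) = very-sparse (subst (_≤ℚ B) (trans (solve 1 (λ x → con 0ℚ := x :* (con 0ℚ :^ 5)) refl (N * (D * D))) (cong (λ z → N * (D * D) * z ^ℚ 5) 0≡p)) (<⇒≤ B>0))
      cases (tri< p>0 _ _) = [ (λ d≤ → [ very-sparse , (λ B≤ → ε-from (≤-trans (*-monoˡ E-bad≥0 B≤) (Probability.sparse₁ n 5≤n p≥0 p≤1 p>0 d≤)) (⟨suc⟩>0 63)) ]′ (≤-total density B)) ,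
        dense-case p>0 ]′ (≤-total (⟨ 12 ⟩ * (D * pp)) 1ℚ)

theorem1p2 : (p : ℕ → ℚ) → (∀ n → (0ℚ ≤ℚ p n) × (p n ≤ℚ 1ℚ)) →
    ∀ (ε : ℚ) → 0ℚ <ℚ ε → ∃[ N ] (∀ n → N ≤ n → badProb n (p n) ≤ℚ ε)
theorem1p2 p bounds ε ε>0 = n₀ , λ n n₀≤n → At.conclusion n n₀≤n (proj₁ (bounds n)) (proj₂ (bounds n))
  where open Threshold ε>0
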